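{- For any complex number $q$ with $|q|<1$, we have $$\sum_{k=0}^{\infty}q^{k^2}[6k+1]\frac{(q;q^2)_k^2\,(q^2;q^4)_k}{(q^4;q^4)_k^3}=\frac{(1+q)(q^2;q^4)_{\infty}(q^6;q^4)_{\infty}}{(q^4;q^4)_{\infty}^2}$$ and $$\sum_{k=0}^{\infty}(-1)^k q^{3k^2}[6k+1]\frac{(q;q^2)_k^3}{(q^4;q^4)_k^3}=\frac{(q^3;q^4)_\infty (q^5;q^4)_\infty}{(q^4;q^4)_\infty^2}.$$
   Context: The $q$-shifted factorial is defined by $(a;q)_n=(1-a)(1-aq)\cdots(1-aq^{n-1})$ for integers $n\geq 1$ and $(a;q)_0=1$. For $|q|<1$, $(a;q)_\infty=\prod_{j=0}^{\infty}(1-aq^j)$. Thus, for example, $(q;q^2)_k=\prod_{j=0}^{k-1}(1-q^{2j+1})$ and $(q^3;q^4)_\infty=\prod_{j=0}^\infty(1-q^{4j+3})$. Powers such as $(a;q)_n^m$ mean $((a;q)_n)^m$. The $q$-integer is $[n]=1+q+\cdots+q^{n-1}$. -}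

module Defs where

open import Algebra.Bundles using (RawRing)
import Algebra.Definitions.RawSemiring as RawSemiringDefs
open import Data.Nat as ℕ using (ℕ; zero; suc)
import Data.Nat.Properties as ℕ
open import Data.Product using (_×_; _,_; proj₁; proj₂; ∃)
open import Data.Rational as ℚ using (ℚ; 0ℚ; 1ℚ; ½; ∣_∣)
import Data.Rational.Properties as ℚ
open import Data.Rational.Solver using (module +-*-Solver)
open import Level using (0ℓ)
open import Relation.Binary.PropositionalEquality using (_≡_; refl; sym; trans; cong; cong₂; subst)
open import Relation.Nullary using (yes; no; contradiction)

-- Reals are Cauchy sequences of rationals.  Both the Cauchy condition
-- and the relations below range over rational ε, and the existential
-- quantifiers are Σ-types, so every sequence carries a modulus.

Cauchy : (ℕ → ℚ) → Set
Cauchy s = ∀ ε → 0ℚ ℚ.< ε →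
  ∃ λ N → ∀ {m n} → N ℕ.≤ m → N ℕ.≤ n → ∣ s m ℚ.- s n ∣ ℚ.< ε

record ℝ : Set where
  constructor mkℝ
  field
    seq    : ℕ → ℚ
    cauchy : Cauchy seq

open ℝ public

infix 4 _≈ᴿ_ _<ᴿ_

_≈ᴿ_ : ℝ → ℝ → Set
x ≈ᴿ y = ∀ ε → 0ℚ ℚ.< ε →
  ∃ λ N → ∀ {n} → N ℕ.≤ n → ∣ seq x n ℚ.- seq y n ∣ ℚ.< ε

-- The gap δ is what makes this a relation between the limits of the
-- sequences; eventual termwise inequality would only give x ≤ y.
_<ᴿ_ : ℝ → ℝ → Set
x <ᴿ y = ∃ λ δ → 0ℚ ℚ.< δ ×
  ∃ λ N → ∀ {n} → N ℕ.≤ n → seq x n ℚ.+ δ ℚ.≤ seq y n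

const-cauchy : ∀ p → Cauchy (λ _ → p)
const-cauchy p ε 0<ε = 0 , λ _ _ → subst (ℚ._< _) (sym (cong ∣_∣ (ℚ.+-inverseʳ p))) 0<ε

+-cauchy : ∀ s t → Cauchy s → Cauchy t → Cauchy (λ n → s n ℚ.+ t n)
+-cauchy s t cs ct ε 0<ε = M ℕ.⊔ N , λ {m} {n} p q → begin-strict
  ∣ (s m ℚ.+ t m) ℚ.- (s n ℚ.+ t n) ∣        ≡⟨ cong ∣_∣ (swap (s m) (t m) (s n) (t n)) ⟩
  ∣ (s m ℚ.- s n) ℚ.+ (t m ℚ.- t n) ∣        ≤⟨ ℚ.∣p+q∣≤∣p∣+∣q∣ (s m ℚ.- s n) (t m ℚ.- t n) ⟩
  ∣ s m ℚ.- s n ∣ ℚ.+ ∣ t m ℚ.- t n ∣        <⟨ ℚ.+-mono-<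
      (proj₂ (cs _ 0<ε/2) (ℕ.m⊔n≤o⇒m≤o M N p) (ℕ.m⊔n≤o⇒m≤o M N q))
      (proj₂ (ct _ 0<ε/2) (ℕ.m⊔n≤o⇒n≤o M N p) (ℕ.m⊔n≤o⇒n≤o M N q)) ⟩
  ε ℚ.* ½ ℚ.+ ε ℚ.* ½                        ≡⟨ sym (ℚ.*-distribˡ-+ ε ½ ½) ⟩
  ε ℚ.* 1ℚ                                   ≡⟨ ℚ.*-identityʳ ε ⟩
  ε                                          ∎
  where
  open ℚ.≤-Reasoning
  0<ε/2 : 0ℚ ℚ.< ε ℚ.* ½
  0<ε/2 = subst (ℚ._< ε ℚ.* ½) (ℚ.*-zeroˡ ½) (ℚ.*-monoˡ-<-pos ½ 0<ε)
  M = proj₁ (cs _ 0<ε/2)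
  N = proj₁ (ct _ 0<ε/2)
  swap : ∀ a b c d → (a ℚ.+ b) ℚ.- (c ℚ.+ d) ≡ (a ℚ.- c) ℚ.+ (b ℚ.- d)
  swap = solve 4 (λ a b c d → (a :+ b) :- (c :+ d) := (a :- c) :+ (b :- d)) refl
    where open +-*-Solver

neg-cauchy : ∀ s → Cauchy s → Cauchy (λ n → ℚ.- s n)
neg-cauchy s cs ε 0<ε = proj₁ (cs _ 0<ε) , λ {m} {n} p q →
  subst (ℚ._< _)
    (trans (sym (ℚ.∣-p∣≡∣p∣ (s m ℚ.- s n))) (cong ∣_∣ (ℚ.neg-distrib-+ (s m) (ℚ.- s n))))
    (proj₂ (cs _ 0<ε) p q)

cauchy-bound : ∀ s → Cauchy s →
  ∃ λ B → 0ℚ ℚ.< B × ∃ λ N → ∀ {n} → N ℕ.≤ n → ∣ s n ∣ ℚ.≤ B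
cauchy-bound s cs = ∣ s N ∣ ℚ.+ 1ℚ , 0<B , N , λ {n} p → begin
  ∣ s n ∣                             ≡⟨ cong ∣_∣ (split (s n) (s N)) ⟩
  ∣ s N ℚ.+ (s n ℚ.- s N) ∣           ≤⟨ ℚ.∣p+q∣≤∣p∣+∣q∣ (s N) (s n ℚ.- s N) ⟩
  ∣ s N ∣ ℚ.+ ∣ s n ℚ.- s N ∣         ≤⟨ ℚ.+-monoʳ-≤ ∣ s N ∣ (ℚ.<⇒≤ (proj₂ (cs _ 0<1) p ℕ.≤-refl)) ⟩
  ∣ s N ∣ ℚ.+ 1ℚ                      ∎
  where
  open ℚ.≤-Reasoning
  0<1 : 0ℚ ℚ.< 1ℚ
  0<1 = ℚ.positive⁻¹ 1ℚ
  N = proj₁ (cs _ 0<1)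
  0<B : 0ℚ ℚ.< ∣ s N ∣ ℚ.+ 1ℚ
  0<B = ℚ.+-mono-≤-< (ℚ.0≤∣p∣ (s N)) 0<1
  split : ∀ a b → a ≡ b ℚ.+ (a ℚ.- b)
  split = solve 2 (λ a b → a := b :+ (a :- b)) refl
    where open +-*-Solver

*-pos : ∀ {p q} → 0ℚ ℚ.< p → 0ℚ ℚ.< q → 0ℚ ℚ.< p ℚ.* q
*-pos {p} {q} 0<p 0<q =
  ℚ.positive⁻¹ (p ℚ.* q) {{ℚ.pos*pos⇒pos p {{ℚ.positive 0<p}} q {{ℚ.positive 0<q}}}}

divide : ∀ {p ε} → 0ℚ ℚ.< p → 0ℚ ℚ.< ε → ∃ λ η → 0ℚ ℚ.< η × p ℚ.* η ≡ ε
divide {p} {ε} 0<p 0<ε = p⁻¹ ℚ.* ε , *-pos 0<p⁻¹ 0<ε ,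
  trans (sym (ℚ.*-assoc p p⁻¹ ε))
    (trans (cong (ℚ._* ε) (ℚ.*-inverseʳ p {{ℚ.>-nonZero 0<p}})) (ℚ.*-identityˡ ε))
  where
  p⁻¹ : ℚ
  p⁻¹ = ℚ.1/_ p {{ℚ.>-nonZero 0<p}}
  0<p⁻¹ : 0ℚ ℚ.< p⁻¹
  0<p⁻¹ = ℚ.positive⁻¹ p⁻¹ {{ℚ.1/pos⇒pos p {{ℚ.positive 0<p}}}}

∣*∣-bound : ∀ {B η} → 0ℚ ℚ.< B → ∀ a b → ∣ a ∣ ℚ.≤ B → ∣ b ∣ ℚ.< η → ∣ a ℚ.* b ∣ ℚ.< B ℚ.* η
∣*∣-bound {B} {η} 0<B a b a≤B b<η = begin-strict
  ∣ a ℚ.* b ∣         ≡⟨ ℚ.∣p*q∣≡∣p∣*∣q∣ a b ⟩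
  ∣ a ∣ ℚ.* ∣ b ∣     ≤⟨ ℚ.*-monoʳ-≤-nonNeg ∣ b ∣ {{ℚ.∣-∣-nonNeg b}} a≤B ⟩
  B ℚ.* ∣ b ∣         <⟨ ℚ.*-monoʳ-<-pos B {{ℚ.positive 0<B}} b<η ⟩
  B ℚ.* η             ∎
  where open ℚ.≤-Reasoning

*-close : ∀ {B C η ε} → 0ℚ ℚ.< B → 0ℚ ℚ.< C → (B ℚ.+ C) ℚ.* η ≡ ε →
  ∀ a b c d → ∣ a ∣ ℚ.≤ B → ∣ d ∣ ℚ.≤ C → ∣ a ℚ.- c ∣ ℚ.< η → ∣ b ℚ.- d ∣ ℚ.< η →
  ∣ a ℚ.* b ℚ.- c ℚ.* d ∣ ℚ.< ε
*-close {B} {C} {η} {ε} 0<B 0<C eq a b c d a≤B d≤C ac bd = begin-strict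
  ∣ a ℚ.* b ℚ.- c ℚ.* d ∣                           ≡⟨ cong ∣_∣ (split a b c d) ⟩
  ∣ a ℚ.* (b ℚ.- d) ℚ.+ d ℚ.* (a ℚ.- c) ∣           ≤⟨ ℚ.∣p+q∣≤∣p∣+∣q∣ (a ℚ.* (b ℚ.- d)) (d ℚ.* (a ℚ.- c)) ⟩
  ∣ a ℚ.* (b ℚ.- d) ∣ ℚ.+ ∣ d ℚ.* (a ℚ.- c) ∣       <⟨ ℚ.+-mono-< (∣*∣-bound 0<B a (b ℚ.- d) a≤B bd)
                                                                   (∣*∣-bound 0<C d (a ℚ.- c) d≤C ac) ⟩
  B ℚ.* η ℚ.+ C ℚ.* η                               ≡⟨ sym (ℚ.*-distribʳ-+ η B C) ⟩
  (B ℚ.+ C) ℚ.* η                                   ≡⟨ eq ⟩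
  ε                                                 ∎
  where
  open ℚ.≤-Reasoning
  split : ∀ a b c d → a ℚ.* b ℚ.- c ℚ.* d ≡ a ℚ.* (b ℚ.- d) ℚ.+ d ℚ.* (a ℚ.- c)
  split = solve 4 (λ a b c d → a :* b :- c :* d := a :* (b :- d) :+ d :* (a :- c)) refl
    where open +-*-Solver

*-cauchy : ∀ s t → Cauchy s → Cauchy t → Cauchy (λ n → s n ℚ.* t n)
*-cauchy s t cs ct ε 0<ε =
  let B , 0<B , K , s≤B = cauchy-bound s cs
      C , 0<C , L , t≤C = cauchy-bound t ct
      η , 0<η , eq      = divide (ℚ.+-mono-< 0<B 0<C) 0<ε
      M , s-close       = cs _ 0<η
      N , t-close       = ct _ 0<η
      P                 = K ℕ.⊔ M
      Q                 = L ℕ.⊔ N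
  in P ℕ.⊔ Q , λ {m} {n} p q →
      let mP = ℕ.m⊔n≤o⇒m≤o P Q p
          mQ = ℕ.m⊔n≤o⇒n≤o P Q p
          nP = ℕ.m⊔n≤o⇒m≤o P Q q
          nQ = ℕ.m⊔n≤o⇒n≤o P Q q
      in *-close 0<B 0<C eq (s m) (t m) (s n) (t n)
           (s≤B (ℕ.m⊔n≤o⇒m≤o K M mP)) (t≤C (ℕ.m⊔n≤o⇒m≤o L N nQ))
           (s-close (ℕ.m⊔n≤o⇒n≤o K M mP) (ℕ.m⊔n≤o⇒n≤o K M nP))
           (t-close (ℕ.m⊔n≤o⇒n≤o L N mQ) (ℕ.m⊔n≤o⇒n≤o L N nQ))

-- Totalised reciprocal, with 0 ↦ 0.  It is only ever applied along
-- sequences that are eventually bounded away from 0.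
recip : ℚ → ℚ
recip p with p ℚ.≟ 0ℚ
... | yes _   = 0ℚ
... | no p≢0  = ℚ.1/_ p {{ℚ.≢-nonZero p≢0}}

recip-inverseˡ : ∀ {p} → 0ℚ ℚ.< p → recip p ℚ.* p ≡ 1ℚ
recip-inverseˡ {p} 0<p with p ℚ.≟ 0ℚ
... | yes p≡0 = contradiction (sym p≡0) (ℚ.<⇒≢ 0<p)
... | no p≢0  = ℚ.*-inverseˡ p {{ℚ.≢-nonZero p≢0}}

0ᴿ 1ᴿ : ℝ
0ᴿ = mkℝ (λ _ → 0ℚ) (const-cauchy 0ℚ)
1ᴿ = mkℝ (λ _ → 1ℚ) (const-cauchy 1ℚ)

recip-close : ∀ {δ ε a b} → 0ℚ ℚ.< δ → 0ℚ ℚ.< ε → δ ℚ.≤ a → δ ℚ.≤ b →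
  ∣ b ℚ.- a ∣ ℚ.< ε ℚ.* (δ ℚ.* δ) → ∣ recip a ℚ.- recip b ∣ ℚ.< ε
recip-close {δ} {ε} {a} {b} 0<δ 0<ε δ≤a δ≤b close =
  ℚ.*-cancelʳ-<-nonNeg (a ℚ.* b) {{ℚ.nonNegative (ℚ.<⇒≤ 0<ab)}} (begin-strict
    ∣ d ∣ ℚ.* (a ℚ.* b)         ≡⟨ cong (∣ d ∣ ℚ.*_) (sym (ℚ.0≤p⇒∣p∣≡p (ℚ.<⇒≤ 0<ab))) ⟩
    ∣ d ∣ ℚ.* ∣ a ℚ.* b ∣       ≡⟨ sym (ℚ.∣p*q∣≡∣p∣*∣q∣ d (a ℚ.* b)) ⟩
    ∣ d ℚ.* (a ℚ.* b) ∣         ≡⟨ cong ∣_∣ clear ⟩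
    ∣ b ℚ.- a ∣                 <⟨ close ⟩
    ε ℚ.* (δ ℚ.* δ)             ≤⟨ ℚ.*-monoˡ-≤-nonNeg ε {{ℚ.nonNegative (ℚ.<⇒≤ 0<ε)}}
                                     (ℚ.≤-trans
                                       (ℚ.*-monoʳ-≤-nonNeg δ {{ℚ.nonNegative (ℚ.<⇒≤ 0<δ)}} δ≤a)
                                       (ℚ.*-monoˡ-≤-nonNeg a {{ℚ.nonNegative (ℚ.<⇒≤ 0<a)}} δ≤b)) ⟩
    ε ℚ.* (a ℚ.* b)             ∎)
  where
  open ℚ.≤-Reasoning
  0<a : 0ℚ ℚ.< a
  0<a = ℚ.<-≤-trans 0<δ δ≤a
  0<b : 0ℚ ℚ.< b
  0<b = ℚ.<-≤-trans 0<δ δ≤b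
  0<ab : 0ℚ ℚ.< a ℚ.* b
  0<ab = *-pos 0<a 0<b
  d : ℚ
  d = recip a ℚ.- recip b
  rearrange : ∀ u v a b → (u ℚ.- v) ℚ.* (a ℚ.* b) ≡ (u ℚ.* a) ℚ.* b ℚ.- (v ℚ.* b) ℚ.* a
  rearrange = solve 4 (λ u v a b →
    (u :- v) :* (a :* b) := (u :* a) :* b :- (v :* b) :* a) refl
    where open +-*-Solver
  clear : d ℚ.* (a ℚ.* b) ≡ b ℚ.- a
  clear = trans (rearrange (recip a) (recip b) a b)
    (cong₂ ℚ._-_
      (trans (cong (ℚ._* b) (recip-inverseˡ 0<a)) (ℚ.*-identityˡ b))
      (trans (cong (ℚ._* a) (recip-inverseˡ 0<b)) (ℚ.*-identityˡ a)))

recip-cauchy : ∀ x → 0ᴿ <ᴿ x → Cauchy (λ n → recip (seq x n))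
recip-cauchy x (δ , 0<δ , K , δ≤x) ε 0<ε =
  let N , close = cauchy x _ (*-pos 0<ε (*-pos 0<δ 0<δ))
      above     = λ {n} k → subst (ℚ._≤ seq x n) (ℚ.+-identityˡ δ) (δ≤x k)
  in K ℕ.⊔ N , λ p q →
       recip-close 0<δ 0<ε
         (above (ℕ.m⊔n≤o⇒m≤o K N p)) (above (ℕ.m⊔n≤o⇒m≤o K N q))
         (close (ℕ.m⊔n≤o⇒n≤o K N q) (ℕ.m⊔n≤o⇒n≤o K N p))

infixl 6 _+ᴿ_ _-ᴿ_
infixl 7 _*ᴿ_
infix  8 -ᴿ_

_+ᴿ_ _*ᴿ_ : ℝ → ℝ → ℝ
x +ᴿ y = mkℝ (λ n → seq x n ℚ.+ seq y n) (+-cauchy (seq x) (seq y) (cauchy x) (cauchy y))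
x *ᴿ y = mkℝ (λ n → seq x n ℚ.* seq y n) (*-cauchy (seq x) (seq y) (cauchy x) (cauchy y))

-ᴿ_ : ℝ → ℝ
-ᴿ x = mkℝ (λ n → ℚ.- seq x n) (neg-cauchy (seq x) (cauchy x))

_-ᴿ_ : ℝ → ℝ → ℝ
x -ᴿ y = x +ᴿ (-ᴿ y)

recipᴿ : (x : ℝ) → 0ᴿ <ᴿ x → ℝ
recipᴿ x 0<x = mkℝ (λ n → recip (seq x n)) (recip-cauchy x 0<x)

fromℚ : ℚ → ℝ
fromℚ p = mkℝ (λ _ → p) (const-cauchy p)

infix 5 _+i_

record ℂ : Set where
  constructor _+i_
  field
    re im : ℝ

open ℂ public

infix  4 _≈_ _#0
infixl 6 _+_ _-_
infixl 7 _*_ _/_⟨_⟩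
infix  8 -_

_≈_ : ℂ → ℂ → Set
z ≈ w = re z ≈ᴿ re w × im z ≈ᴿ im w

0# 1# : ℂ
0# = 0ᴿ +i 0ᴿ
1# = 1ᴿ +i 0ᴿ

_+_ _*_ : ℂ → ℂ → ℂ
z + w = (re z +ᴿ re w) +i (im z +ᴿ im w)
z * w = (re z *ᴿ re w -ᴿ im z *ᴿ im w) +i (re z *ᴿ im w +ᴿ im z *ᴿ re w)

-_ : ℂ → ℂ
- z = (-ᴿ re z) +i (-ᴿ im z)

_-_ : ℂ → ℂ → ℂ
z - w = z + (- w)

∣_∣² : ℂ → ℝ
∣ z ∣² = re z *ᴿ re z +ᴿ im z *ᴿ im z

-- Nonzero in the positive sense needed to divide constructively.
_#0 : ℂ → Set
z #0 = 0ᴿ <ᴿ ∣ z ∣²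

-- The value of a quotient does not depend on the proof d, which only
-- enters the modulus of the resulting Cauchy sequences.
_/_⟨_⟩ : (z w : ℂ) → w #0 → ℂ
z / w ⟨ d ⟩ = z * ((re w *ᴿ r) +i (-ᴿ im w *ᴿ r))
  where
  r : ℝ
  r = recipᴿ ∣ w ∣² d

ℂ-rawRing : RawRing 0ℓ 0ℓ
ℂ-rawRing = record
  { Carrier = ℂ ; _≈_ = _≈_ ; _+_ = _+_ ; _*_ = _*_ ; -_ = -_ ; 0# = 0# ; 1# = 1# }

open RawSemiringDefs (RawRing.rawSemiring ℂ-rawRing) public using (_^_)

-- ∣ z ∣< r abbreviates |z| < r for r ≥ 0, with both sides squared.
infix 4 ∣_∣<_

∣_∣<_ : ℂ → ℝ → Set
∣ z ∣< r = ∣ z ∣² <ᴿ r *ᴿ r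

infix 4 _⟶_

_⟶_ : (ℕ → ℂ) → ℂ → Set
u ⟶ l = ∀ ε → 0ℚ ℚ.< ε → ∃ λ N → ∀ {n} → N ℕ.≤ n → ∣ u n - l ∣< fromℚ ε

partialSum : (ℕ → ℂ) → ℕ → ℂ
partialSum f zero    = 0#
partialSum f (suc n) = partialSum f n + f n

Σ∞_≈_ : (ℕ → ℂ) → ℂ → Set
Σ∞ f ≈ l = partialSum f ⟶ l

infix 4 Σ∞_≈_

[_]⟨_⟩ : ℕ → ℂ → ℂ
[ n ]⟨ q ⟩ = partialSum (q ^_) n

-- ⦅ a ⨾ q ⦆ n is the q-shifted factorial (a;q)_n.
⦅_⨾_⦆ : ℂ → ℂ → ℕ → ℂ
⦅ a ⨾ q ⦆ zero    = 1#
⦅ a ⨾ q ⦆ (suc n) = ⦅ a ⨾ q ⦆ n * (1# - a * q ^ n)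

-- ⦅ a ⨾ q ⦆∞≈ P states that the infinite product (a;q)_∞ converges to P.
⦅_⨾_⦆∞≈_ : ℂ → ℂ → ℂ → Set
⦅ a ⨾ q ⦆∞≈ P = ⦅ a ⨾ q ⦆ ⟶ P

infix 4 ⦅_⨾_⦆∞≈_

{-# OPTIONS --safe #-}

-- Both series are values of
--   T(e) = Σ_k q^(k²) [6k+1] (q;q²)_k³ Π_(j<k) (e - q^(4j+2)) / ((q⁴;q⁴)_k³ (eq;q²)_k),
-- the first at e = 1 and the second at e = 0.  The summand has a WZ companion,
-- which gives, for the n-th partial sums,
--   T_n(e) = (1 - eq²)² / ((1 - eq)(1 - eq³)) · T_n(eq⁴) + g_n(e)
-- with an error g_n(e) bounded by a constant times |e| |q|ⁿ.  Iterating along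
-- e, eq⁴, eq⁸, … and letting first the number of steps and then n tend to
-- infinity relates T(e) to T(0) by an infinite product.  Starting at e = q²,
-- where T(q²) = 1 because all terms after the first vanish, this evaluates T(0);
-- starting at e = 1 it then evaluates T(1).

module Submission where

open import Algebra.Bundles using (CommutativeRing; RawRing)
import Algebra.Definitions.RawSemiring as RawSemiringDefinitions
import Algebra.Properties.AbelianGroup as AbelianGroupProperties
import Algebra.Properties.Ring as RingProperties
import Algebra.Properties.Semiring.Exp as Exp
import Algebra.Properties.Semiring.Mult.TCOptimised as Mult
import Algebra.Solver.Ring
open import Algebra.Solver.Ring.AlmostCommutativeRing
  using (fromCommutativeRing; _-Raw-AlmostCommutative⟶_)
open import Algebra.Structures using (IsCommutativeRing)
open import Data.Integer as ℤ using (ℤ; +_; -[1+_]; +≤+)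
import Data.Integer.Properties as ℤ
open import Data.Integer.Solver using () renaming (module +-*-Solver to ℤ-Solver)
open import Data.Maybe using (Maybe; just; nothing)
open import Data.Nat as ℕ using (ℕ; zero; suc; z≤n; s≤s)
import Data.Nat.Properties as ℕ
open import Data.Nat.Solver using () renaming (module +-*-Solver to ℕ-Solver)
open import Data.Product using (Σ-syntax; _×_; _,_; proj₁; proj₂; ∃)
open import Data.Rational as ℚ using (ℚ; 0ℚ; 1ℚ; ½; ∣_∣; mkℚ)
import Data.Rational.Properties as ℚ
open import Data.Rational.Solver using (module +-*-Solver)
import Data.Rational.Unnormalised as ℚᵘ
import Data.Rational.Unnormalised.Properties as ℚᵘ
open import Data.Sum using (inj₁; inj₂)
open import Defs using (divide; *-pos)
open import Function using (_∘_)
open import Level using (0ℓ)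
open import Relation.Binary.PropositionalEquality as ≡ using (_≡_)
import Relation.Binary.Reasoning.Setoid as SetoidReasoning
open import Relation.Nullary using (yes; no; contradiction)

-- A ring solver with integer coefficients over an arbitrary commutative ring

-- The family T(e) is built so that both series occur in it. At e = 1 the product Π(e - q^(4j+2)) is
-- (q²;q⁴)_k, and (eq;q²)_k cancels one of the three factors (q;q²)_k. At e = 0 it is (-1)^k
-- q^(2k²), which turns q^(k²) into q^(3k²). The order of the two limits matters. The errors g_n(e)
-- carry the factor e, which decays along e, eq⁴, eq⁸, ..., so that after m steps they add up to at
-- most K |q|ⁿ with K independent of m. This bound survives m → ∞ at fixed n, and only then does n
-- make it vanish. The argument is constructive. Norms occur only as rational upper bounds, so no
-- square root is formed, and |q| is replaced by a rational ρ < 1 above it. Inverses are carried as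
-- data; those of the form 1/(1 - z) with |z| ≤ ρ share the bound κ = 1/(1 - ρ).

module IntegerSolver {c ℓ} (R : CommutativeRing c ℓ) where

  open CommutativeRing R
  open RingProperties ring
  open AbelianGroupProperties +-abelianGroup using (⁻¹-∙-comm; ε⁻¹≈ε; ⁻¹-involutive)
  open Mult semiring using (×-homo-+; ×1-homo-*; 1+×) renaming (_×_ to _·_)
  open SetoidReasoning setoid

  private
    -- The optimised multiple lets `⟦ + 1 ⟧` reduce to `1#`, so `con (+ 1)` evaluates to `1#` itself
    -- and `1-homo` is `refl`.
    ⟦_⟧ : ℤ → Carrier
    ⟦ + n ⟧      = n · 1#
    ⟦ -[1+ n ] ⟧ = - (suc n · 1#)

    ⟦-⟧ : ∀ i → ⟦ ℤ.- i ⟧ ≈ - ⟦ i ⟧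
    ⟦-⟧ (+ zero)   = sym ε⁻¹≈ε
    ⟦-⟧ (+ suc n)  = refl
    ⟦-⟧ -[1+ n ]   = sym (⁻¹-involutive _)

    ⟦⊖⟧ : ∀ m n → ⟦ m ℤ.⊖ n ⟧ ≈ m · 1# - n · 1#
    ⟦⊖⟧ zero    zero    = sym (-‿inverseʳ 0#)
    ⟦⊖⟧ zero    (suc n) = sym (+-identityˡ _)
    ⟦⊖⟧ (suc m) zero    = sym (trans (+-congˡ ε⁻¹≈ε) (+-identityʳ _))
    ⟦⊖⟧ (suc m) (suc n) = begin
      ⟦ suc m ℤ.⊖ suc n ⟧                  ≡⟨ ≡.cong ⟦_⟧ (ℤ.[1+m]⊖[1+n]≡m⊖n m n) ⟩
      ⟦ m ℤ.⊖ n ⟧                          ≈⟨ ⟦⊖⟧ m n ⟩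
      m · 1# - n · 1#                      ≈⟨ +-congʳ (+-identityʳ _) ⟨
      (m · 1# + 0#) - n · 1#               ≈⟨ +-congʳ (+-congˡ (-‿inverseʳ 1#)) ⟨
      (m · 1# + (1# - 1#)) - n · 1#        ≈⟨ +-congʳ (+-assoc _ _ _) ⟨
      ((m · 1# + 1#) - 1#) - n · 1#        ≈⟨ +-congʳ (+-congʳ (+-comm _ _)) ⟩
      ((1# + m · 1#) - 1#) - n · 1#        ≈⟨ +-assoc _ _ _ ⟩
      (1# + m · 1#) + (- 1# - n · 1#)      ≈⟨ +-cong (sym (1+× m 1#)) (⁻¹-∙-comm _ _) ⟩
      suc m · 1# - (1# + n · 1#)           ≈⟨ +-congˡ (-‿cong (1+× n 1#)) ⟨
      suc m · 1# - suc n · 1#              ∎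

    ⟦+⟧ : ∀ i j → ⟦ i ℤ.+ j ⟧ ≈ ⟦ i ⟧ + ⟦ j ⟧
    ⟦+⟧ (+ m)    (+ n)    = ×-homo-+ 1# m n
    ⟦+⟧ (+ m)    -[1+ n ] = ⟦⊖⟧ m (suc n)
    ⟦+⟧ -[1+ m ] (+ n)    = trans (⟦⊖⟧ n (suc m)) (+-comm _ _)
    ⟦+⟧ -[1+ m ] -[1+ n ] = begin
      - (suc (suc (m ℕ.+ n)) · 1#)         ≡⟨ ≡.cong (λ k → - (suc k · 1#)) (ℕ.+-suc m n) ⟨
      - ((suc m ℕ.+ suc n) · 1#)           ≈⟨ -‿cong (×-homo-+ 1# (suc m) (suc n)) ⟩
      - (suc m · 1# + suc n · 1#)          ≈⟨ ⁻¹-∙-comm _ _ ⟨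
      - (suc m · 1#) - suc n · 1#          ∎

    ⟦*⟧⁺ : ∀ m n → ⟦ + m ℤ.* + n ⟧ ≈ m · 1# * (n · 1#)
    ⟦*⟧⁺ m n = trans (reflexive (≡.cong ⟦_⟧ (≡.sym (ℤ.pos-* m n)))) (×1-homo-* m n)

    ⟦*⟧ : ∀ i j → ⟦ i ℤ.* j ⟧ ≈ ⟦ i ⟧ * ⟦ j ⟧
    ⟦*⟧ (+ m)    (+ n)    = ⟦*⟧⁺ m n
    ⟦*⟧ (+ m)    -[1+ n ] = begin
      ⟦ + m ℤ.* -[1+ n ] ⟧                 ≡⟨ ≡.cong ⟦_⟧ (ℤ.neg-distribʳ-* (+ m) (+ suc n)) ⟨
      ⟦ ℤ.- (+ m ℤ.* + suc n) ⟧            ≈⟨ ⟦-⟧ (+ m ℤ.* + suc n) ⟩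
      - ⟦ + m ℤ.* + suc n ⟧                ≈⟨ -‿cong (⟦*⟧⁺ m (suc n)) ⟩
      - (m · 1# * (suc n · 1#))            ≈⟨ -‿distribʳ-* _ _ ⟩
      m · 1# * - (suc n · 1#)              ∎
    ⟦*⟧ -[1+ m ] (+ n)    = begin
      ⟦ -[1+ m ] ℤ.* + n ⟧                 ≡⟨ ≡.cong ⟦_⟧ (ℤ.neg-distribˡ-* (+ suc m) (+ n)) ⟨
      ⟦ ℤ.- (+ suc m ℤ.* + n) ⟧            ≈⟨ ⟦-⟧ (+ suc m ℤ.* + n) ⟩
      - ⟦ + suc m ℤ.* + n ⟧                ≈⟨ -‿cong (⟦*⟧⁺ (suc m) n) ⟩
      - (suc m · 1# * (n · 1#))            ≈⟨ -‿distribˡ-* _ _ ⟩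
      - (suc m · 1#) * (n · 1#)            ∎
    ⟦*⟧ -[1+ m ] -[1+ n ] = begin
      (suc m ℕ.* suc n) · 1#               ≈⟨ ×1-homo-* (suc m) (suc n) ⟩
      suc m · 1# * (suc n · 1#)            ≈⟨ ⁻¹-involutive _ ⟨
      - - (suc m · 1# * (suc n · 1#))      ≈⟨ -‿cong (-‿distribˡ-* _ _) ⟩
      - (- (suc m · 1#) * (suc n · 1#))    ≈⟨ -‿distribʳ-* _ _ ⟩
      - (suc m · 1#) * - (suc n · 1#)      ∎

    homomorphism : CommutativeRing.rawRing ℤ.+-*-commutativeRing
                     -Raw-AlmostCommutative⟶ fromCommutativeRing R
    homomorphism = record
      { ⟦_⟧    = ⟦_⟧
      ; +-homo = ⟦+⟧
      ; *-homo = ⟦*⟧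
      ; -‿homo = ⟦-⟧
      ; 0-homo = refl
      ; 1-homo = refl
      }

    -- Equality in `R` need not be decidable, so normal forms are compared through their integer
    -- coefficients.
    decide : ∀ i j → Maybe (⟦ i ⟧ ≈ ⟦ j ⟧)
    decide i j with i ℤ.≟ j
    ... | yes i≡j = just (reflexive (≡.cong ⟦_⟧ i≡j))
    ... | no _    = nothing

  open Algebra.Solver.Ring _ _ homomorphism decide public

  :1 : ∀ {n} → Polynomial n
  :1 = con (+ 1)

-- Rational inequalities

-- Inequalities are certified by writing the difference as a combination of
-- nonnegative quantities; the identity itself is left to the ring solver.
≤-by : ∀ {p q} d → 0ℚ ℚ.≤ d → q ≡ p ℚ.+ d → p ℚ.≤ q
≤-by {p} {q} d 0≤d eq = begin
  p          ≡⟨ ℚ.+-identityʳ p ⟨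
  p ℚ.+ 0ℚ   ≤⟨ ℚ.+-monoʳ-≤ p 0≤d ⟩
  p ℚ.+ d    ≡⟨ eq ⟨
  q          ∎
  where open ℚ.≤-Reasoning

0≤-difference : ∀ {p q} → p ℚ.≤ q → 0ℚ ℚ.≤ q ℚ.- p
0≤-difference {p} {q} p≤q = ≡.subst (ℚ._≤ q ℚ.- p) (ℚ.+-inverseʳ p) (ℚ.+-monoˡ-≤ (ℚ.- p) p≤q)

0≤+ : ∀ {p q} → 0ℚ ℚ.≤ p → 0ℚ ℚ.≤ q → 0ℚ ℚ.≤ p ℚ.+ q
0≤+ = ℚ.+-mono-≤

0≤* : ∀ {p q} → 0ℚ ℚ.≤ p → 0ℚ ℚ.≤ q → 0ℚ ℚ.≤ p ℚ.* q
0≤* {p} {q} 0≤p 0≤q =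
  ℚ.nonNegative⁻¹ (p ℚ.* q)
    {{ℚ.nonNeg*nonNeg⇒nonNeg p {{ℚ.nonNegative 0≤p}} q {{ℚ.nonNegative 0≤q}}}}

*-mono : ∀ {p q r s} → 0ℚ ℚ.≤ p → 0ℚ ℚ.≤ s → p ℚ.≤ q → r ℚ.≤ s → p ℚ.* r ℚ.≤ q ℚ.* s
*-mono {p} {q} {r} {s} 0≤p 0≤s p≤q r≤s =
  ≤-by (p ℚ.* (s ℚ.- r) ℚ.+ (q ℚ.- p) ℚ.* s)
    (0≤+ (0≤* 0≤p (0≤-difference r≤s)) (0≤* (0≤-difference p≤q) 0≤s))
    (solve 4 (λ p q r s → q :* s := p :* r :+ (p :* (s :- r) :+ (q :- p) :* s)) ≡.refl p q r s)
  where open +-*-Solver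

0≤1 : 0ℚ ℚ.≤ 1ℚ
0≤1 = ℚ.nonNegative⁻¹ 1ℚ

0<1 : 0ℚ ℚ.< 1ℚ
0<1 = ℚ.positive⁻¹ 1ℚ

0<½ : 0ℚ ℚ.< ½
0<½ = ℚ.positive⁻¹ ½

half+half : ∀ ε → ε ℚ.* ½ ℚ.+ ε ℚ.* ½ ≡ ε
half+half = solve 1 (λ ε → ε :* con ½ :+ ε :* con ½ := ε) ≡.refl
  where open +-*-Solver

open Exp (CommutativeRing.semiring ℚ.+-*-commutativeRing) public using ()
  renaming (_^_ to infixr 8 _^ℚ_; ^-homo-* to ^ℚ-homo-*)

fromℕ : ℕ → ℚ
fromℕ n = + n ℚ./ 1

fromℕ-suc : ∀ n → fromℕ (suc n) ≡ 1ℚ ℚ.+ fromℕ n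
fromℕ-suc n = ℚ.toℚᵘ-injective (begin
  ℚ.toℚᵘ (fromℕ (suc n))                ≈⟨ ℚ.toℚᵘ-fromℚᵘ (ℚᵘ.mkℚᵘ (+ suc n) 0) ⟩
  ℚᵘ.mkℚᵘ (+ suc n) 0                   ≈⟨ ℚᵘ.*≡* (solve 1 (λ n → (con (+ 1) :+ n) :* con (+ 1)
                                              := (con (+ 1) :* con (+ 1) :+ n :* con (+ 1)) :* con (+ 1)) ≡.refl (+ n)) ⟩
  ℚᵘ.1ℚᵘ ℚᵘ.+ ℚᵘ.mkℚᵘ (+ n) 0           ≈⟨ ℚᵘ.+-congʳ ℚᵘ.1ℚᵘ (ℚ.toℚᵘ-fromℚᵘ (ℚᵘ.mkℚᵘ (+ n) 0)) ⟨
  ℚᵘ.1ℚᵘ ℚᵘ.+ ℚ.toℚᵘ (fromℕ n)          ≈⟨ ℚ.toℚᵘ-homo-+ 1ℚ (fromℕ n) ⟨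
  ℚ.toℚᵘ (1ℚ ℚ.+ fromℕ n)               ∎)
  where
  open ℚᵘ.≃-Reasoning
  open ℤ-Solver

-- For p = (a + 1)/(b + 1), multiplying by the denominator b + 1 leaves the numerator a + 1, which
-- is at least 1.
archimedean : ∀ {p} → 0ℚ ℚ.< p → ∃ λ n → 1ℚ ℚ.≤ fromℕ n ℚ.* p
archimedean {p@(mkℚ (+ suc a) b _)} 0<p = suc b , ℚ.toℚᵘ-cancel-≤ (begin
  ℚᵘ.1ℚᵘ                                    ≤⟨ ℚᵘ.*≤* (+≤+ (s≤s bound)) ⟩
  ℚᵘ.mkℚᵘ (+ suc b) 0 ℚᵘ.* ℚ.toℚᵘ p         ≃⟨ ℚᵘ.*-congʳ (ℚ.toℚᵘ-fromℚᵘ (ℚᵘ.mkℚᵘ (+ suc b) 0)) ⟨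
  ℚ.toℚᵘ (fromℕ (suc b)) ℚᵘ.* ℚ.toℚᵘ p      ≃⟨ ℚ.toℚᵘ-homo-* (fromℕ (suc b)) p ⟨
  ℚ.toℚᵘ (fromℕ (suc b) ℚ.* p)              ∎)
  where
  open ℚᵘ.≤-Reasoning
  bound : b ℕ.+ 0 ℕ.+ 0 ℕ.≤ (a ℕ.+ b ℕ.* suc a) ℕ.* 1
  bound = ℕ.≤-trans (ℕ.≤-reflexive (≡.trans (ℕ.+-identityʳ _) (ℕ.+-identityʳ b)))
    (ℕ.≤-trans (ℕ.m≤m*n b (suc a)) (ℕ.≤-trans (ℕ.m≤n+m _ a) (ℕ.≤-reflexive (≡.sym (ℕ.*-identityʳ _)))))
archimedean {mkℚ (+ zero) b _}  0<p = contradiction 0<p λ { (ℚ.*<* (ℤ.+<+ ())) }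
archimedean {mkℚ ℤ.-[1+ a ] b _} 0<p = contradiction 0<p λ { (ℚ.*<* ()) }

-- Powers of a rational between 0 and 1

pow-nonneg : ∀ {ρ} → 0ℚ ℚ.≤ ρ → ∀ n → 0ℚ ℚ.≤ ρ ^ℚ n
pow-nonneg 0≤ρ zero    = 0≤1
pow-nonneg 0≤ρ (suc n) = 0≤* 0≤ρ (pow-nonneg 0≤ρ n)

pow-decreasing : ∀ {ρ} → 0ℚ ℚ.≤ ρ → ρ ℚ.≤ 1ℚ → ∀ m n → ρ ^ℚ (m ℕ.+ n) ℚ.≤ ρ ^ℚ m
pow-decreasing 0≤ρ ρ≤1 zero zero = ℚ.≤-refl
pow-decreasing {ρ} 0≤ρ ρ≤1 zero (suc n) =
  ≡.subst (ρ ^ℚ suc n ℚ.≤_) (ℚ.*-identityˡ 1ℚ) (*-mono 0≤ρ 0≤1 ρ≤1 (pow-decreasing 0≤ρ ρ≤1 0 n))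
pow-decreasing {ρ} 0≤ρ ρ≤1 (suc m) n =
  *-mono 0≤ρ (pow-nonneg 0≤ρ m) ℚ.≤-refl (pow-decreasing 0≤ρ ρ≤1 m n)

-- Bernoulli's inequality without a division by ρ, which may be 0. The left side decreases with n:
-- consecutive values differ by ρⁿ (n + 1) (1 - ρ)².
bernoulli : ∀ {ρ} → 0ℚ ℚ.≤ ρ → ρ ℚ.≤ 1ℚ → ∀ n → ρ ^ℚ n ℚ.* (1ℚ ℚ.+ fromℕ n ℚ.* (1ℚ ℚ.- ρ)) ℚ.≤ 1ℚ
bernoulli {ρ} 0≤ρ ρ≤1 zero = ℚ.≤-reflexive
  (solve 1 (λ ρ → con 1ℚ :* (con 1ℚ :+ con 0ℚ :* (con 1ℚ :- ρ)) := con 1ℚ) ≡.refl ρ)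
  where open +-*-Solver
bernoulli {ρ} 0≤ρ ρ≤1 (suc n) = ℚ.≤-trans
  (≤-by d
    (0≤* (pow-nonneg 0≤ρ n) (0≤* (0≤+ 0≤1 0≤n) (0≤* 0≤h 0≤h)))
    (≡.trans
      (solve 3 (λ ρ p n → p :* (con 1ℚ :+ n :* (con 1ℚ :- ρ))
        := ρ :* p :* (con 1ℚ :+ (con 1ℚ :+ n) :* (con 1ℚ :- ρ))
          :+ p :* ((con 1ℚ :+ n) :* ((con 1ℚ :- ρ) :* (con 1ℚ :- ρ)))) ≡.refl ρ (ρ ^ℚ n) (fromℕ n))
      (≡.cong (λ k → ρ ℚ.* ρ ^ℚ n ℚ.* (1ℚ ℚ.+ k ℚ.* (1ℚ ℚ.- ρ)) ℚ.+ d) (≡.sym (fromℕ-suc n)))))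
  (bernoulli 0≤ρ ρ≤1 n)
  where
  open +-*-Solver
  d = ρ ^ℚ n ℚ.* ((1ℚ ℚ.+ fromℕ n) ℚ.* ((1ℚ ℚ.- ρ) ℚ.* (1ℚ ℚ.- ρ)))
  0≤h = 0≤-difference ρ≤1
  0≤n : 0ℚ ℚ.≤ fromℕ n
  0≤n = ℚ.nonNegative⁻¹ (fromℕ n) {{ℚ.normalize-nonNeg n 1}}

pow-small : ∀ {ρ ε} → 0ℚ ℚ.≤ ρ → ρ ℚ.< 1ℚ → 0ℚ ℚ.< ε → ∃ λ N → ∀ {n} → N ℕ.≤ n → ρ ^ℚ n ℚ.≤ ε
pow-small {ρ} {ε} 0≤ρ ρ<1 0<ε = N , small
  where
  open +-*-Solver
  0<h : 0ℚ ℚ.< 1ℚ ℚ.- ρ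
  0<h = ≡.subst (ℚ._< 1ℚ ℚ.- ρ) (ℚ.+-inverseʳ ρ) (ℚ.+-monoˡ-< (ℚ.- ρ) ρ<1)
  -- N is chosen with N (1 - ρ) ε ≥ 1, because Bernoulli bounds ρ^N by 1/(1 + N (1 - ρ)).
  arch = archimedean (*-pos 0<h 0<ε)
  N = proj₁ arch
  0≤ρ^N = pow-nonneg 0≤ρ N
  0≤N : 0ℚ ℚ.≤ fromℕ N
  0≤N = ℚ.nonNegative⁻¹ (fromℕ N) {{ℚ.normalize-nonNeg N 1}}
  ρ^N≤ε : ρ ^ℚ N ℚ.≤ ε
  ρ^N≤ε = begin
    ρ ^ℚ N                                          ≤⟨ ≤-by (ρ ^ℚ N ℚ.* (fromℕ N ℚ.* ((1ℚ ℚ.- ρ) ℚ.* ε) ℚ.- 1ℚ) ℚ.+ ρ ^ℚ N ℚ.* ε)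
                                                         (0≤+ (0≤* 0≤ρ^N (0≤-difference (proj₂ arch))) (0≤* 0≤ρ^N (ℚ.<⇒≤ 0<ε)))
                                                         (solve 4 (λ p n h e → p :* (con 1ℚ :+ n :* h) :* e
                                                           := p :+ (p :* (n :* (h :* e) :- con 1ℚ) :+ p :* e))
                                                           ≡.refl (ρ ^ℚ N) (fromℕ N) (1ℚ ℚ.- ρ) ε) ⟩
    ρ ^ℚ N ℚ.* (1ℚ ℚ.+ fromℕ N ℚ.* (1ℚ ℚ.- ρ)) ℚ.* ε
      ≤⟨ *-mono (0≤* 0≤ρ^N (0≤+ 0≤1 (0≤* 0≤N (ℚ.<⇒≤ 0<h)))) (ℚ.<⇒≤ 0<ε) (bernoulli 0≤ρ (ℚ.<⇒≤ ρ<1) N) ℚ.≤-refl ⟩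
    1ℚ ℚ.* ε                                        ≡⟨ ℚ.*-identityˡ ε ⟩
    ε                                               ∎
    where open ℚ.≤-Reasoning
  small : ∀ {n} → N ℕ.≤ n → ρ ^ℚ n ℚ.≤ ε
  small {n} N≤n = ℚ.≤-trans
    (≡.subst (λ k → ρ ^ℚ k ℚ.≤ ρ ^ℚ N) (ℕ.m+[n∸m]≡n N≤n) (pow-decreasing 0≤ρ (ℚ.<⇒≤ ρ<1) N (n ℕ.∸ N)))
    ρ^N≤ε

-- Polynomial identities over the rationals

module ℚ-Identities where

  open IntegerSolver ℚ.+-*-commutativeRing

  [V+1]η : ∀ V η → (V ℚ.+ 1ℚ) ℚ.* η ≡ V ℚ.* η ℚ.+ η
  [V+1]η = solve 2 (λ V η → (V :+ :1) :* η := V :* η :+ η) ≡.refl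

  split-off : ∀ a s → a ≡ a ℚ.* (1ℚ ℚ.- s) ℚ.+ a ℚ.* s
  split-off = solve 2 (λ a s → a := a :* (:1 :- s) :+ a :* s) ≡.refl

  0≡a[1-1] : ∀ a → 0ℚ ≡ a ℚ.* (1ℚ ℚ.- 1ℚ)
  0≡a[1-1] = solve 1 (λ a → con (+ 0) := a :* (:1 :- :1)) ≡.refl

  -- With r = ρ^m and s = ρ^n this appends one term to the closed form of the geometric sum V (ρ^m +
  -- ... + ρ^(m+n-1)).
  telescope : ∀ V κ r s ρ → κ ℚ.* (1ℚ ℚ.- ρ) ≡ 1ℚ →
    V ℚ.* κ ℚ.* r ℚ.* (1ℚ ℚ.- s) ℚ.+ V ℚ.* (r ℚ.* s) ≡ V ℚ.* κ ℚ.* r ℚ.* (1ℚ ℚ.- ρ ℚ.* s)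
  telescope V κ r s ρ inv = begin
    a ℚ.+ V ℚ.* (r ℚ.* s)                                ≡⟨ ≡.cong (a ℚ.+_) (ℚ.*-identityˡ (V ℚ.* (r ℚ.* s))) ⟨
    a ℚ.+ 1ℚ ℚ.* (V ℚ.* (r ℚ.* s))                       ≡⟨ ≡.cong (λ k → a ℚ.+ k ℚ.* (V ℚ.* (r ℚ.* s))) inv ⟨
    a ℚ.+ κ ℚ.* (1ℚ ℚ.- ρ) ℚ.* (V ℚ.* (r ℚ.* s))
      ≡⟨ solve 5 (λ V κ r s ρ → V :* κ :* r :* (:1 :- s) :+ κ :* (:1 :- ρ) :* (V :* (r :* s))
           := V :* κ :* r :* (:1 :- ρ :* s)) ≡.refl V κ r s ρ ⟩
    V ℚ.* κ ℚ.* r ℚ.* (1ℚ ℚ.- ρ ℚ.* s)                   ∎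
    where
    open ≡.≡-Reasoning
    a = V ℚ.* κ ℚ.* r ℚ.* (1ℚ ℚ.- s)

  -- Passing from s to ρs raises D - DCκs by DCκ(1 - ρ)s = DCs. That pays for a factor 1 + Cs and
  -- leaves a nonnegative remainder.
  invariant : ∀ D C κ ρ s → κ ℚ.* (1ℚ ℚ.- ρ) ≡ 1ℚ →
    D ℚ.- D ℚ.* (C ℚ.* κ) ℚ.* (ρ ℚ.* s)
      ≡ (D ℚ.- D ℚ.* (C ℚ.* κ) ℚ.* s) ℚ.* (1ℚ ℚ.+ C ℚ.* s) ℚ.+ D ℚ.* (C ℚ.* κ) ℚ.* s ℚ.* (C ℚ.* s)
  invariant D C κ ρ s inv = begin
    D ℚ.- c ℚ.* (ρ ℚ.* s)
      ≡⟨ solve 5 (λ D C κ ρ s → D :- D :* (C :* κ) :* (ρ :* s)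
           := D :- D :* (C :* κ) :* s :+ κ :* (:1 :- ρ) :* (D :* (C :* s))) ≡.refl D C κ ρ s ⟩
    D ℚ.- c ℚ.* s ℚ.+ κ ℚ.* (1ℚ ℚ.- ρ) ℚ.* (D ℚ.* (C ℚ.* s))
      ≡⟨ ≡.cong (λ k → D ℚ.- c ℚ.* s ℚ.+ k ℚ.* (D ℚ.* (C ℚ.* s))) inv ⟩
    D ℚ.- c ℚ.* s ℚ.+ 1ℚ ℚ.* (D ℚ.* (C ℚ.* s))
      ≡⟨ solve 4 (λ D C κ s → D :- D :* (C :* κ) :* s :+ :1 :* (D :* (C :* s))
           := (D :- D :* (C :* κ) :* s) :* (:1 :+ C :* s) :+ D :* (C :* κ) :* s :* (C :* s)) ≡.refl D C κ s ⟩
    (D ℚ.- c ℚ.* s) ℚ.* (1ℚ ℚ.+ C ℚ.* s) ℚ.+ c ℚ.* s ℚ.* (C ℚ.* s) ∎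
    where
    open ≡.≡-Reasoning
    c = D ℚ.* (C ℚ.* κ)

  a≡a-b+b : ∀ a b → a ≡ a ℚ.- b ℚ.+ b
  a≡a-b+b = solve 2 (λ a b → a := a :- b :+ b) ≡.refl
  assoc₄ : ∀ D C κ ρ s → D ℚ.* (C ℚ.* κ) ℚ.* (ρ ℚ.* s) ≡ D ℚ.* (C ℚ.* ρ ℚ.* κ) ℚ.* s
  assoc₄ = solve 5 (λ D C κ ρ s → D :* (C :* κ) :* (ρ :* s) := D :* (C :* ρ :* κ) :* s) ≡.refl

  exchange : ∀ B G s κ → B ℚ.* (G ℚ.* s) ℚ.* κ ≡ B ℚ.* G ℚ.* κ ℚ.* s
  exchange = solve 4 (λ B G s κ → B :* (G :* s) :* κ := B :* G :* κ :* s) ≡.refl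

  lagrange : ∀ a b c d → (a ℚ.* a ℚ.+ b ℚ.* b) ℚ.* (c ℚ.* c ℚ.+ d ℚ.* d)
    ≡ (a ℚ.* c ℚ.+ b ℚ.* d) ℚ.* (a ℚ.* c ℚ.+ b ℚ.* d) ℚ.+ (a ℚ.* d ℚ.- b ℚ.* c) ℚ.* (a ℚ.* d ℚ.- b ℚ.* c)
  lagrange = solve 4 (λ a b c d → (a :* a :+ b :* b) :* (c :* c :+ d :* d)
    := (a :* c :+ b :* d) :* (a :* c :+ b :* d) :+ (a :* d :- b :* c) :* (a :* d :- b :* c)) ≡.refl

  -- Multiplicativity of the squared modulus. Differences are spelled `a ℚ.+ ℚ.- b` because the
  -- components of complex products unfold to this form.
  norm-mult : ∀ a b c d →
    (a ℚ.* c ℚ.+ ℚ.- (b ℚ.* d)) ℚ.* (a ℚ.* c ℚ.+ ℚ.- (b ℚ.* d))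
      ℚ.+ (a ℚ.* d ℚ.+ b ℚ.* c) ℚ.* (a ℚ.* d ℚ.+ b ℚ.* c)
    ≡ (a ℚ.* a ℚ.+ b ℚ.* b) ℚ.* (c ℚ.* c ℚ.+ d ℚ.* d)
  norm-mult = solve 4 (λ a b c d → (a :* c :- b :* d) :* (a :* c :- b :* d) :+ (a :* d :+ b :* c) :* (a :* d :+ b :* c)
    := (a :* a :+ b :* b) :* (c :* c :+ d :* d)) ≡.refl

  square-* : ∀ r s → r ℚ.* r ℚ.* (s ℚ.* s) ≡ r ℚ.* s ℚ.* (r ℚ.* s)
  square-* = solve 2 (λ r s → r :* r :* (s :* s) := r :* s :* (r :* s)) ≡.refl

  square-neg : ∀ a → ℚ.- a ℚ.* ℚ.- a ≡ a ℚ.* a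
  square-neg = solve 1 (λ a → :- a :* :- a := a :* a) ≡.refl

  minkowski : ∀ a b c d r s → (r ℚ.+ s) ℚ.* (r ℚ.+ s) ≡
    ((a ℚ.+ c) ℚ.* (a ℚ.+ c) ℚ.+ (b ℚ.+ d) ℚ.* (b ℚ.+ d))
    ℚ.+ ((r ℚ.* r ℚ.- (a ℚ.* a ℚ.+ b ℚ.* b)) ℚ.+ (s ℚ.* s ℚ.- (c ℚ.* c ℚ.+ d ℚ.* d))
      ℚ.+ ((r ℚ.* s ℚ.- (a ℚ.* c ℚ.+ b ℚ.* d)) ℚ.+ (r ℚ.* s ℚ.- (a ℚ.* c ℚ.+ b ℚ.* d))))
  minkowski = solve 6 (λ a b c d r s → (r :+ s) :* (r :+ s) :=
    ((a :+ c) :* (a :+ c) :+ (b :+ d) :* (b :+ d))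
    :+ ((r :* r :- (a :* a :+ b :* b)) :+ (s :* s :- (c :* c :+ d :* d))
      :+ ((r :* s :- (a :* c :+ b :* d)) :+ (r :* s :- (a :* c :+ b :* d))))) ≡.refl

  square-+ : ∀ r s → (r ℚ.+ s) ℚ.* (r ℚ.+ s) ≡ (r ℚ.* r ℚ.+ s ℚ.* s) ℚ.+ (r ℚ.* s ℚ.+ r ℚ.* s)
  square-+ = solve 2 (λ r s → (r :+ s) :* (r :+ s) := (r :* r :+ s :* s) :+ (r :* s :+ r :* s)) ≡.refl

  -- Expands 1 - a as (1 - ρ) + (ρ - a). For a ≤ ρ ≤ 1 the excess over (1 - ρ)² is visibly
  -- nonnegative, which gives |1 - z| ≥ 1 - ρ.
  square-1- : ∀ a b ρ → (1ℚ ℚ.+ ℚ.- a) ℚ.* (1ℚ ℚ.+ ℚ.- a) ℚ.+ (0ℚ ℚ.+ ℚ.- b) ℚ.* (0ℚ ℚ.+ ℚ.- b) ≡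
    0ℚ ℚ.+ (1ℚ ℚ.+ ℚ.- ρ) ℚ.* (1ℚ ℚ.+ ℚ.- ρ)
      ℚ.+ ((ρ ℚ.+ ℚ.- a) ℚ.* (ρ ℚ.+ ℚ.- a)
        ℚ.+ ((ρ ℚ.+ ℚ.- a) ℚ.* (1ℚ ℚ.+ ℚ.- ρ) ℚ.+ (ρ ℚ.+ ℚ.- a) ℚ.* (1ℚ ℚ.+ ℚ.- ρ)) ℚ.+ b ℚ.* b)
  square-1- = solve 3 (λ a b ρ → (:1 :- a) :* (:1 :- a) :+ (con (+ 0) :- b) :* (con (+ 0) :- b) :=
    con (+ 0) :+ (:1 :- ρ) :* (:1 :- ρ) :+ ((ρ :- a) :* (ρ :- a) :+ ((ρ :- a) :* (:1 :- ρ) :+ (ρ :- a) :* (:1 :- ρ)) :+ b :* b)) ≡.refl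

  inverse-re : ∀ a b r → a ℚ.* (a ℚ.* r) ℚ.+ ℚ.- (b ℚ.* (ℚ.- b ℚ.* r)) ≡ r ℚ.* (a ℚ.* a ℚ.+ b ℚ.* b)
  inverse-re = solve 3 (λ a b r → a :* (a :* r) :- b :* (:- b :* r) := r :* (a :* a :+ b :* b)) ≡.refl

  inverse-im : ∀ a b r → a ℚ.* (ℚ.- b ℚ.* r) ℚ.+ b ℚ.* (a ℚ.* r) ≡ 0ℚ
  inverse-im = solve 3 (λ a b r → a :* (:- b :* r) :+ b :* (a :* r) := con (+ 0)) ≡.refl

  inverse-norm : ∀ a b r → a ℚ.* r ℚ.* (a ℚ.* r) ℚ.+ (ℚ.- b ℚ.* r) ℚ.* (ℚ.- b ℚ.* r) ≡ r ℚ.* (r ℚ.* (a ℚ.* a ℚ.+ b ℚ.* b))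
  inverse-norm = solve 3 (λ a b r → a :* r :* (a :* r) :+ (:- b :* r) :* (:- b :* r) := r :* (r :* (a :* a :+ b :* b))) ≡.refl

  spread : ∀ κ ρ r → r ℚ.* (κ ℚ.* (1ℚ ℚ.- ρ) ℚ.* (κ ℚ.* (1ℚ ℚ.- ρ))) ≡ κ ℚ.* κ ℚ.* (r ℚ.* ((1ℚ ℚ.- ρ) ℚ.* (1ℚ ℚ.- ρ)))
  spread = solve 3 (λ κ ρ r → r :* (κ :* (:1 :- ρ) :* (κ :* (:1 :- ρ))) := κ :* κ :* (r :* ((:1 :- ρ) :* (:1 :- ρ)))) ≡.refl

  cancel-middle : ∀ a b c → (a ℚ.- b) ℚ.+ (b ℚ.- c) ≡ a ℚ.- c
  cancel-middle = solve 3 (λ a b c → (a :- b) :+ (b :- c) := a :- c) ≡.refl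

  flip-difference : ∀ a b → ℚ.- (a ℚ.- b) ≡ b ℚ.- a
  flip-difference = solve 2 (λ a b → :- (a :- b) := b :- a) ≡.refl

  *-re-assoc : ∀ a b c d e f →
    (a ℚ.* c ℚ.+ ℚ.- (b ℚ.* d)) ℚ.* e ℚ.+ ℚ.- ((a ℚ.* d ℚ.+ b ℚ.* c) ℚ.* f)
    ≡ a ℚ.* (c ℚ.* e ℚ.+ ℚ.- (d ℚ.* f)) ℚ.+ ℚ.- (b ℚ.* (c ℚ.* f ℚ.+ d ℚ.* e))
  *-re-assoc = solve 6 (λ a b c d e f →
    (a :* c :- b :* d) :* e :- (a :* d :+ b :* c) :* f
    := a :* (c :* e :- d :* f) :- b :* (c :* f :+ d :* e)) ≡.refl

  *-im-assoc : ∀ a b c d e f →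
    (a ℚ.* c ℚ.+ ℚ.- (b ℚ.* d)) ℚ.* f ℚ.+ (a ℚ.* d ℚ.+ b ℚ.* c) ℚ.* e
    ≡ a ℚ.* (c ℚ.* f ℚ.+ d ℚ.* e) ℚ.+ b ℚ.* (c ℚ.* e ℚ.+ ℚ.- (d ℚ.* f))
  *-im-assoc = solve 6 (λ a b c d e f →
    (a :* c :- b :* d) :* f :+ (a :* d :+ b :* c) :* e
    := a :* (c :* f :+ d :* e) :+ b :* (c :* e :- d :* f)) ≡.refl

  *-re-comm : ∀ a b c d → a ℚ.* c ℚ.+ ℚ.- (b ℚ.* d) ≡ c ℚ.* a ℚ.+ ℚ.- (d ℚ.* b)
  *-re-comm = solve 4 (λ a b c d → a :* c :- b :* d := c :* a :- d :* b) ≡.refl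

  *-im-comm : ∀ a b c d → a ℚ.* d ℚ.+ b ℚ.* c ≡ c ℚ.* b ℚ.+ d ℚ.* a
  *-im-comm = solve 4 (λ a b c d → a :* d :+ b :* c := c :* b :+ d :* a) ≡.refl

  *-re-identity : ∀ a b → 1ℚ ℚ.* a ℚ.+ ℚ.- (0ℚ ℚ.* b) ≡ a
  *-re-identity = solve 2 (λ a b → :1 :* a :- con (+ 0) :* b := a) ≡.refl

  *-im-identity : ∀ a b → 1ℚ ℚ.* b ℚ.+ 0ℚ ℚ.* a ≡ b
  *-im-identity = solve 2 (λ a b → :1 :* b :+ con (+ 0) :* a := b) ≡.refl

  *-re-distrib : ∀ a b c d e f →
    a ℚ.* (c ℚ.+ e) ℚ.+ ℚ.- (b ℚ.* (d ℚ.+ f)) ≡ (a ℚ.* c ℚ.+ ℚ.- (b ℚ.* d)) ℚ.+ (a ℚ.* e ℚ.+ ℚ.- (b ℚ.* f))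
  *-re-distrib = solve 6 (λ a b c d e f →
    a :* (c :+ e) :- b :* (d :+ f) := (a :* c :- b :* d) :+ (a :* e :- b :* f)) ≡.refl

  *-im-distrib : ∀ a b c d e f →
    a ℚ.* (d ℚ.+ f) ℚ.+ b ℚ.* (c ℚ.+ e) ≡ (a ℚ.* d ℚ.+ b ℚ.* c) ℚ.+ (a ℚ.* f ℚ.+ b ℚ.* e)
  *-im-distrib = solve 6 (λ a b c d e f →
    a :* (d :+ f) :+ b :* (c :+ e) := (a :* d :+ b :* c) :+ (a :* f :+ b :* e)) ≡.refl

  five : ∀ δ → δ ℚ.+ (δ ℚ.+ δ) ℚ.+ δ ℚ.+ δ ≡ fromℕ 5 ℚ.* δ
  five = solve 1 (λ δ → δ :+ (δ :+ δ) :+ δ :+ δ := con (+ 5) :* δ) ≡.refl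

  five′ : ∀ δ → δ ℚ.+ δ ℚ.+ (δ ℚ.+ δ) ℚ.+ δ ≡ fromℕ 5 ℚ.* δ
  five′ = solve 1 (λ δ → δ :+ δ :+ (δ :+ δ) :+ δ := con (+ 5) :* δ) ≡.refl

  shrink : ∀ s δ → 1ℚ ℚ.- δ ≡ s ℚ.+ (1ℚ ℚ.- (s ℚ.+ δ))
  shrink = solve 2 (λ s δ → :1 :- δ := s :+ (:1 :- (s :+ δ))) ≡.refl

  square-complement : ∀ h → (1ℚ ℚ.- h) ℚ.* (1ℚ ℚ.- h) ≡ (1ℚ ℚ.- (h ℚ.+ h)) ℚ.+ h ℚ.* h
  square-complement = solve 1 (λ h → (:1 :- h) :* (:1 :- h) := (:1 :- (h :+ h)) :+ h :* h) ≡.refl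

open ℚ-Identities

-- The WZ pair

module FiniteSums (R : CommutativeRing 0ℓ 0ℓ) where

  open CommutativeRing R
  open Exp semiring public using (_^_)

  sum prod : (ℕ → Carrier) → ℕ → Carrier
  sum f zero     = 0#
  sum f (suc n)  = sum f n + f n
  prod f zero    = 1#
  prod f (suc n) = prod f n * f n

  prod-head : ∀ f n → prod f (suc n) ≈ f 0 * prod (f ∘ suc) n
  prod-head f zero    = *-comm _ _
  prod-head f (suc n) = trans (*-congʳ (prod-head f n)) (*-assoc _ _ _)

  prod-cong : ∀ {f h} → (∀ n → f n ≈ h n) → ∀ n → prod f n ≈ prod h n
  prod-cong f≈h zero    = refl
  prod-cong f≈h (suc n) = *-cong (prod-cong f≈h n) (f≈h n)

  prod-* : ∀ f h n → prod f n * prod h n ≈ prod (λ k → f k * h k) n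
  prod-* f h zero    = *-identityˡ 1#
  prod-* f h (suc n) = trans
    (solve 4 (λ a b c d → a :* b :* (c :* d) := a :* c :* (b :* d)) refl (prod f n) (f n) (prod h n) (h n))
    (*-congʳ (prod-* f h n))
    where open IntegerSolver R using (solve; _:=_; _:*_)

  prod-1 : ∀ n → prod (λ _ → 1#) n ≈ 1#
  prod-1 zero    = refl
  prod-1 (suc n) = trans (*-identityʳ _) (prod-1 n)

  prod-units : ∀ {f h} → (∀ j → f j * h j ≈ 1#) → ∀ n → prod f n * prod h n ≈ 1#
  prod-units {f} {h} fh≈1 n = trans (prod-* f h n) (trans (prod-cong fh≈1 n) (prod-1 n))

  inverse-unique : ∀ w v v′ → w * v ≈ 1# → w * v′ ≈ 1# → v ≈ v′
  inverse-unique w v v′ wv≈1 wv′≈1 = begin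
    v              ≈⟨ *-identityʳ v ⟨
    v * 1#         ≈⟨ *-congˡ wv′≈1 ⟨
    v * (w * v′)   ≈⟨ solve 3 (λ v w v′ → v :* (w :* v′) := w :* v :* v′) refl v w v′ ⟩
    w * v * v′     ≈⟨ *-congʳ wv≈1 ⟩
    1# * v′        ≈⟨ *-identityˡ v′ ⟩
    v′             ∎
    where
    open SetoidReasoning setoid
    open IntegerSolver R using (solve; _:=_; _:*_)

  -- The powers in the statement come from a raw ring with another equality; computing a power never
  -- consults it.
  ^-independent : ∀ (_≈′_ : Carrier → Carrier → Set) z n →
    RawSemiringDefinitions._^_ (RawRing.rawSemiring (record
      { Carrier = Carrier ; _≈_ = _≈′_ ; _+_ = _+_ ; _*_ = _*_ ; -_ = -_ ; 0# = 0# ; 1# = 1# })) z n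
    ≈ z ^ n
  ^-independent _≈′_ z zero    = refl
  ^-independent _≈′_ z (suc n) = *-congˡ (^-independent _≈′_ z n)

module WZPair (R : CommutativeRing 0ℓ 0ℓ) where

  open CommutativeRing R
  open Exp semiring using (^-congˡ; ^-assocʳ)
  open IntegerSolver R using (solve; _:=_; _:+_; _:*_; _:-_; _:^_; :-_; :1; con)
  open FiniteSums R using (_^_; sum; prod; prod-head)
  open SetoidReasoning setoid

  module Summation
    (q : Carrier) (u : Carrier) (u-inverse : (1# - q) * u ≈ 1#)
    (L : ℕ → Carrier) (L-inverse : ∀ k → (1# - q ^ 4 * (q ^ 4) ^ k) * L k ≈ 1#)
    where

    x : ℕ → Carrier
    x k = (q ^ 2) ^ k

    [q⁴]^ : ∀ k → (q ^ 4) ^ k ≈ x k ^ 2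
    [q⁴]^ k = begin
      (q ^ 4) ^ k            ≈⟨ ^-assocʳ q 4 k ⟩
      q ^ (4 ℕ.* k)          ≡⟨ ≡.cong (q ^_)
        (≡.trans (ℕ.*-assoc 2 2 k) (ℕ.*-comm 2 (2 ℕ.* k))) ⟩
      q ^ (2 ℕ.* k ℕ.* 2)    ≈⟨ ^-assocʳ q (2 ℕ.* k) 2 ⟨
      (q ^ (2 ℕ.* k)) ^ 2    ≈⟨ ^-congˡ 2 (^-assocʳ q 2 k) ⟨
      x k ^ 2                ∎

    F : ℕ → Carrier
    F k = q * x k * (1# - q * x k) ^ 3

    -- The part of the summand without e and without 1 - q^(6k+1). The initial value u = 1/(1 - q)
    -- turns that factor into [6k+1].
    c : ℕ → Carrier
    c zero    = u
    c (suc k) = c k * (F k * L k ^ 3)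

    N : Carrier → ℕ → Carrier
    N e = prod (λ j → e - q ^ 2 * (q ^ 4) ^ j)

    -- The summand, with W i standing for 1/(1 - e q^(2i+1)).
    t : Carrier → (ℕ → Carrier) → ℕ → Carrier
    t e W k = (1# - q * x k ^ 3) * c k * N e k * prod W k

    r : Carrier → (ℕ → Carrier) → Carrier
    r e W = (1# - e * q ^ 2) ^ 2 * (W 0 * W 1)

    -- The WZ companion. Its quotient by the summand is the rational certificate -e q^(2n+1) (1 -
    -- q^(2n+1))³ / ((1 - q^(6n+1)) (1 - eq^(2n+1)) (1 - eq^(2n+3))).
    g : Carrier → (ℕ → Carrier) → ℕ → Carrier
    g e W n = - (e * F n * (c n * N e n * prod W (2 ℕ.+ n)))

    -- Each factor after the first on the left is q⁴ times a factor of `N e n`; these powers collect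
    -- to q^(4n), that is `x n ^ 2`.
    N-shift : ∀ e n → N (e * q ^ 4) (suc n) ≈ (e * q ^ 4 - q ^ 2) * x n ^ 2 * N e n
    N-shift e zero = solve 2 (λ e q →
      :1 :* (e :* q :^ 4 :- q :^ 2 :* :1) := (e :* q :^ 4 :- q :^ 2) :* (:1 :^ 2) :* :1) refl e q
    N-shift e (suc n) = begin
      N (e * q ^ 4) (suc n) * (e * q ^ 4 - q ^ 2 * (q ^ 4) ^ suc n)
        ≈⟨ *-congʳ (N-shift e n) ⟩
      (e * q ^ 4 - q ^ 2) * x n ^ 2 * N e n * (e * q ^ 4 - q ^ 2 * (q ^ 4 * (q ^ 4) ^ n))
        ≈⟨ solve 5 (λ e q x N y →
             (e :* q :^ 4 :- q :^ 2) :* x :^ 2 :* N :* (e :* q :^ 4 :- q :^ 2 :* (q :^ 4 :* y))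
             := (e :* q :^ 4 :- q :^ 2) :* (q :^ 2 :* x) :^ 2 :* (N :* (e :- q :^ 2 :* y)))
           refl e q (x n) (N e n) ((q ^ 4) ^ n) ⟩
      (e * q ^ 4 - q ^ 2) * x (suc n) ^ 2 * N e (suc n) ∎

    module _ (e : Carrier) (W : ℕ → Carrier) (W-inverse : ∀ i → (1# - e * (q * x i)) * W i ≈ 1#) where

      private
        -- Since eq⁴ · q^(2i+1) = e q^(2(i+2)+1), these are the inverses that belong to `e * q ^ 4`.
        W′ : ℕ → Carrier
        W′ i = W (2 ℕ.+ i)

      prod-shift : ∀ n → W 0 * W 1 * prod W′ n ≈ prod W (2 ℕ.+ n)
      prod-shift n = begin
        W 0 * W 1 * prod W′ n            ≈⟨ *-assoc _ _ _ ⟩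
        W 0 * (W 1 * prod W′ n)          ≈⟨ *-congˡ (prod-head (W ∘ suc) n) ⟨
        W 0 * prod (W ∘ suc) (suc n)     ≈⟨ prod-head W (suc n) ⟨
        prod W (2 ℕ.+ n)                 ∎

      c-step : ∀ n → F n * c n ≈ (1# - q ^ 4 * x n ^ 2) ^ 3 * c (suc n)
      c-step n = sym (begin
        (1# - q ^ 4 * x n ^ 2) ^ 3 * (c n * (F n * L n ^ 3))
          ≈⟨ *-congʳ (^-congˡ 3 (+-congˡ (-‿cong (*-congˡ ([q⁴]^ n))))) ⟨
        (1# - q ^ 4 * (q ^ 4) ^ n) ^ 3 * (c n * (F n * L n ^ 3))
          ≈⟨ solve 4 (λ a c F L → a :^ 3 :* (c :* (F :* L :^ 3)) := (a :* L) :^ 3 :* (F :* c))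
               refl (1# - q ^ 4 * (q ^ 4) ^ n) (c n) (F n) (L n) ⟩
        ((1# - q ^ 4 * (q ^ 4) ^ n) * L n) ^ 3 * (F n * c n)
          ≈⟨ *-congʳ (^-congˡ 3 (L-inverse n)) ⟩
        1# ^ 3 * (F n * c n)
          ≈⟨ solve 1 (λ y → :1 :^ 3 :* y := y) refl (F n * c n) ⟩
        F n * c n ∎)

      prod-cancel : ∀ n → prod W n ≈ prod W (suc n) * (1# - e * (q * x n))
      prod-cancel n = sym (begin
        prod W n * W n * (1# - e * (q * x n))    ≈⟨ trans (*-assoc _ _ _) (*-congˡ (*-comm _ _)) ⟩
        prod W n * ((1# - e * (q * x n)) * W n)  ≈⟨ *-congˡ (W-inverse n) ⟩
        prod W n * 1#                            ≈⟨ *-identityʳ _ ⟩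
        prod W n                                 ∎)

      -- The WZ equation at n + 1. Once `c-step`, `prod-cancel`, `N-shift` and `prod-shift` have
      -- expressed all terms through C, M and D, no inverse remains visible and a polynomial
      -- identity in e, q and X = q^(2n) is left.
      wz-step : ∀ n → t e W (suc n) + g e W n ≈ r e W * t (e * q ^ 4) W′ (suc n) + g e W (suc n)
      wz-step n = begin
        (1# - q * x (suc n) ^ 3) * C * (M * (e - q ^ 2 * (q ^ 4) ^ n)) * prod W (1 ℕ.+ n)
          + - (e * F n * (c n * M * prod W (2 ℕ.+ n)))
          ≈⟨ +-cong
               (*-cong (*-congˡ (*-congˡ (+-congˡ (-‿cong (*-congˡ ([q⁴]^ n))))))
                 (trans (prod-cancel (1 ℕ.+ n)) (*-congʳ (prod-cancel (2 ℕ.+ n)))))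
               (-‿cong (trans
                 (solve 5 (λ e F c M D → e :* F :* (c :* M :* D) := (F :* c) :* (e :* M :* D))
                   refl e (F n) (c n) M (prod W (2 ℕ.+ n)))
                 (*-cong (c-step n) (*-congˡ (prod-cancel (2 ℕ.+ n)))))) ⟩
        (1# - q * (q ^ 2 * X) ^ 3) * C * (M * (e - q ^ 2 * X ^ 2))
            * (D * (1# - e * (q * (q ^ 2 * (q ^ 2 * X)))) * (1# - e * (q * (q ^ 2 * X))))
          + - ((1# - q ^ 4 * X ^ 2) ^ 3 * C * (e * M * (D * (1# - e * (q * (q ^ 2 * (q ^ 2 * X)))))))
          ≈⟨ solve 6 (λ e q X C M D →
               (:1 :- q :* (q :^ 2 :* X) :^ 3) :* C :* (M :* (e :- q :^ 2 :* X :^ 2))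
                 :* (D :* (:1 :- e :* (q :* (q :^ 2 :* (q :^ 2 :* X)))) :* (:1 :- e :* (q :* (q :^ 2 :* X))))
                 :+ :- ((:1 :- q :^ 4 :* X :^ 2) :^ 3 :* C :* (e :* M :* (D :* (:1 :- e :* (q :* (q :^ 2 :* (q :^ 2 :* X)))))))
               := (:1 :- e :* q :^ 2) :^ 2 :* ((:1 :- q :* (q :^ 2 :* X) :^ 3) :* C :* ((e :* q :^ 4 :- q :^ 2) :* X :^ 2 :* M)) :* D
                 :+ :- (e :* (q :* (q :^ 2 :* X) :* (:1 :- q :* (q :^ 2 :* X)) :^ 3) :* (C :* (M :* (e :- q :^ 2 :* X :^ 2)) :* D)))
               refl e q X C M D ⟩
        (1# - e * q ^ 2) ^ 2 * ((1# - q * x (suc n) ^ 3) * C * ((e * q ^ 4 - q ^ 2) * X ^ 2 * M)) * D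
          + - (e * F (suc n) * (C * (M * (e - q ^ 2 * X ^ 2)) * D))
          ≈⟨ +-cong
               (*-cong (*-congˡ (*-congˡ (sym (N-shift e n)))) (sym (prod-shift (suc n))))
               (-‿cong (*-congˡ (*-congʳ (*-congˡ (*-congˡ (+-congˡ (-‿cong (*-congˡ (sym ([q⁴]^ n)))))))))) ⟩
        (1# - e * q ^ 2) ^ 2 * ((1# - q * x (suc n) ^ 3) * C * N (e * q ^ 4) (suc n)) * (W 0 * W 1 * prod W′ (suc n))
          + g e W (suc n)
          ≈⟨ +-congʳ (solve 4 (λ a b w p → a :* b :* (w :* p) := a :* w :* (b :* p)) refl
               ((1# - e * q ^ 2) ^ 2) ((1# - q * x (suc n) ^ 3) * C * N (e * q ^ 4) (suc n))
               (W 0 * W 1) (prod W′ (suc n))) ⟩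
        r e W * t (e * q ^ 4) W′ (suc n) + g e W (suc n) ∎
        where
        X = x n
        C = c (suc n)
        M = N e n
        D = prod W (3 ℕ.+ n)

      t-zero : ∀ e W → t e W 0 ≈ 1#
      t-zero e W = trans
        (solve 2 (λ q u → (:1 :- q :* :1 :^ 3) :* u :* :1 :* :1 := (:1 :- q) :* u) refl q u)
        u-inverse

      -- Rests on (1 - eq)(1 - eq³) + eq(1 - q)² = (1 - eq²)². It starts the summation in `wz`, and
      -- it also shows that r differs from 1 by a multiple of e, which controls the product of the
      -- r.
      r-value : r e W ≈ 1# + - g e W 0
      r-value = sym (begin
        1# + - - (e * (q * 1# * (1# - q * 1#) ^ 3) * (u * 1# * (1# * W 0 * W 1)))
          ≈⟨ +-congʳ (sym units) ⟩
        (1# - e * (q * x 0)) * W 0 * ((1# - e * (q * x 1)) * W 1)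
            + - - (e * (q * 1# * (1# - q * 1#) ^ 3) * (u * 1# * (1# * W 0 * W 1)))
          ≈⟨ solve 5 (λ e q u w v →
               (:1 :- e :* (q :* :1)) :* w :* ((:1 :- e :* (q :* (q :^ 2 :* :1))) :* v)
                 :+ :- :- (e :* (q :* :1 :* (:1 :- q :* :1) :^ 3) :* (u :* :1 :* (:1 :* w :* v)))
               := (:1 :- e :* (q :* :1)) :* w :* ((:1 :- e :* (q :* (q :^ 2 :* :1))) :* v)
                 :+ ((:1 :- q) :* u) :* (e :* q :* (:1 :- q) :^ 2 :* w :* v))
               refl e q u (W 0) (W 1) ⟩
        (1# - e * (q * x 0)) * W 0 * ((1# - e * (q * x 1)) * W 1)
            + (1# - q) * u * (e * q * (1# - q) ^ 2 * W 0 * W 1)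
          ≈⟨ +-congˡ (*-congʳ u-inverse) ⟩
        (1# - e * (q * x 0)) * W 0 * ((1# - e * (q * x 1)) * W 1)
            + 1# * (e * q * (1# - q) ^ 2 * W 0 * W 1)
          ≈⟨ solve 4 (λ e q w v →
               (:1 :- e :* (q :* :1)) :* w :* ((:1 :- e :* (q :* (q :^ 2 :* :1))) :* v)
                 :+ :1 :* (e :* q :* (:1 :- q) :^ 2 :* w :* v)
               := (:1 :- e :* q :^ 2) :^ 2 :* (w :* v)) refl e q (W 0) (W 1) ⟩
        r e W ∎)
        where
        units : (1# - e * (q * x 0)) * W 0 * ((1# - e * (q * x 1)) * W 1) ≈ 1#
        units = trans (*-cong (W-inverse 0) (W-inverse 1)) (*-identityʳ 1#)

      wz : ∀ n → sum (t e W) (suc n) ≈ r e W * sum (t (e * q ^ 4) W′) (suc n) + g e W n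
      wz zero = begin
        0# + t e W 0                          ≈⟨ +-congˡ (t-zero e W) ⟩
        0# + 1#                               ≈⟨ solve 1 (λ g → con (+ 0) :+ :1 := (:1 :+ :- g) :* (con (+ 0) :+ :1) :+ g) refl (g e W 0) ⟩
        (1# + - g e W 0) * (0# + 1#) + g e W 0
          ≈⟨ +-congʳ (*-cong (sym r-value) (+-congˡ (sym (t-zero (e * q ^ 4) W′)))) ⟩
        r e W * (0# + t (e * q ^ 4) W′ 0) + g e W 0 ∎
      wz (suc n) = begin
        S + t e W (suc n)                     ≈⟨ +-congʳ (wz n) ⟩
        r e W * S′ + g e W n + t e W (suc n)  ≈⟨ trans (+-assoc _ _ _) (+-congˡ (+-comm _ _)) ⟩
        r e W * S′ + (t e W (suc n) + g e W n) ≈⟨ +-congˡ (wz-step n) ⟩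
        r e W * S′ + (r e W * t (e * q ^ 4) W′ (suc n) + g e W (suc n)) ≈⟨ +-assoc _ _ _ ⟨
        r e W * S′ + r e W * t (e * q ^ 4) W′ (suc n) + g e W (suc n) ≈⟨ +-congʳ (distribˡ _ _ _) ⟨
        r e W * (S′ + t (e * q ^ 4) W′ (suc n)) + g e W (suc n) ∎
        where
        S  = sum (t e W) (suc n)
        S′ = sum (t (e * q ^ 4) W′) (suc n)

-- Limits and infinite products in a complete normed ring

2ℚ : ℚ
2ℚ = 1ℚ ℚ.+ 1ℚ

-- The norm is given only by its rational upper bounds, so it need not exist as a real number.
-- Limits are determined up to differences of arbitrarily small norm, and these may fail to be
-- `≈ 0#`.
record CompleteNorm (R : CommutativeRing 0ℓ 0ℓ) : Set₁ where
  open CommutativeRing R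
  infix 4 ∥_∥≤_ _⇢_
  field
    ∥_∥≤_ : Carrier → ℚ → Set
    norm-nonneg : ∀ {z a} → ∥ z ∥≤ a → 0ℚ ℚ.≤ a
    norm-resp   : ∀ {z w a} → z ≈ w → ∥ z ∥≤ a → ∥ w ∥≤ a
    norm-mono   : ∀ {z a b} → a ℚ.≤ b → ∥ z ∥≤ a → ∥ z ∥≤ b
    norm-0      : ∥ 0# ∥≤ 0ℚ
    norm-1      : ∥ 1# ∥≤ 1ℚ
    norm-+      : ∀ {z w a b} → ∥ z ∥≤ a → ∥ w ∥≤ b → ∥ z + w ∥≤ a ℚ.+ b
    norm-*      : ∀ {z w a b} → ∥ z ∥≤ a → ∥ w ∥≤ b → ∥ z * w ∥≤ a ℚ.* b
    norm-neg    : ∀ {z a} → ∥ z ∥≤ a → ∥ - z ∥≤ a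
    norm-finite : ∀ z → ∃ λ a → ∥ z ∥≤ a

  Null : (ℕ → Carrier) → Set
  Null u = ∀ ε → 0ℚ ℚ.< ε → ∃ λ N → ∀ {n} → N ℕ.≤ n → ∥ u n ∥≤ ε

  _⇢_ : (ℕ → Carrier) → Carrier → Set
  u ⇢ l = Null (λ n → u n + - l)

  field
    complete : ∀ u → (∀ ε → 0ℚ ℚ.< ε → ∃ λ N → ∀ n → ∥ u (N ℕ.+ n) + - u N ∥≤ ε) →
      ∃ λ l → u ⇢ l
    -- κ is 1/(1 - ρ), the bound that the geometric series gives for 1/(1 - z).
    unit : ∀ {z ρ κ} → ρ ℚ.< 1ℚ → 0ℚ ℚ.≤ κ → κ ℚ.* (1ℚ ℚ.- ρ) ≡ 1ℚ → ∥ z ∥≤ ρ →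
      ∃ λ w → (1# + - z) * w ≈ 1# × ∥ w ∥≤ κ

module Analysis (R : CommutativeRing 0ℓ 0ℓ) (norm : CompleteNorm R) where

  open CommutativeRing R
  open CompleteNorm norm
  open IntegerSolver R using (solve; _:=_; _:+_; _:*_; _:-_; _:^_; :-_; :1; con)
  open FiniteSums R

  Bdd : (ℕ → Carrier) → Set
  Bdd u = ∃ λ B → ∀ n → ∥ u n ∥≤ B

  norm-pow : ∀ {z a} → ∥ z ∥≤ a → ∀ n → ∥ z ^ n ∥≤ a ^ℚ n
  norm-pow z≤a zero    = norm-1
  norm-pow z≤a (suc n) = norm-* z≤a (norm-pow z≤a n)

  null-cong : ∀ {u v} → (∀ n → u n ≈ v n) → Null u → Null v
  null-cong u≈v nu ε 0<ε = let N , small = nu ε 0<ε in N , λ N≤n → norm-resp (u≈v _) (small N≤n)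

  null-+ : ∀ {u v} → Null u → Null v → Null (λ n → u n + v n)
  null-+ nu nv ε 0<ε =
    let M , u-small = nu _ (*-pos 0<ε 0<½)
        N , v-small = nv _ (*-pos 0<ε 0<½)
    in M ℕ.⊔ N , λ p → norm-mono (ℚ.≤-reflexive (half+half ε))
         (norm-+ (u-small (ℕ.m⊔n≤o⇒m≤o M N p)) (v-small (ℕ.m⊔n≤o⇒n≤o M N p)))

  null-neg : ∀ {u} → Null u → Null (λ n → - u n)
  null-neg nu ε 0<ε = let N , small = nu ε 0<ε in N , λ p → norm-neg (small p)

  null-*-bdd : ∀ {u v} → Null u → Bdd v → Null (λ n → u n * v n)
  null-*-bdd nu (B , v≤B) ε 0<ε =
    -- The divisor is B + 1 because B may be 0.
    let η , 0<η , eq = divide (ℚ.+-mono-≤-< (norm-nonneg (v≤B 0)) 0<1) 0<ε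
        N , small    = nu η 0<η
    in N , λ {n} p → norm-mono
         (≤-by η (ℚ.<⇒≤ 0<η) (≡.trans (≡.sym eq) (≡.trans ([V+1]η B η) (≡.cong (ℚ._+ η) (ℚ.*-comm B η)))))
         (norm-* (small p) (v≤B n))

  bdd-const : ∀ z → Bdd (λ _ → z)
  bdd-const z = let a , z≤a = norm-finite z in a , λ _ → z≤a

  bdd-* : ∀ {u v} → Bdd u → Bdd v → Bdd (λ n → u n * v n)
  bdd-* (A , u≤A) (B , v≤B) = A ℚ.* B , λ n → norm-* (u≤A n) (v≤B n)

  bdd-unshift : ∀ u N B → (∀ {n} → N ℕ.≤ n → ∥ u n ∥≤ B) → Bdd u
  bdd-unshift u zero    B tail = B , λ n → tail z≤n
  bdd-unshift u (suc N) B tail =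
    let A , u0≤A = norm-finite (u 0)
        C , u≤C  = bdd-unshift (u ∘ suc) N B (tail ∘ s≤s)
    in A ℚ.⊔ C , λ { zero    → norm-mono (ℚ.p≤p⊔q A C) u0≤A
                   ; (suc n) → norm-mono (ℚ.p≤q⊔p A C) (u≤C n) }

  lim-const : ∀ z → (λ _ → z) ⇢ z
  lim-const z ε 0<ε = 0 , λ _ → norm-resp (sym (-‿inverseʳ z)) (norm-mono (ℚ.<⇒≤ 0<ε) norm-0)

  lim-cong : ∀ {u v l m} → (∀ n → u n ≈ v n) → l ≈ m → u ⇢ l → v ⇢ m
  lim-cong u≈v l≈m = null-cong (λ n → +-cong (u≈v n) (-‿cong l≈m))

  lim⇒bdd : ∀ {u l} → u ⇢ l → Bdd u
  lim⇒bdd {u} {l} u⇢l =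
    let N , small = u⇢l 1ℚ 0<1
        A , l≤A   = norm-finite l
    in bdd-unshift u N (1ℚ ℚ.+ A) λ {n} p →
         norm-resp (solve 2 (λ u l → u :- l :+ l := u) refl (u n) l) (norm-+ (small p) l≤A)

  lim-+ : ∀ {u v l m} → u ⇢ l → v ⇢ m → (λ n → u n + v n) ⇢ (l + m)
  lim-+ {u} {v} {l} {m} u⇢l v⇢m = null-cong
    (λ n → solve 4 (λ u v l m → u :- l :+ (v :- m) := u :+ v :- (l :+ m)) refl (u n) (v n) l m)
    (null-+ u⇢l v⇢m)

  lim-neg : ∀ {u l} → u ⇢ l → (λ n → - u n) ⇢ (- l)
  lim-neg {u} {l} u⇢l = null-cong
    (λ n → solve 2 (λ u l → :- (u :- l) := :- u :- :- l) refl (u n) l) (null-neg u⇢l)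

  lim-* : ∀ {u v l m} → u ⇢ l → v ⇢ m → (λ n → u n * v n) ⇢ (l * m)
  lim-* {u} {v} {l} {m} u⇢l v⇢m = null-cong
    (λ n → solve 4 (λ u v l m → (u :- l) :* v :+ (v :- m) :* l := u :* v :- l :* m) refl (u n) (v n) l m)
    (null-+ (null-*-bdd u⇢l (lim⇒bdd v⇢m)) (null-*-bdd v⇢m (bdd-const l)))

  lim-unshift : ∀ {u l} → (u ∘ suc) ⇢ l → u ⇢ l
  lim-unshift u⇢l ε 0<ε =
    let N , small = u⇢l ε 0<ε in suc N , λ { {suc n} (s≤s p) → small p }

  -- A term of the sequence is only near the limit, so a rational bound is passed on with
  -- arbitrarily small slack.
  lim-bound : ∀ {u l b ε} → u ⇢ l → (∀ n → ∥ u n ∥≤ b) → 0ℚ ℚ.< ε → ∥ l ∥≤ b ℚ.+ ε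
  lim-bound {u} {l} u⇢l u≤b 0<ε =
    let N , small = u⇢l _ 0<ε in
    norm-resp (solve 2 (λ u l → u :+ :- (u :- l) := l) refl (u N) l)
      (norm-+ (u≤b N) (norm-neg (small ℕ.≤-refl)))

  lim-sum : ∀ {u : ℕ → ℕ → Carrier} {l} → (∀ k → (λ m → u m k) ⇢ l k) →
    ∀ n → (λ m → sum (u m) n) ⇢ sum l n
  lim-sum u⇢l zero    = lim-const 0#
  lim-sum u⇢l (suc n) = lim-+ (lim-sum u⇢l n) (u⇢l n)

  lim-prod : ∀ {u : ℕ → ℕ → Carrier} {l} → (∀ k → (λ m → u m k) ⇢ l k) →
    ∀ n → (λ m → prod (u m) n) ⇢ prod l n
  lim-prod u⇢l zero    = lim-const 1#
  lim-prod u⇢l (suc n) = lim-* (lim-prod u⇢l n) (u⇢l n)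

  module Geometric
    {ρ κ : ℚ} (0≤ρ : 0ℚ ℚ.≤ ρ) (ρ<1 : ρ ℚ.< 1ℚ) (0≤κ : 0ℚ ℚ.≤ κ) (κ-inverse : κ ℚ.* (1ℚ ℚ.- ρ) ≡ 1ℚ)
    where

    scaled-pow-small : ∀ V {ε} → 0ℚ ℚ.≤ V → 0ℚ ℚ.< ε → ∃ λ N → ∀ {n} → N ℕ.≤ n → V ℚ.* ρ ^ℚ n ℚ.≤ ε
    scaled-pow-small V 0≤V 0<ε =
      let η , 0<η , eq = divide (ℚ.+-mono-≤-< 0≤V 0<1) 0<ε
          N , small    = pow-small 0≤ρ ρ<1 0<η
      in N , λ p → ℚ.≤-trans (*-mono 0≤V (ℚ.<⇒≤ 0<η) ℚ.≤-refl (small p))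
           (≤-by η (ℚ.<⇒≤ 0<η) (≡.trans (≡.sym eq) ([V+1]η V η)))

    null-geometric : ∀ (u : ℕ → Carrier) V → (∀ n → ∥ u n ∥≤ V ℚ.* ρ ^ℚ n) → Null u
    null-geometric u V u≤ ε 0<ε =
      let N , small = scaled-pow-small V 0≤V 0<ε in N , λ {n} p → norm-mono (small p) (u≤ n)
      where
      0≤V : 0ℚ ℚ.≤ V
      0≤V = ≡.subst (0ℚ ℚ.≤_) (ℚ.*-identityʳ V) (norm-nonneg (u≤ 0))

    geometric-steps : ∀ (u : ℕ → Carrier) V → (∀ m → ∥ u (suc m) - u m ∥≤ V ℚ.* ρ ^ℚ m) →
      ∀ m n → ∥ u (m ℕ.+ n) - u m ∥≤ V ℚ.* κ ℚ.* ρ ^ℚ m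
    geometric-steps u V step m n =
      norm-mono (≤-by (V ℚ.* κ ℚ.* ρ ^ℚ m ℚ.* ρ ^ℚ n)
          (0≤* (0≤* (0≤* 0≤V 0≤κ) (pow-nonneg 0≤ρ m)) (pow-nonneg 0≤ρ n))
          (split-off (V ℚ.* κ ℚ.* ρ ^ℚ m) (ρ ^ℚ n)))
        (sharp n)
      where
      0≤V : 0ℚ ℚ.≤ V
      0≤V = ≡.subst (0ℚ ℚ.≤_) (ℚ.*-identityʳ V) (norm-nonneg (step 0))
      -- With the factor 1 - ρⁿ the bound equals V times the sum of ρ^(m+i) over i < n, and the
      -- induction closes.
      sharp : ∀ n → ∥ u (m ℕ.+ n) - u m ∥≤ V ℚ.* κ ℚ.* ρ ^ℚ m ℚ.* (1ℚ ℚ.- ρ ^ℚ n)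
      sharp zero rewrite ℕ.+-identityʳ m = norm-resp (sym (-‿inverseʳ (u m)))
        (norm-mono (ℚ.≤-reflexive (0≡a[1-1] (V ℚ.* κ ℚ.* ρ ^ℚ m))) norm-0)
      sharp (suc n) rewrite ℕ.+-suc m n = norm-resp
        (solve 3 (λ a b c → (b :- c) :+ (a :- b) := a :- c) refl (u (suc (m ℕ.+ n))) (u (m ℕ.+ n)) (u m))
        (norm-mono (ℚ.≤-reflexive (≡.trans
            (≡.cong (λ k → V ℚ.* κ ℚ.* ρ ^ℚ m ℚ.* (1ℚ ℚ.- ρ ^ℚ n) ℚ.+ V ℚ.* k) (^ℚ-homo-* ρ m n))
            (telescope V κ (ρ ^ℚ m) (ρ ^ℚ n) ρ κ-inverse)))
          (norm-+ (sharp n) (step (m ℕ.+ n))))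

    geometric-sum : ∀ (v : ℕ → Carrier) V → (∀ j → ∥ v j ∥≤ V ℚ.* ρ ^ℚ j) → ∀ n → ∥ sum v n ∥≤ V ℚ.* κ
    geometric-sum v V v≤ n =
      norm-resp (solve 1 (λ s → s :- con (+ 0) := s) refl (sum v n))
        (norm-mono (ℚ.≤-reflexive (ℚ.*-identityʳ (V ℚ.* κ)))
          (geometric-steps (sum v) V (λ m → norm-resp (solve 2 (λ s a → a := s :+ a :- s) refl (sum v m) (v m)) (v≤ m)) 0 n))

    geometric-lim : ∀ (u : ℕ → Carrier) V → (∀ m → ∥ u (suc m) - u m ∥≤ V ℚ.* ρ ^ℚ m) → ∃ λ l → u ⇢ l
    geometric-lim u V step = complete u λ ε 0<ε →
      let N , small = scaled-pow-small (V ℚ.* κ) (0≤* 0≤V 0≤κ) 0<ε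
      in N , λ n → norm-mono (small ℕ.≤-refl) (geometric-steps u V step N n)
      where
      0≤V : 0ℚ ℚ.≤ V
      0≤V = ≡.subst (0ℚ ℚ.≤_) (ℚ.*-identityʳ V) (norm-nonneg (step 0))

    -- The bound D - DCκρⁿ is preserved by a further factor 1 + Cρⁿ.
    prod-bound : ∀ (z : ℕ → Carrier) C D → 0ℚ ℚ.≤ D → (∀ j → ∥ z j ∥≤ C ℚ.* ρ ^ℚ j) → 1ℚ ℚ.≤ D ℚ.- D ℚ.* (C ℚ.* κ) →
      ∀ n → ∥ prod (λ j → 1# + z j) n ∥≤ D
    prod-bound z C D 0≤D z≤ base n =
      norm-mono (≤-by (c ℚ.* ρ ^ℚ n) (0≤* 0≤c (pow-nonneg 0≤ρ n)) (a≡a-b+b D (c ℚ.* ρ ^ℚ n))) (sharp n)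
      where
      c = D ℚ.* (C ℚ.* κ)
      0≤C : 0ℚ ℚ.≤ C
      0≤C = ≡.subst (0ℚ ℚ.≤_) (ℚ.*-identityʳ C) (norm-nonneg (z≤ 0))
      0≤c : 0ℚ ℚ.≤ c
      0≤c = 0≤* 0≤D (0≤* 0≤C 0≤κ)
      sharp : ∀ n → ∥ prod (λ j → 1# + z j) n ∥≤ D ℚ.- c ℚ.* ρ ^ℚ n
      sharp zero = norm-mono (≡.subst (λ k → 1ℚ ℚ.≤ D ℚ.- k) (≡.sym (ℚ.*-identityʳ c)) base) norm-1
      sharp (suc n) = norm-mono
        (≤-by (c ℚ.* ρ ^ℚ n ℚ.* (C ℚ.* ρ ^ℚ n)) (0≤* (0≤* 0≤c 0≤s) (0≤* 0≤C 0≤s))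
          (invariant D C κ ρ (ρ ^ℚ n) κ-inverse))
        (norm-* (sharp n) (norm-+ norm-1 (z≤ n)))
        where
        0≤s = pow-nonneg 0≤ρ n

    -- Once 2Cκρ^N ≤ 1, `prod-bound` with D = 2 applies to the tail from N, whose partial products
    -- therefore form a sequence with geometrically small steps. The first N factors are peeled off
    -- one by one, each turning C into Cρ.
    lim-infinite-prod : ∀ (z : ℕ → Carrier) C → (∀ j → ∥ z j ∥≤ C ℚ.* ρ ^ℚ j) → ∃ λ P → prod (λ j → 1# + z j) ⇢ P
    lim-infinite-prod z C z≤ =
      let N , small = scaled-pow-small (2ℚ ℚ.* (C ℚ.* κ)) (0≤* 0≤2 (0≤* 0≤C 0≤κ)) 0<1
      in from z C N z≤ (small ℕ.≤-refl)
      where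
      0≤2 : 0ℚ ℚ.≤ 2ℚ
      0≤2 = 0≤+ 0≤1 0≤1
      0≤C : 0ℚ ℚ.≤ C
      0≤C = ≡.subst (0ℚ ℚ.≤_) (ℚ.*-identityʳ C) (norm-nonneg (z≤ 0))
      from : ∀ (z : ℕ → Carrier) C N → (∀ j → ∥ z j ∥≤ C ℚ.* ρ ^ℚ j) → 2ℚ ℚ.* (C ℚ.* κ) ℚ.* ρ ^ℚ N ℚ.≤ 1ℚ →
        ∃ λ P → prod (λ j → 1# + z j) ⇢ P
      from z C zero z≤ c≤1 = geometric-lim (prod (λ j → 1# + z j)) (2ℚ ℚ.* C) λ m →
        norm-resp (solve 2 (λ p z → p :* z := p :* (:1 :+ z) :- p) refl (prod (λ j → 1# + z j) m) (z m))
          (norm-mono (ℚ.≤-reflexive (≡.sym (ℚ.*-assoc 2ℚ C (ρ ^ℚ m))))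
            (norm-* (prod-bound z C 2ℚ 0≤2 z≤
              (ℚ.+-monoʳ-≤ 2ℚ (ℚ.neg-antimono-≤ (≡.subst (ℚ._≤ 1ℚ) (ℚ.*-identityʳ (2ℚ ℚ.* (C ℚ.* κ))) c≤1))) m) (z≤ m)))
      from z C (suc N) z≤ c≤1 =
        let P , lim = from (z ∘ suc) (C ℚ.* ρ) N
              (λ j → norm-mono (ℚ.≤-reflexive (≡.sym (ℚ.*-assoc C ρ (ρ ^ℚ j)))) (z≤ (suc j)))
              (≡.subst (ℚ._≤ 1ℚ) (assoc₄ 2ℚ C κ ρ (ρ ^ℚ N)) c≤1)
        in (1# + z 0) * P , lim-unshift
             (lim-cong (λ n → sym (prod-head (λ j → 1# + z j) n)) refl (lim-* (lim-const (1# + z 0)) lim))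

-- Evaluation of the two series

-- Meant for sequences whose successive ratios Mρⁿ drop below 1 only from some index on.
eventually-decreasing⇒bounded : ∀ (y : ℕ → ℚ) N → (∀ {n} → N ℕ.≤ n → y (suc n) ℚ.≤ y n) →
  ∃ λ B → ∀ n → y n ℚ.≤ B
eventually-decreasing⇒bounded y zero    dec = y 0 , bound
  where
  bound : ∀ n → y n ℚ.≤ y 0
  bound zero    = ℚ.≤-refl
  bound (suc n) = ℚ.≤-trans (dec z≤n) (bound n)
eventually-decreasing⇒bounded y (suc N) dec =
  let B , y≤B = eventually-decreasing⇒bounded (y ∘ suc) N (dec ∘ s≤s)
  in y 0 ℚ.⊔ B , λ { zero    → ℚ.p≤p⊔q (y 0) B
                   ; (suc n) → ℚ.≤-trans (y≤B n) (ℚ.p≤q⊔p (y 0) B) }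

module Evaluation (R : CommutativeRing 0ℓ 0ℓ) (norm : CompleteNorm R) where

  open CommutativeRing R
  open CompleteNorm norm
  open IntegerSolver R using (solve; _:=_; _:+_; _:*_; _:-_; _:^_; :-_; :1; con)
  open FiniteSums R
  open Analysis R norm
  open Exp semiring using (^-congˡ; ^-homo-*; ^-assocʳ)
  open ℕ-Solver using () renaming
    (solve to ℕ-solve; con to con′; _:+_ to _:+′_; _:*_ to _:*′_; _:=_ to _:=′_)

  norm-*1 : ∀ {z w a} → ∥ z ∥≤ a → ∥ w ∥≤ 1ℚ → ∥ z * w ∥≤ a
  norm-*1 z≤a w≤1 = norm-mono (ℚ.≤-reflexive (ℚ.*-identityʳ _)) (norm-* z≤a w≤1)

  norm-1* : ∀ {z w a} → ∥ z ∥≤ 1ℚ → ∥ w ∥≤ a → ∥ z * w ∥≤ a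
  norm-1* z≤1 w≤a = norm-mono (ℚ.≤-reflexive (ℚ.*-identityˡ _)) (norm-* z≤1 w≤a)

  norm-pow1 : ∀ {z} → ∥ z ∥≤ 1ℚ → ∀ n → ∥ z ^ n ∥≤ 1ℚ
  norm-pow1 z≤1 zero    = norm-1
  norm-pow1 z≤1 (suc n) = norm-1* z≤1 (norm-pow1 z≤1 n)

  norm-1- : ∀ {z} → ∥ z ∥≤ 1ℚ → ∥ 1# - z ∥≤ 2ℚ
  norm-1- z≤1 = norm-+ norm-1 (norm-neg z≤1)

  module InDisk
    {ρ κ : ℚ} (0≤ρ : 0ℚ ℚ.≤ ρ) (ρ<1 : ρ ℚ.< 1ℚ) (0≤κ : 0ℚ ℚ.≤ κ) (κ-inverse : κ ℚ.* (1ℚ ℚ.- ρ) ≡ 1ℚ)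
    (q : Carrier) (q≤ρ : ∥ q ∥≤ ρ)
    where

    open Geometric 0≤ρ ρ<1 0≤κ κ-inverse

    q^≤1 : ∀ n → ∥ q ^ n ∥≤ 1ℚ
    q^≤1 = norm-pow1 (norm-mono (ℚ.<⇒≤ ρ<1) q≤ρ)

    q^suc≤ρ : ∀ n → ∥ q ^ suc n ∥≤ ρ
    q^suc≤ρ n = norm-*1 q≤ρ (q^≤1 n)

    unit-below-ρ : ∀ {z} → ∥ z ∥≤ ρ → ∃ λ w → (1# - z) * w ≈ 1# × ∥ w ∥≤ κ
    unit-below-ρ = unit ρ<1 0≤κ κ-inverse

    q-unit : ∃ λ w → (1# - q) * w ≈ 1# × ∥ w ∥≤ κ
    q-unit = unit-below-ρ q≤ρ

    q⁴-unit : ∀ k → ∃ λ w → (1# - q ^ 4 * (q ^ 4) ^ k) * w ≈ 1# × ∥ w ∥≤ κ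
    q⁴-unit k = unit-below-ρ (norm-*1 (q^suc≤ρ 3) (norm-pow1 (q^≤1 4) k))

    L : ℕ → Carrier
    L k = proj₁ (q⁴-unit k)

    open WZPair.Summation R q (proj₁ q-unit) (proj₁ (proj₂ q-unit)) L (λ k → proj₁ (proj₂ (q⁴-unit k))) public

    x≤1 : ∀ k → ∥ x k ∥≤ 1ℚ
    x≤1 = norm-pow1 (q^≤1 2)

    private
      -- Mρⁿ bounds the n-th ratio of c · N · ΠW: 8ρⁿ comes from F, κ³ from L³, 2 from e - q^(4n+2),
      -- and κ from W. `y` multiplies these bounds up.
      8ℚ M : ℚ
      8ℚ = 2ℚ ^ℚ 3
      M  = 8ℚ ℚ.* (κ ^ℚ 3 ℚ.* (2ℚ ℚ.* κ))

      y : ℕ → ℚ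
      y zero    = κ
      y (suc n) = y n ℚ.* (M ℚ.* ρ ^ℚ n)

      0≤2 : 0ℚ ℚ.≤ 2ℚ
      0≤2 = 0≤+ 0≤1 0≤1

      0≤M : 0ℚ ℚ.≤ M
      0≤M = 0≤* (pow-nonneg 0≤2 3) (0≤* (pow-nonneg 0≤κ 3) (0≤* 0≤2 0≤κ))

      0≤y : ∀ n → 0ℚ ℚ.≤ y n
      0≤y zero    = 0≤κ
      0≤y (suc n) = 0≤* (0≤y n) (0≤* 0≤M (pow-nonneg 0≤ρ n))

      y-bounded : ∃ λ B → ∀ n → y n ℚ.≤ B
      y-bounded =
        let N , small = scaled-pow-small M 0≤M 0<1
        in eventually-decreasing⇒bounded y N λ {n} p →
             ℚ.≤-trans (*-mono (0≤y n) 0≤1 ℚ.≤-refl (small p)) (ℚ.≤-reflexive (ℚ.*-identityʳ (y n)))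

      Y : ℚ
      Y = proj₁ y-bounded

      F-bound : ∀ n → ∥ F n ∥≤ ρ ^ℚ n ℚ.* 8ℚ
      F-bound n = norm-* (norm-1* (norm-mono (ℚ.<⇒≤ ρ<1) q≤ρ) (norm-pow (q^suc≤ρ 1) n))
        (norm-pow (norm-1- (norm-*1 (norm-mono (ℚ.<⇒≤ ρ<1) q≤ρ) (x≤1 n))) 3)

    module _ {e : Carrier} {W : ℕ → Carrier} (e≤1 : ∥ e ∥≤ 1ℚ) (W≤κ : ∀ i → ∥ W i ∥≤ κ) where

      cND-bound : ∀ n → ∥ c n * N e n * prod W n ∥≤ y n
      cND-bound zero = norm-*1 (norm-*1 (proj₂ (proj₂ q-unit)) norm-1) norm-1
      cND-bound (suc n) = norm-resp
        (solve 7 (λ c N D F L n W → c :* N :* D :* (F :* (L :* (n :* W))) := c :* (F :* L) :* (N :* n) :* (D :* W))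
          refl (c n) (N e n) (prod W n) (F n) (L n ^ 3) (e - q ^ 2 * (q ^ 4) ^ n) (W n))
        (norm-* (cND-bound n) (norm-mono (ℚ.≤-reflexive
            (≡.trans (ℚ.*-assoc (ρ ^ℚ n) 8ℚ (κ ^ℚ 3 ℚ.* (2ℚ ℚ.* κ))) (ℚ.*-comm (ρ ^ℚ n) M)))
          (norm-* (F-bound n) (norm-* (norm-pow (proj₂ (proj₂ (q⁴-unit n))) 3)
            (norm-* (norm-+ e≤1 (norm-neg (norm-*1 (q^≤1 2) (norm-pow1 (q^≤1 4) n)))) (W≤κ n))))))

    -- The factor F supplies ρⁿ and the factor e supplies a; the two surplus factors of W cost κ². G
    -- is fixed before e and W, so that one constant serves every step of the iteration.
    g-bound : ∃ λ G → 0ℚ ℚ.≤ G × (∀ {e W a} → ∥ e ∥≤ a → a ℚ.≤ 1ℚ → (∀ i → ∥ W i ∥≤ κ) →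
      ∀ n → ∥ g e W n ∥≤ (G ℚ.* ρ ^ℚ n) ℚ.* a)
    g-bound = 8ℚ ℚ.* G′ , 0≤* (pow-nonneg 0≤2 3) (0≤* (0≤* 0≤Y 0≤κ) 0≤κ) , λ {e} {W} {a} e≤a a≤1 W≤κ n →
      norm-neg (norm-resp
        (solve 7 (λ e F c N D V W → F :* (c :* N :* D :* V :* W) :* e := e :* F :* (c :* N :* (D :* V :* W)))
          refl e (F n) (c n) (N e n) (prod W n) (W n) (W (suc n)))
        (norm-* (norm-mono (ℚ.≤-reflexive (rearrange (ρ ^ℚ n) 8ℚ G′))
          (norm-* (F-bound n) (norm-* (norm-* (norm-mono (proj₂ y-bounded n) (cND-bound (norm-mono a≤1 e≤a) W≤κ n)) (W≤κ n)) (W≤κ (suc n)))))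
          e≤a))
      where
      0≤Y = ℚ.≤-trans 0≤κ (proj₂ y-bounded 0)
      G′ = Y ℚ.* κ ℚ.* κ
      rearrange : ∀ a b c → a ℚ.* b ℚ.* c ≡ b ℚ.* c ℚ.* a
      rearrange a b c = ≡.trans (ℚ.*-assoc a b c) (ℚ.*-comm a (b ℚ.* c))

    T₀ : ℕ → Carrier
    T₀ = sum (t 0# (λ _ → 1#))

    -- Iteration along e, eq⁴, eq⁸, ...

    module Iteration (e₀ : Carrier) (e₀≤1 : ∥ e₀ ∥≤ 1ℚ) where

      W₀-unit : ∀ i → ∃ λ w → (1# - e₀ * (q * x i)) * w ≈ 1# × ∥ w ∥≤ κ
      W₀-unit i = unit-below-ρ (norm-1* e₀≤1 (norm-*1 q≤ρ (x≤1 i)))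

      E : ℕ → Carrier
      E zero    = e₀
      E (suc j) = E j * q ^ 4

      -- Shifting the inverses, instead of constructing new ones for each `E j`, makes `W (suc j)`
      -- the very sequence that `wz` yields for `W j`.
      W : ℕ → ℕ → Carrier
      W zero    i = proj₁ (W₀-unit i)
      W (suc j) i = W j (2 ℕ.+ i)

      E-power : ∀ j → E j ≈ e₀ * (q ^ 4) ^ j
      E-power zero    = sym (*-identityʳ e₀)
      E-power (suc j) = trans (*-congʳ (E-power j))
        (solve 3 (λ e p r → e :* p :* r := e :* (r :* p)) refl e₀ ((q ^ 4) ^ j) (q ^ 4))

      E-bound : ∀ j → ∥ E j ∥≤ ρ ^ℚ j
      E-bound zero    = e₀≤1
      E-bound (suc j) = norm-mono (ℚ.≤-reflexive (ℚ.*-comm (ρ ^ℚ j) ρ)) (norm-* (E-bound j) (q^suc≤ρ 3))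

      W-inverse : ∀ j i → (1# - E j * (q * x i)) * W j i ≈ 1#
      W-inverse zero    i = proj₁ (proj₂ (W₀-unit i))
      W-inverse (suc j) i = trans
        (*-congʳ (solve 3 (λ e q x → :1 :- e :* q :^ 4 :* (q :* x) := :1 :- e :* (q :* (q :^ 2 :* (q :^ 2 :* x))))
          refl (E j) q (x i)))
        (W-inverse j (2 ℕ.+ i))

      W-bound : ∀ j i → ∥ W j i ∥≤ κ
      W-bound zero    i = proj₂ (proj₂ (W₀-unit i))
      W-bound (suc j) i = W-bound j (2 ℕ.+ i)

      S : ℕ → ℕ → Carrier
      S n j = sum (t (E j) (W j)) (suc n)

      r′ : ℕ → Carrier
      r′ j = r (E j) (W j)

      g′ : ℕ → ℕ → Carrier
      g′ n j = g (E j) (W j) n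

      iterate : ∀ n m → S n 0 - prod r′ m * S n m ≈ sum (λ j → prod r′ j * g′ n j) m
      iterate n zero    = solve 1 (λ s → s :- :1 :* s := con (+ 0)) refl (S n 0)
      iterate n (suc m) = trans
        (solve 5 (λ s p r s′ g → s :- p :* r :* s′ := s :- p :* (r :* s′ :+ g) :+ p :* g) refl
          (S n 0) (prod r′ m) (r′ m) (S n (suc m)) (g′ n m))
        (+-congʳ (trans (+-congˡ (-‿cong (*-congˡ (sym (wz (E m) (W m) (W-inverse m) n))))) (iterate n m)))

      private
        G = proj₁ g-bound

      g′-bound : ∀ n j → ∥ g′ n j ∥≤ G ℚ.* ρ ^ℚ n ℚ.* ρ ^ℚ j
      g′-bound n j = proj₂ (proj₂ g-bound) (E-bound j) (pow-decreasing 0≤ρ (ℚ.<⇒≤ ρ<1) 0 j) (W-bound j) n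

      -- By `r-value` the factors are 1 - `g′ 0 j`, and `g′ 0 j` decays geometrically in j; the
      -- product thus converges, and a convergent sequence is bounded.
      prod-r′-bounded : Bdd (prod r′)
      prod-r′-bounded =
        let _ , lim = lim-infinite-prod (λ j → - g′ 0 j) (G ℚ.* ρ ^ℚ 0) (λ j → norm-neg (g′-bound 0 j))
            B , bound = lim⇒bdd lim
        in B , λ n → norm-resp (sym (prod-cong (λ j → r-value (E j) (W j) (W-inverse j)) n)) (bound n)

      -- K must serve all m at once. The factor ρ^j in `g′-bound` makes this possible: its sum over
      -- j is at most κ.
      iterate-bound : ∃ λ K → 0ℚ ℚ.≤ K × (∀ n m → ∥ S n 0 - prod r′ m * S n m ∥≤ K ℚ.* ρ ^ℚ n)
      iterate-bound = B ℚ.* G ℚ.* κ , 0≤* (0≤* (norm-nonneg (r′≤B 0)) (proj₁ (proj₂ g-bound))) 0≤κ , λ n m →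
        norm-resp (sym (iterate n m))
          (norm-mono (ℚ.≤-reflexive (exchange B G (ρ ^ℚ n) κ))
            (geometric-sum (λ j → prod r′ j * g′ n j) (B ℚ.* (G ℚ.* ρ ^ℚ n))
              (λ j → norm-mono (ℚ.≤-reflexive (≡.sym (ℚ.*-assoc B (G ℚ.* ρ ^ℚ n) (ρ ^ℚ j))))
                (norm-* (r′≤B j) (g′-bound n j))) m))
        where
        B = proj₁ prod-r′-bounded
        r′≤B = proj₂ prod-r′-bounded

      E⇢0 : E ⇢ 0#
      E⇢0 = null-cong (λ j → solve 1 (λ e → e := e :- con (+ 0)) refl (E j))
        (null-geometric E 1ℚ (λ j → norm-mono (ℚ.≤-reflexive (≡.sym (ℚ.*-identityˡ (ρ ^ℚ j)))) (E-bound j)))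

      -- From (1 - ez)w = 1 follows w - 1 = ezw, where w stays bounded and e runs to 0.
      W⇢1 : ∀ i → (λ j → W j i) ⇢ 1#
      W⇢1 i = null-cong
        (λ j → trans (solve 3 (λ e z w → (e :- con (+ 0)) :* (z :* w) := w :- (:1 :- e :* z) :* w) refl (E j) (q * x i) (W j i))
                 (+-congˡ (-‿cong (W-inverse j i))))
        (null-*-bdd E⇢0 (bdd-* (bdd-const (q * x i)) (κ , λ j → W-bound j i)))

      S⇢T₀ : ∀ n → S n ⇢ T₀ (suc n)
      S⇢T₀ n = lim-sum (λ k → lim-*
        (lim-* (lim-const ((1# - q * x k ^ 3) * c k)) (lim-prod (λ j → lim-+ E⇢0 (lim-const (- (q ^ 2 * (q ^ 4) ^ j)))) k))
        (lim-prod W⇢1 k)) (suc n)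

      -- Denominator and numerator of `r′`, both free of inverses.
      a b : ℕ → Carrier
      a j = (1# - E j * q) * (1# - E j * q ^ 3)
      b j = (1# - E j * q ^ 2) ^ 2

      a*r′ : ∀ j → a j * r′ j ≈ b j
      a*r′ j = begin
        a j * (b j * (W j 0 * W j 1))
          ≈⟨ solve 5 (λ e q b v w →
               (:1 :- e :* q) :* (:1 :- e :* q :^ 3) :* (b :* (v :* w))
               := (:1 :- e :* (q :* :1)) :* v :* ((:1 :- e :* (q :* (q :^ 2 :* :1))) :* w) :* b)
               refl (E j) q (b j) (W j 0) (W j 1) ⟩
        (1# - E j * (q * x 0)) * W j 0 * ((1# - E j * (q * x 1)) * W j 1) * b j
          ≈⟨ *-congʳ (*-cong (W-inverse j 0) (W-inverse j 1)) ⟩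
        1# * 1# * b j
          ≈⟨ trans (*-congʳ (*-identityˡ 1#)) (*-identityˡ (b j)) ⟩
        b j ∎
        where open SetoidReasoning setoid

      -- Multiplying `iterate-bound` by `prod a m` clears the denominators of `prod r′ m`, so that
      -- only products without inverses need limits. Half of ε covers the bound CKρⁿ, the other half
      -- the slack in letting m → ∞.
      transfer : ∀ {A B} → prod a ⇢ A → prod b ⇢ B → Null (λ n → A * S n 0 - B * T₀ (suc n))
      transfer {A} {B} a⇢A b⇢B ε 0<ε =
        let C , a≤C       = lim⇒bdd a⇢A
            K , 0≤K , bnd = iterate-bound
            0≤C           = norm-nonneg (a≤C 0)
            N , small     = scaled-pow-small (C ℚ.* K) (0≤* 0≤C 0≤K) (*-pos 0<ε 0<½)
        in N , λ {n} p →
          norm-mono (ℚ.≤-reflexive (half+half ε))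
            (lim-bound
              (lim-+ (lim-* a⇢A (lim-const (S n 0))) (lim-neg (lim-* b⇢B (S⇢T₀ n))))
              (λ m → norm-mono (ℚ.≤-trans (ℚ.≤-reflexive (≡.sym (ℚ.*-assoc C K (ρ ^ℚ n)))) (small p))
                (norm-resp (regroup n m) (norm-* (a≤C m) (bnd n m))))
              (*-pos 0<ε 0<½))
        where
        regroup : ∀ n m → prod a m * (S n 0 - prod r′ m * S n m) ≈ prod a m * S n 0 - prod b m * S n m
        regroup n m = trans
          (solve 4 (λ a s r s′ → a :* (s :- r :* s′) := a :* s :- a :* r :* s′) refl (prod a m) (S n 0) (prod r′ m) (S n m))
          (+-congˡ (-‿cong (*-congʳ (trans (prod-* a r′ m) (prod-cong a*r′ m)))))

    -- Infinite products and the limits of T(0) and T(1)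

    poch : ℕ → ℕ → Carrier
    poch s = prod (λ j → 1# - q ^ s * (q ^ 4) ^ j)

    poch-head : ∀ s n → poch s (suc n) ≈ (1# - q ^ s) * poch (4 ℕ.+ s) n
    poch-head s n = trans (prod-head (λ j → 1# - q ^ s * (q ^ 4) ^ j) n)
      (*-cong (+-congˡ (-‿cong (*-identityʳ (q ^ s))))
        (prod-cong (λ j → solve 3 (λ q p y → :1 :- p :* (q :^ 4 :* y) := :1 :- q :* (q :* (q :* (q :* p))) :* y)
          refl q (q ^ s) ((q ^ 4) ^ j)) n))

    private
      pow-bound : ∀ s j → ∥ q ^ s * (q ^ 4) ^ j ∥≤ 1ℚ ℚ.* ρ ^ℚ j
      pow-bound s j = norm-* (q^≤1 s) (norm-pow (q^suc≤ρ 3) j)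

    poch-lim : ∀ s → ∃ λ P → poch s ⇢ P
    poch-lim s = lim-infinite-prod (λ j → - (q ^ s * (q ^ 4) ^ j)) 1ℚ (λ j → norm-neg (pow-bound s j))

    -- The product of the reciprocal factors converges as well, which makes the
    -- limit a unit.
    poch-lim-unit : ∀ s {P} → poch (suc s) ⇢ P → ∃ λ i → P * i ≈ 1#
    poch-lim-unit s {P} lim = Q * w , trans (sym (*-assoc P Q w))
      (trans (*-congʳ (solve 1 (λ y → y := :1 :- (:1 :- y)) refl (P * Q))) w-inverse)
      where
      factor : ∀ j → ∃ λ w → (1# - q ^ suc s * (q ^ 4) ^ j) * w ≈ 1# × ∥ w ∥≤ κ
      factor j = unit-below-ρ (norm-*1 (q^suc≤ρ s) (norm-pow1 (q^≤1 4) j))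
      v : ℕ → Carrier
      v j = proj₁ (factor j)
      v-lim = lim-infinite-prod (λ j → q ^ suc s * (q ^ 4) ^ j * v j) κ
        (λ j → norm-mono (ℚ.≤-reflexive (≡.trans (≡.cong (ℚ._* κ) (ℚ.*-identityˡ (ρ ^ℚ j))) (ℚ.*-comm (ρ ^ℚ j) κ)))
          (norm-* (pow-bound (suc s) j) (proj₂ (proj₂ (factor j)))))
      Q : Carrier
      Q = proj₁ v-lim
      v-value : ∀ j → (1# - q ^ suc s * (q ^ 4) ^ j) * (1# + q ^ suc s * (q ^ 4) ^ j * v j) ≈ 1#
      v-value j = trans (*-congˡ (trans (+-congʳ (sym (proj₁ (proj₂ (factor j)))))
          (solve 2 (λ z v → (:1 :- z) :* v :+ z :* v := v) refl (q ^ suc s * (q ^ 4) ^ j) (v j))))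
        (proj₁ (proj₂ (factor j)))
      near-1 : (λ _ → 1#) ⇢ (P * Q)
      near-1 = lim-cong (λ n → prod-units v-value n)
        refl (lim-* lim (proj₂ v-lim))
      -- `near-1` does not give `P * Q ≈ 1#`, as limits are not unique up to `≈`. But 1 - PQ has
      -- norm at most ½, so PQ has an inverse of norm at most 2.
      correction = unit {κ = 2ℚ} (ℚ.*<* (ℤ.+<+ (s≤s (s≤s z≤n)))) (0≤+ 0≤1 0≤1) ≡.refl
        (proj₂ (near-1 ½ 0<½) ℕ.≤-refl)
      w = proj₁ correction
      w-inverse = proj₁ (proj₂ correction)

    -- P₂ and P₁ are built from P₆ and P₅, so that their relations to these hold exactly and not
    -- merely up to a null difference.
    P₃ P₄ P₅ P₆ P₂ P₁ : Carrier
    P₃ = proj₁ (poch-lim 3)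
    P₄ = proj₁ (poch-lim 4)
    P₅ = proj₁ (poch-lim 5)
    P₆ = proj₁ (poch-lim 6)
    P₂ = (1# - q ^ 2) * P₆
    P₁ = (1# - q ^ 1) * P₅

    P₂-lim : poch 2 ⇢ P₂
    P₂-lim = lim-unshift (lim-cong (λ n → sym (poch-head 2 n)) refl (lim-* (lim-const (1# - q ^ 2)) (proj₂ (poch-lim 6))))

    P₁-lim : poch 1 ⇢ P₁
    P₁-lim = lim-unshift (lim-cong (λ n → sym (poch-head 1 n)) refl (lim-* (lim-const (1# - q ^ 1)) (proj₂ (poch-lim 5))))

    P₃-unit = poch-lim-unit 2 (proj₂ (poch-lim 3))
    P₄-unit = poch-lim-unit 3 (proj₂ (poch-lim 4))
    P₅-unit = poch-lim-unit 4 (proj₂ (poch-lim 5))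

    P₄⁻¹ : Carrier
    P₄⁻¹ = proj₁ P₄-unit

    module I₁ = Iteration 1# norm-1
    module Iq² = Iteration (q ^ 2) (q^≤1 2)

    Sq²≈1 : ∀ n → Iq².S n 0 ≈ 1#
    Sq²≈1 zero    = trans (+-identityˡ _) (t-zero (q ^ 2) (Iq².W 0) (Iq².W-inverse 0) (q ^ 2) (Iq².W 0))
    Sq²≈1 (suc n) = trans (+-cong (Sq²≈1 n) vanish) (+-identityʳ 1#)
      where
      vanish : t (q ^ 2) (Iq².W 0) (suc n) ≈ 0#
      vanish = trans (*-congʳ (*-congˡ (prod-head (λ j → q ^ 2 - q ^ 2 * (q ^ 4) ^ j) n)))
        (solve 4 (λ a p r d → a :* ((p :- p :* :1) :* r) :* d := con (+ 0)) refl
          ((1# - q * x (suc n) ^ 3) * c (suc n)) (q ^ 2) (prod (λ j → q ^ 2 - q ^ 2 * (q ^ 4) ^ suc j) n) (prod (Iq².W 0) (suc n)))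

    transfer-q² : Null (λ n → P₃ * P₅ * Iq².S n 0 - P₄ * P₄ * T₀ (suc n))
    transfer-q² = Iq².transfer
      (lim-cong (λ n → trans (prod-* _ _ n) (prod-cong (λ j → sym (trans
          (*-cong (+-congˡ (-‿cong (*-congʳ (Iq².E-power j)))) (+-congˡ (-‿cong (*-congʳ (Iq².E-power j)))))
          (solve 2 (λ q y → (:1 :- q :^ 2 :* y :* q) :* (:1 :- q :^ 2 :* y :* q :^ 3)
             := (:1 :- q :^ 3 :* y) :* (:1 :- q :^ 5 :* y)) refl q ((q ^ 4) ^ j)))) n))
        refl (lim-* (proj₂ (poch-lim 3)) (proj₂ (poch-lim 5))))
      (lim-cong (λ n → trans (prod-* _ _ n) (prod-cong (λ j → sym (trans
          (^-congˡ 2 (+-congˡ (-‿cong (*-congʳ (Iq².E-power j)))))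
          (solve 2 (λ q y → (:1 :- q :^ 2 :* y :* q :^ 2) :^ 2
             := (:1 :- q :^ 4 :* y) :* (:1 :- q :^ 4 :* y)) refl q ((q ^ 4) ^ j)))) n))
        refl (lim-* (proj₂ (poch-lim 4)) (proj₂ (poch-lim 4))))

    transfer-1 : Null (λ n → P₁ * P₃ * I₁.S n 0 - P₂ * P₂ * T₀ (suc n))
    transfer-1 = I₁.transfer
      (lim-cong (λ n → trans (prod-* _ _ n) (prod-cong (λ j → sym (trans
          (*-cong (+-congˡ (-‿cong (*-congʳ (I₁.E-power j)))) (+-congˡ (-‿cong (*-congʳ (I₁.E-power j)))))
          (solve 2 (λ q y → (:1 :- :1 :* y :* q) :* (:1 :- :1 :* y :* q :^ 3)
             := (:1 :- q :^ 1 :* y) :* (:1 :- q :^ 3 :* y)) refl q ((q ^ 4) ^ j)))) n))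
        refl (lim-* P₁-lim (proj₂ (poch-lim 3))))
      (lim-cong (λ n → trans (prod-* _ _ n) (prod-cong (λ j → sym (trans
          (^-congˡ 2 (+-congˡ (-‿cong (*-congʳ (I₁.E-power j)))))
          (solve 2 (λ q y → (:1 :- :1 :* y :* q :^ 2) :^ 2
             := (:1 :- q :^ 2 :* y) :* (:1 :- q :^ 2 :* y)) refl q ((q ^ 4) ^ j)))) n))
        refl (lim-* P₂-lim P₂-lim))

    T₀-lim : T₀ ⇢ P₃ * P₅ * P₄⁻¹ ^ 2
    T₀-lim = lim-unshift (null-cong
      (λ n → begin
        - (P₃ * P₅ * Iq².S n 0 - P₄ * P₄ * T₀ (suc n)) * P₄⁻¹ ^ 2
          ≈⟨ *-congʳ (-‿cong (+-congʳ (*-congˡ (Sq²≈1 n)))) ⟩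
        - (P₃ * P₅ * 1# - P₄ * P₄ * T₀ (suc n)) * P₄⁻¹ ^ 2
          ≈⟨ solve 4 (λ a p i t → :- (a :* :1 :- p :* p :* t) :* i :^ 2 := (p :* i) :* (p :* i) :* t :- a :* i :^ 2)
               refl (P₃ * P₅) P₄ P₄⁻¹ (T₀ (suc n)) ⟩
        P₄ * P₄⁻¹ * (P₄ * P₄⁻¹) * T₀ (suc n) - P₃ * P₅ * P₄⁻¹ ^ 2
          ≈⟨ +-congʳ (trans (*-congʳ (trans (*-cong (proj₂ P₄-unit) (proj₂ P₄-unit)) (*-identityˡ 1#))) (*-identityˡ _)) ⟩
        T₀ (suc n) - P₃ * P₅ * P₄⁻¹ ^ 2 ∎)
      (null-*-bdd (null-neg transfer-q²) (bdd-const (P₄⁻¹ ^ 2))))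
      where open SetoidReasoning setoid

    W₁ : ℕ → Carrier
    W₁ = I₁.W 0

    T₁ : ℕ → Carrier
    T₁ = sum (t 1# W₁)

    T₁-lim : T₁ ⇢ (1# + q) * P₂ * P₆ * P₄⁻¹ ^ 2
    T₁-lim = lim-unshift (lim-cong cancel value
      (lim-+ {l = 0#} (null-cong (λ n → solve 1 (λ a → a := a :- con (+ 0)) refl _) (null-*-bdd transfer-1 (bdd-const J)))
        (lim-* (lim-const (J * (P₂ * P₂))) (λ ε 0<ε → let N , small = T₀-lim ε 0<ε in N , λ p → small (ℕ.m≤n⇒m≤1+n p)))))
      where
      open SetoidReasoning setoid
      i₃ = proj₁ P₃-unit
      i₅ = proj₁ P₅-unit
      u = proj₁ q-unit
      -- The inverse of P₁P₃, because P₁ = (1 - q)P₅.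
      J = u * i₅ * i₃
      units : P₅ * i₅ * (P₃ * i₃ * ((1# - q) * u)) ≈ 1#
      units = trans (*-cong (proj₂ P₅-unit) (trans (*-cong (proj₂ P₃-unit) (proj₁ (proj₂ q-unit))) (*-identityˡ 1#))) (*-identityˡ 1#)
      cancel : ∀ n → (P₁ * P₃ * I₁.S n 0 - P₂ * P₂ * T₀ (suc n)) * J + J * (P₂ * P₂) * T₀ (suc n) ≈ I₁.S n 0
      cancel n = trans
        (solve 9 (λ q P₃ P₅ s p t u i₅ i₃ →
           ((:1 :- q :^ 1) :* P₅ :* P₃ :* s :- p :* t) :* (u :* i₅ :* i₃) :+ u :* i₅ :* i₃ :* p :* t
           := P₅ :* i₅ :* (P₃ :* i₃ :* ((:1 :- q) :* u)) :* s)
          refl q P₃ P₅ (I₁.S n 0) (P₂ * P₂) (T₀ (suc n)) u i₅ i₃)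
        (trans (*-congʳ units) (*-identityˡ _))
      -- One of the two factors P₂ unfolds to (1 - q²)P₆, and dividing 1 - q² by 1 - q gives the
      -- factor 1 + q.
      value : 0# + J * (P₂ * P₂) * (P₃ * P₅ * P₄⁻¹ ^ 2) ≈ (1# + q) * P₂ * P₆ * P₄⁻¹ ^ 2
      value = trans
        (solve 9 (λ q P₃ P₅ P₂ P₆ i u i₅ i₃ →
           con (+ 0) :+ u :* i₅ :* i₃ :* (P₂ :* ((:1 :- q :^ 2) :* P₆)) :* (P₃ :* P₅ :* i :^ 2)
           := P₅ :* i₅ :* (P₃ :* i₃ :* ((:1 :- q) :* u)) :* ((:1 :+ q) :* P₂ :* P₆ :* i :^ 2))
          refl q P₃ P₅ P₂ P₆ P₄⁻¹ u i₅ i₃)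
        (trans (*-congʳ units) (*-identityˡ _))

    -- The summands of T(1) and T(0) in the form of the statement

    [_] : ℕ → Carrier
    [ n ] = sum (q ^_) n

    poch-odd : ℕ → Carrier
    poch-odd = prod (λ j → 1# - q * (q ^ 2) ^ j)

    q-number : ∀ n → [ n ] ≈ (1# - q ^ n) * proj₁ q-unit
    q-number n = begin
      [ n ]                                  ≈⟨ *-identityˡ _ ⟨
      1# * [ n ]                             ≈⟨ *-congʳ (proj₁ (proj₂ q-unit)) ⟨
      (1# - q) * u * [ n ]                   ≈⟨ solve 3 (λ q u s → (:1 :- q) :* u :* s := (:1 :- q) :* s :* u) refl q u [ n ] ⟩
      (1# - q) * [ n ] * u                   ≈⟨ *-congʳ (numerator n) ⟩
      (1# - q ^ n) * u                       ∎
      where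
      open SetoidReasoning setoid
      u = proj₁ q-unit
      numerator : ∀ n → (1# - q) * [ n ] ≈ 1# - q ^ n
      numerator zero    = solve 1 (λ q → (:1 :- q) :* con (+ 0) := :1 :- :1) refl q
      numerator (suc n) = trans (distribˡ _ _ _) (trans (+-congʳ (numerator n))
        (solve 2 (λ q p → :1 :- p :+ (:1 :- q) :* p := :1 :- q :* p) refl q (q ^ n)))

    x-power : ∀ k → q ^ (2 ℕ.* k) ≈ x k
    x-power k = sym (^-assocʳ q 2 k)

    q^6k+1 : ∀ k → q ^ (6 ℕ.* k ℕ.+ 1) ≈ q * x k ^ 3
    q^6k+1 k = begin
      q ^ (6 ℕ.* k ℕ.+ 1)          ≡⟨ ≡.cong (q ^_) (ℕ-solve 1 (λ k → con′ 6 :*′ k :+′ con′ 1 :=′ con′ 1 :+′ con′ 2 :*′ k :*′ con′ 3) ≡.refl k) ⟩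
      q * q ^ (2 ℕ.* k ℕ.* 3)      ≈⟨ *-congˡ (^-assocʳ q (2 ℕ.* k) 3) ⟨
      q * (q ^ (2 ℕ.* k)) ^ 3      ≈⟨ *-congˡ (^-congˡ 3 (x-power k)) ⟩
      q * x k ^ 3                  ∎
      where open SetoidReasoning setoid

    q^k² : ∀ k → q ^ (suc k ℕ.^ 2) ≈ q ^ (k ℕ.^ 2) * (q * x k)
    q^k² k = begin
      q ^ (suc k ℕ.^ 2)                    ≡⟨ ≡.cong (q ^_) (ℕ-solve 1 (λ k →
                                                (con′ 1 :+′ k) :*′ ((con′ 1 :+′ k) :*′ con′ 1)
                                                :=′ k :*′ (k :*′ con′ 1) :+′ (con′ 1 :+′ con′ 2 :*′ k)) ≡.refl k) ⟩
      q ^ (k ℕ.^ 2 ℕ.+ suc (2 ℕ.* k))      ≈⟨ ^-homo-* q (k ℕ.^ 2) (suc (2 ℕ.* k)) ⟩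
      q ^ (k ℕ.^ 2) * (q * q ^ (2 ℕ.* k))  ≈⟨ *-congˡ (*-congˡ (x-power k)) ⟩
      q ^ (k ℕ.^ 2) * (q * x k)            ∎
      where open SetoidReasoning setoid

    c-value : ∀ k → c k ≈ proj₁ q-unit * q ^ (k ℕ.^ 2) * poch-odd k ^ 3 * prod L k ^ 3
    c-value zero    = solve 1 (λ u → u := u :* :1 :* :1 :^ 3 :* :1 :^ 3) refl (proj₁ q-unit)
    c-value (suc k) = trans (*-congʳ (c-value k)) (trans
      (solve 7 (λ u s p l q x m →
         u :* s :* p :^ 3 :* l :^ 3 :* (q :* x :* (:1 :- q :* x) :^ 3 :* m :^ 3)
         := u :* (s :* (q :* x)) :* (p :* (:1 :- q :* x)) :^ 3 :* (l :* m) :^ 3)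
        refl (proj₁ q-unit) (q ^ (k ℕ.^ 2)) (poch-odd k) (prod L k) q (x k) (L k))
      (*-congʳ (*-congʳ (*-congˡ (sym (q^k² k))))))

    -- `N 0# k` is (-1)^k q^(2k²). Joined with q^(k²), each step contributes -q^(4k+2) · q^(2k+1) =
    -- -(q^(2k+1))³, the negated cube of the factor by which q^(k²) grows.
    N₀-value : ∀ k → N 0# k * q ^ (k ℕ.^ 2) ≈ (- 1#) ^ k * q ^ (3 ℕ.* k ℕ.^ 2)
    N₀-value zero    = refl
    N₀-value (suc k) = begin
      N 0# k * (0# - q ^ 2 * (q ^ 4) ^ k) * q ^ (suc k ℕ.^ 2)
        ≈⟨ *-cong (*-congˡ (+-congˡ (-‿cong (*-congˡ ([q⁴]^ k))))) (q^k² k) ⟩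
      N 0# k * (0# - q ^ 2 * x k ^ 2) * (q ^ (k ℕ.^ 2) * (q * x k))
        ≈⟨ solve 4 (λ n q x s → n :* (con (+ 0) :- q :^ 2 :* x :^ 2) :* (s :* (q :* x)) := n :* s :* :- (q :* x) :^ 3)
             refl (N 0# k) q (x k) (q ^ (k ℕ.^ 2)) ⟩
      N 0# k * q ^ (k ℕ.^ 2) * - (q * x k) ^ 3
        ≈⟨ *-congʳ (N₀-value k) ⟩
      (- 1#) ^ k * q ^ (3 ℕ.* k ℕ.^ 2) * - (q * x k) ^ 3
        ≈⟨ *-congʳ (*-congˡ (cube (k ℕ.^ 2))) ⟩
      (- 1#) ^ k * (q ^ (k ℕ.^ 2)) ^ 3 * - (q * x k) ^ 3
        ≈⟨ solve 3 (λ m s y → m :* s :^ 3 :* :- y :^ 3 := :- :1 :* m :* (s :* y) :^ 3)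
             refl ((- 1#) ^ k) (q ^ (k ℕ.^ 2)) (q * x k) ⟩
      (- 1#) ^ suc k * (q ^ (k ℕ.^ 2) * (q * x k)) ^ 3
        ≈⟨ *-congˡ (^-congˡ 3 (q^k² k)) ⟨
      (- 1#) ^ suc k * (q ^ (suc k ℕ.^ 2)) ^ 3
        ≈⟨ *-congˡ (cube (suc k ℕ.^ 2)) ⟨
      (- 1#) ^ suc k * q ^ (3 ℕ.* suc k ℕ.^ 2) ∎
      where
      open SetoidReasoning setoid
      cube : ∀ m → q ^ (3 ℕ.* m) ≈ (q ^ m) ^ 3
      cube m = trans (reflexive (≡.cong (q ^_) (ℕ.*-comm 3 m))) (sym (^-assocʳ q m 3))

    -- At e = 1 the inverses `W₁` belong to the factors of (q;q²)_k and cancel one of its three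
    -- powers, while `N 1#` is `poch 2` by definition.
    t₁-value : ∀ k → t 1# W₁ k ≈
      q ^ (k ℕ.^ 2) * [ 6 ℕ.* k ℕ.+ 1 ] * (poch-odd k ^ 2 * poch 2 k) * prod L k ^ 3
    t₁-value k = begin
      (1# - q * x k ^ 3) * c k * N 1# k * prod W₁ k
        ≈⟨ *-congʳ (*-congʳ (*-cong (+-congˡ (-‿cong (sym (q^6k+1 k)))) (c-value k))) ⟩
      (1# - q ^ (6 ℕ.* k ℕ.+ 1)) * (u * q ^ (k ℕ.^ 2) * poch-odd k ^ 3 * prod L k ^ 3) * poch 2 k * prod W₁ k
        ≈⟨ solve 7 (λ a u s o l p w → a :* (u :* s :* o :^ 3 :* l) :* p :* w
             := s :* (a :* u) :* (o :^ 2 :* p) :* l :* (o :* w))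
             refl (1# - q ^ (6 ℕ.* k ℕ.+ 1)) u (q ^ (k ℕ.^ 2)) (poch-odd k) (prod L k ^ 3) (poch 2 k) (prod W₁ k) ⟩
      q ^ (k ℕ.^ 2) * ((1# - q ^ (6 ℕ.* k ℕ.+ 1)) * u) * (poch-odd k ^ 2 * poch 2 k) * prod L k ^ 3 * (poch-odd k * prod W₁ k)
        ≈⟨ *-cong (*-congʳ (*-congʳ (*-congˡ (sym (q-number (6 ℕ.* k ℕ.+ 1))))))
             (prod-units (λ j → trans (*-congʳ (+-congˡ (-‿cong (sym (*-identityˡ _))))) (I₁.W-inverse 0 j)) k) ⟩
      q ^ (k ℕ.^ 2) * [ 6 ℕ.* k ℕ.+ 1 ] * (poch-odd k ^ 2 * poch 2 k) * prod L k ^ 3 * 1#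
        ≈⟨ *-identityʳ _ ⟩
      q ^ (k ℕ.^ 2) * [ 6 ℕ.* k ℕ.+ 1 ] * (poch-odd k ^ 2 * poch 2 k) * prod L k ^ 3 ∎
      where
      open SetoidReasoning setoid
      u = proj₁ q-unit

    t₀-value : ∀ k → t 0# (λ _ → 1#) k ≈
      (- 1#) ^ k * q ^ (3 ℕ.* k ℕ.^ 2) * [ 6 ℕ.* k ℕ.+ 1 ] * poch-odd k ^ 3 * prod L k ^ 3
    t₀-value k = begin
      (1# - q * x k ^ 3) * c k * N 0# k * prod (λ _ → 1#) k
        ≈⟨ *-cong (*-congʳ (*-cong (+-congˡ (-‿cong (sym (q^6k+1 k)))) (c-value k))) (prod-1 k) ⟩
      (1# - q ^ (6 ℕ.* k ℕ.+ 1)) * (u * q ^ (k ℕ.^ 2) * poch-odd k ^ 3 * prod L k ^ 3) * N 0# k * 1#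
        ≈⟨ solve 6 (λ a u s o l n → a :* (u :* s :* o :* l) :* n :* :1
             := n :* s :* (a :* u) :* o :* l)
             refl (1# - q ^ (6 ℕ.* k ℕ.+ 1)) u (q ^ (k ℕ.^ 2)) (poch-odd k ^ 3) (prod L k ^ 3) (N 0# k) ⟩
      N 0# k * q ^ (k ℕ.^ 2) * ((1# - q ^ (6 ℕ.* k ℕ.+ 1)) * u) * poch-odd k ^ 3 * prod L k ^ 3
        ≈⟨ *-congʳ (*-congʳ (*-cong (N₀-value k) (sym (q-number (6 ℕ.* k ℕ.+ 1))))) ⟩
      (- 1#) ^ k * q ^ (3 ℕ.* k ℕ.^ 2) * [ 6 ℕ.* k ℕ.+ 1 ] * poch-odd k ^ 3 * prod L k ^ 3 ∎
      where
      open SetoidReasoning setoid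
      u = proj₁ q-unit

    poch-unit : ∀ k → poch 4 k ^ 3 * prod L k ^ 3 ≈ 1#
    poch-unit k = trans (solve 2 (λ p l → p :^ 3 :* l :^ 3 := (p :* l) :^ 3) refl (poch 4 k) (prod L k))
      (trans (^-congˡ 3 (prod-units (λ j → proj₁ (proj₂ (q⁴-unit j))) k)) (solve 0 (:1 :^ 3 := :1) refl))

    P₄²-unit : P₄ ^ 2 * P₄⁻¹ ^ 2 ≈ 1#
    P₄²-unit = trans (solve 2 (λ p l → p :^ 2 :* l :^ 2 := (p :* l) :^ 2) refl P₄ P₄⁻¹)
      (trans (^-congˡ 2 (proj₂ P₄-unit)) (solve 0 (:1 :^ 2 := :1) refl))

    -- The operations of the statement are parameters, related to those of R one
    -- at a time, so that compound expressions over ℂ are never compared by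
    -- unfolding their Cauchy moduli.
    module Realisation
      (1′ : Carrier) (1′≈1 : 1′ ≈ 1#)
      (_+′_ : Carrier → Carrier → Carrier) (+′≈+ : ∀ z w → z +′ w ≈ z + w)
      (_*′_ : Carrier → Carrier → Carrier) (*′≈* : ∀ z w → z *′ w ≈ z * w)
      (neg : Carrier → Carrier) (neg≈- : ∀ z → neg z ≈ - z)
      (_-′_ : Carrier → Carrier → Carrier) (-′≈- : ∀ z w → z -′ w ≈ z - w)
      (_^′_ : Carrier → ℕ → Carrier) (^′≈^ : ∀ z n → z ^′ n ≈ z ^ n)
      (Σ′ : (ℕ → Carrier) → ℕ → Carrier) (Σ′-zero : ∀ f → Σ′ f 0 ≈ 0#) (Σ′-suc : ∀ f n → Σ′ f (suc n) ≈ Σ′ f n + f n)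
      (⦅_⨾_⦆ : Carrier → Carrier → ℕ → Carrier) (⦅⦆-zero : ∀ a b → ⦅ a ⨾ b ⦆ 0 ≈ 1#)
      (⦅⦆-suc : ∀ a b n → ⦅ a ⨾ b ⦆ (suc n) ≈ ⦅ a ⨾ b ⦆ n *′ (1′ -′ (a *′ (b ^′ n))))
      ([_]⟨_⟩ : ℕ → Carrier → Carrier) ([]-sum : ∀ n z → [ n ]⟨ z ⟩ ≈ Σ′ (z ^′_) n)
      (_#0 : Carrier → Set) (unit⇒#0 : ∀ z w → z * w ≈ 1# → z #0)
      (_/_⟨_⟩ : ∀ z w → w #0 → Carrier) (/-unit : ∀ z w v (d : w #0) → w * v ≈ 1# → (z / w ⟨ d ⟩) ≈ z * v)
      (_⟶_ : (ℕ → Carrier) → Carrier → Set) (⇢⇒⟶ : ∀ u l → u ⇢ l → u ⟶ l)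
      where

      private
        infixl 7 _⊛_
        _⊛_ : ∀ {z z′ w w′} → z ≈ z′ → w ≈ w′ → z *′ w ≈ z′ * w′
        _⊛_ {z} {z′} {w} {w′} z≈ w≈ = trans (*′≈* z w) (*-cong z≈ w≈)

        Σ′-sum : ∀ {f h} → (∀ n → f n ≈ h n) → ∀ n → Σ′ f n ≈ sum h n
        Σ′-sum {f} f≈h zero    = Σ′-zero f
        Σ′-sum {f} f≈h (suc n) = trans (Σ′-suc f n) (+-cong (Σ′-sum f≈h n) (f≈h n))

        ⦅⦆-prod : ∀ {a a′ b b′} → a ≈ a′ → b ≈ b′ → ∀ n → ⦅ a ⨾ b ⦆ n ≈ prod (λ j → 1# - a′ * b′ ^ j) n
        ⦅⦆-prod {a} {a′} {b} {b′} a≈ b≈ zero    = ⦅⦆-zero a b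
        ⦅⦆-prod {a} {a′} {b} {b′} a≈ b≈ (suc n) = trans (⦅⦆-suc a b n) (⦅⦆-prod a≈ b≈ n ⊛
          trans (-′≈- 1′ (a *′ (b ^′ n))) (+-cong 1′≈1 (-‿cong (a≈ ⊛ trans (^′≈^ b n) (^-congˡ n b≈)))))

        ⦅⦆-poch : ∀ s n → ⦅ q ^′ s ⨾ q ^′ 4 ⦆ n ≈ poch s n
        ⦅⦆-poch s = ⦅⦆-prod (^′≈^ q s) (^′≈^ q 4)

        ⦅⦆-odd : ∀ n → ⦅ q ⨾ q ^′ 2 ⦆ n ≈ poch-odd n
        ⦅⦆-odd = ⦅⦆-prod refl (^′≈^ q 2)

        []-value : ∀ n → [ n ]⟨ q ⟩ ≈ [ n ]
        []-value n = trans ([]-sum n q) (Σ′-sum (^′≈^ q) n)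

        ^′-cong : ∀ {z w} n → z ≈ w → z ^′ n ≈ w ^ n
        ^′-cong {z} n z≈w = trans (^′≈^ z n) (^-congˡ n z≈w)

        denominator : ∀ k → ⦅ q ^′ 4 ⨾ q ^′ 4 ⦆ k ^′ 3 * prod L k ^ 3 ≈ 1#
        denominator k = trans (*-congʳ (^′-cong 3 (⦅⦆-poch 4 k))) (poch-unit k)

        denominator-∞ : P₄ ^′ 2 * P₄⁻¹ ^ 2 ≈ 1#
        denominator-∞ = trans (*-congʳ (^′≈^ P₄ 2)) P₄²-unit

        ⟶-poch : ∀ s {P} → poch s ⇢ P → ⦅ q ^′ s ⨾ q ^′ 4 ⦆ ⟶ P
        ⟶-poch s {P} lim = ⇢⇒⟶ _ P (lim-cong (λ n → sym (⦅⦆-poch s n)) refl lim)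

        ⟶-sum : ∀ {f h l m} → (∀ n → f n ≈ h n) → m ≈ l → sum h ⇢ l → Σ′ f ⟶ m
        ⟶-sum f≈h m≈l lim = ⇢⇒⟶ _ _ (lim-cong (λ n → sym (Σ′-sum f≈h n)) (sym m≈l) lim)

      evaluation :
        Σ[ d ∈ (∀ k → (⦅ q ^′ 4 ⨾ q ^′ 4 ⦆ k ^′ 3) #0) ]
        Σ[ P₂ ∈ Carrier ] Σ[ P₃ ∈ Carrier ] Σ[ P₄ ∈ Carrier ] Σ[ P₅ ∈ Carrier ] Σ[ P₆ ∈ Carrier ]
        Σ[ d∞ ∈ (P₄ ^′ 2) #0 ]
          (⦅ q ^′ 2 ⨾ q ^′ 4 ⦆ ⟶ P₂) × (⦅ q ^′ 3 ⨾ q ^′ 4 ⦆ ⟶ P₃) × (⦅ q ^′ 4 ⨾ q ^′ 4 ⦆ ⟶ P₄) ×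
          (⦅ q ^′ 5 ⨾ q ^′ 4 ⦆ ⟶ P₅) × (⦅ q ^′ 6 ⨾ q ^′ 4 ⦆ ⟶ P₆) ×
          (Σ′ (λ k → (((q ^′ (k ℕ.^ 2)) *′ [ 6 ℕ.* k ℕ.+ 1 ]⟨ q ⟩)
              *′ ((⦅ q ⨾ q ^′ 2 ⦆ k ^′ 2) *′ ⦅ q ^′ 2 ⨾ q ^′ 4 ⦆ k))
                / ⦅ q ^′ 4 ⨾ q ^′ 4 ⦆ k ^′ 3 ⟨ d k ⟩)
            ⟶ ((((1′ +′ q) *′ P₂) *′ P₆) / P₄ ^′ 2 ⟨ d∞ ⟩)) ×
          (Σ′ (λ k → ((((neg 1′ ^′ k) *′ (q ^′ (3 ℕ.* k ℕ.^ 2))) *′ [ 6 ℕ.* k ℕ.+ 1 ]⟨ q ⟩)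
              *′ (⦅ q ⨾ q ^′ 2 ⦆ k ^′ 3))
                / ⦅ q ^′ 4 ⨾ q ^′ 4 ⦆ k ^′ 3 ⟨ d k ⟩)
            ⟶ ((P₃ *′ P₅) / P₄ ^′ 2 ⟨ d∞ ⟩))
      evaluation = (λ k → unit⇒#0 _ _ (denominator k)) , P₂ , P₃ , P₄ , P₅ , P₆ , unit⇒#0 _ _ denominator-∞ ,
        ⟶-poch 2 P₂-lim , ⟶-poch 3 (proj₂ (poch-lim 3)) , ⟶-poch 4 (proj₂ (poch-lim 4)) ,
        ⟶-poch 5 (proj₂ (poch-lim 5)) , ⟶-poch 6 (proj₂ (poch-lim 6)) ,
        ⟶-sum
          (λ k → trans (/-unit _ _ _ _ (denominator k)) (trans
            (*-congʳ (^′≈^ q (k ℕ.^ 2) ⊛ []-value (6 ℕ.* k ℕ.+ 1) ⊛ (^′-cong 2 (⦅⦆-odd k) ⊛ ⦅⦆-poch 2 k)))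
            (sym (t₁-value k))))
          (trans (/-unit _ _ _ _ denominator-∞) (*-congʳ (trans (+′≈+ 1′ q) (+-congʳ 1′≈1) ⊛ refl ⊛ refl))) T₁-lim ,
        ⟶-sum
          (λ k → trans (/-unit _ _ _ _ (denominator k)) (trans
            (*-congʳ (^′-cong k (trans (neg≈- 1′) (-‿cong 1′≈1)) ⊛ ^′≈^ q (3 ℕ.* k ℕ.^ 2) ⊛ []-value (6 ℕ.* k ℕ.+ 1)
              ⊛ ^′-cong 3 (⦅⦆-odd k)))
            (sym (t₀-value k))))
          (trans (/-unit _ _ _ _ denominator-∞) (*-congʳ (*′≈* P₃ P₅))) T₀-lim

-- The complete normed ring of complex numbers

open import Defs

0≤square : ∀ a → 0ℚ ℚ.≤ a ℚ.* a
0≤square a with ℚ.≤-total 0ℚ a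
... | inj₁ 0≤a = 0≤* 0≤a 0≤a
... | inj₂ a≤0 = ≡.subst (0ℚ ℚ.≤_) (square-neg a) (0≤* 0≤-a 0≤-a)
  where 0≤-a = ℚ.neg-antimono-≤ a≤0

square-cancel-≤ : ∀ {p s} → 0ℚ ℚ.≤ s → p ℚ.* p ℚ.≤ s ℚ.* s → p ℚ.≤ s
square-cancel-≤ {p} {s} 0≤s pp≤ss with p ℚ.≤? s
... | yes p≤s = p≤s
... | no  p≰s = contradiction (ℚ.<-≤-trans ss<pp pp≤ss) (ℚ.<-irrefl ≡.refl)
  where
  open ℚ.≤-Reasoning
  s<p = ℚ.≰⇒> p≰s
  0<p = ℚ.≤-<-trans 0≤s s<p
  ss<pp : s ℚ.* s ℚ.< p ℚ.* p
  ss<pp = begin-strict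
    s ℚ.* s  ≤⟨ *-mono 0≤s (ℚ.<⇒≤ 0<p) ℚ.≤-refl (ℚ.<⇒≤ s<p) ⟩
    s ℚ.* p  <⟨ ℚ.*-monoˡ-<-pos p {{ℚ.positive 0<p}} s<p ⟩
    p ℚ.* p  ∎

∣a∣²≡a² : ∀ a → ∣ a ∣ ℚ.* ∣ a ∣ ≡ a ℚ.* a
∣a∣²≡a² a = ≡.trans (≡.sym (ℚ.∣p*q∣≡∣p∣*∣q∣ a a)) (ℚ.0≤p⇒∣p∣≡p (0≤square a))

p≤∣p∣ : ∀ p → p ℚ.≤ ∣ p ∣
p≤∣p∣ p with ℚ.≤-total 0ℚ p
... | inj₁ 0≤p = ℚ.≤-reflexive (≡.sym (ℚ.0≤p⇒∣p∣≡p 0≤p))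
... | inj₂ p≤0 = ℚ.≤-trans p≤0 (ℚ.0≤∣p∣ p)

-- The certificate `minkowski` reduces the triangle inequality to the Cauchy-Schwarz bound `cross`,
-- which Lagrange's identity gives in squared form.
minkowski-≤ : ∀ {a b c d r s} → 0ℚ ℚ.≤ r → 0ℚ ℚ.≤ s →
  a ℚ.* a ℚ.+ b ℚ.* b ℚ.≤ r ℚ.* r → c ℚ.* c ℚ.+ d ℚ.* d ℚ.≤ s ℚ.* s →
  (a ℚ.+ c) ℚ.* (a ℚ.+ c) ℚ.+ (b ℚ.+ d) ℚ.* (b ℚ.+ d) ℚ.≤ (r ℚ.+ s) ℚ.* (r ℚ.+ s)
minkowski-≤ {a} {b} {c} {d} {r} {s} 0≤r 0≤s ab≤r cd≤s =
  ≤-by _ (0≤+ (0≤+ (0≤-difference ab≤r) (0≤-difference cd≤s)) (0≤+ (0≤-difference cross) (0≤-difference cross)))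
    (minkowski a b c d r s)
  where
  cross : a ℚ.* c ℚ.+ b ℚ.* d ℚ.≤ r ℚ.* s
  cross = square-cancel-≤ (0≤* 0≤r 0≤s) (ℚ.≤-trans
    (≤-by _ (0≤square (a ℚ.* d ℚ.- b ℚ.* c)) (lagrange a b c d))
    (ℚ.≤-trans (*-mono (0≤+ (0≤square a) (0≤square b)) (0≤square s) ab≤r cd≤s)
      (ℚ.≤-reflexive (square-* r s))))

-- Equality of complex numbers is taken to be eventual equality of the
-- approximating sequences.  It is finer than _≈_, but every algebraic
-- identity used here holds in this sense, and all operations, including
-- bounds by rationals, respect it on the nose.
infix 4 _≐_

record _≐_ (z w : ℂ) : Set where
  constructor eventually
  field
    from   : ℕ
    agrees : ∀ {n} → from ℕ.≤ n → seq (re z) n ≡ seq (re w) n × seq (im z) n ≡ seq (im w) n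

pointwise : ∀ {z w} → (∀ n → seq (re z) n ≡ seq (re w) n) → (∀ n → seq (im z) n ≡ seq (im w) n) → z ≐ w
pointwise p q = eventually 0 λ {n} _ → p n , q n

≐-refl : ∀ {z} → z ≐ z
≐-refl = pointwise (λ _ → ≡.refl) (λ _ → ≡.refl)

≐-sym : ∀ {z w} → z ≐ w → w ≐ z
≐-sym (eventually M p) = eventually M λ le → ≡.sym (proj₁ (p le)) , ≡.sym (proj₂ (p le))

≐-trans : ∀ {z w v} → z ≐ w → w ≐ v → z ≐ v
≐-trans (eventually M p) (eventually N q) = eventually (M ℕ.⊔ N) λ le →
  let p₁ , p₂ = p (ℕ.m⊔n≤o⇒m≤o M N le)
      q₁ , q₂ = q (ℕ.m⊔n≤o⇒n≤o M N le)
  in ≡.trans p₁ q₁ , ≡.trans p₂ q₂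

+-≐ : ∀ {z z′ w w′} → z ≐ z′ → w ≐ w′ → z + w ≐ z′ + w′
+-≐ (eventually M p) (eventually N q) = eventually (M ℕ.⊔ N) λ le →
  let p₁ , p₂ = p (ℕ.m⊔n≤o⇒m≤o M N le)
      q₁ , q₂ = q (ℕ.m⊔n≤o⇒n≤o M N le)
  in ≡.cong₂ ℚ._+_ p₁ q₁ , ≡.cong₂ ℚ._+_ p₂ q₂

*-≐ : ∀ {z z′ w w′} → z ≐ z′ → w ≐ w′ → z * w ≐ z′ * w′
*-≐ (eventually M p) (eventually N q) = eventually (M ℕ.⊔ N) λ le →
  let p₁ , p₂ = p (ℕ.m⊔n≤o⇒m≤o M N le)
      q₁ , q₂ = q (ℕ.m⊔n≤o⇒n≤o M N le)
  in ≡.cong₂ (λ a b → a ℚ.+ ℚ.- b) (≡.cong₂ ℚ._*_ p₁ q₁) (≡.cong₂ ℚ._*_ p₂ q₂)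
   , ≡.cong₂ ℚ._+_ (≡.cong₂ ℚ._*_ p₁ q₂) (≡.cong₂ ℚ._*_ p₂ q₁)

neg-≐ : ∀ {z w} → z ≐ w → - z ≐ - w
neg-≐ (eventually M p) = eventually M λ le → ≡.cong ℚ.-_ (proj₁ (p le)) , ≡.cong ℚ.-_ (proj₂ (p le))

module ℂ-Laws where

  +-assoc : ∀ z w v → (z + w) + v ≐ z + (w + v)
  +-assoc z w v = pointwise
    (λ n → ℚ.+-assoc (seq (re z) n) (seq (re w) n) (seq (re v) n))
    (λ n → ℚ.+-assoc (seq (im z) n) (seq (im w) n) (seq (im v) n))

  +-comm : ∀ z w → z + w ≐ w + z
  +-comm z w = pointwise (λ n → ℚ.+-comm (seq (re z) n) (seq (re w) n)) (λ n → ℚ.+-comm (seq (im z) n) (seq (im w) n))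

  +-identityˡ : ∀ z → 0# + z ≐ z
  +-identityˡ z = pointwise (λ n → ℚ.+-identityˡ (seq (re z) n)) (λ n → ℚ.+-identityˡ (seq (im z) n))

  +-identityʳ : ∀ z → z + 0# ≐ z
  +-identityʳ z = pointwise (λ n → ℚ.+-identityʳ (seq (re z) n)) (λ n → ℚ.+-identityʳ (seq (im z) n))

  -‿inverseˡ : ∀ z → - z + z ≐ 0#
  -‿inverseˡ z = pointwise (λ n → ℚ.+-inverseˡ (seq (re z) n)) (λ n → ℚ.+-inverseˡ (seq (im z) n))

  -‿inverseʳ : ∀ z → z + - z ≐ 0#
  -‿inverseʳ z = pointwise (λ n → ℚ.+-inverseʳ (seq (re z) n)) (λ n → ℚ.+-inverseʳ (seq (im z) n))

  *-assoc : ∀ z w v → (z * w) * v ≐ z * (w * v)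
  *-assoc z w v = pointwise
    (λ n → *-re-assoc (seq (re z) n) (seq (im z) n) (seq (re w) n) (seq (im w) n) (seq (re v) n) (seq (im v) n))
    (λ n → *-im-assoc (seq (re z) n) (seq (im z) n) (seq (re w) n) (seq (im w) n) (seq (re v) n) (seq (im v) n))

  *-comm : ∀ z w → z * w ≐ w * z
  *-comm z w = pointwise
    (λ n → *-re-comm (seq (re z) n) (seq (im z) n) (seq (re w) n) (seq (im w) n))
    (λ n → *-im-comm (seq (re z) n) (seq (im z) n) (seq (re w) n) (seq (im w) n))

  *-identityˡ : ∀ z → 1# * z ≐ z
  *-identityˡ z = pointwise
    (λ n → *-re-identity (seq (re z) n) (seq (im z) n)) (λ n → *-im-identity (seq (re z) n) (seq (im z) n))

  *-identityʳ : ∀ z → z * 1# ≐ z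
  *-identityʳ z = ≐-trans {z * 1#} {1# * z} {z} (*-comm z 1#) (*-identityˡ z)

  distribˡ : ∀ z w v → z * (w + v) ≐ z * w + z * v
  distribˡ z w v = pointwise
    (λ n → *-re-distrib (seq (re z) n) (seq (im z) n) (seq (re w) n) (seq (im w) n) (seq (re v) n) (seq (im v) n))
    (λ n → *-im-distrib (seq (re z) n) (seq (im z) n) (seq (re w) n) (seq (im w) n) (seq (re v) n) (seq (im v) n))

  distribʳ : ∀ z w v → (w + v) * z ≐ w * z + v * z
  distribʳ z w v = ≐-trans {(w + v) * z} {z * (w + v)} {w * z + v * z} (*-comm (w + v) z)
    (≐-trans {z * (w + v)} {z * w + z * v} {w * z + v * z} (distribˡ z w v)
      (+-≐ {z * w} {w * z} {z * v} {v * z} (*-comm z w) (*-comm z v)))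

ℂ-isCommutativeRing : IsCommutativeRing _≐_ _+_ _*_ -_ 0# 1#
ℂ-isCommutativeRing = record
  { isRing = record
    { +-isAbelianGroup = record
      { isGroup = record
        { isMonoid = record
          { isSemigroup = record
            { isMagma = record
              { isEquivalence = record { refl = ≐-refl ; sym = ≐-sym ; trans = ≐-trans }
              ; ∙-cong = +-≐
              }
            ; assoc = ℂ-Laws.+-assoc
            }
          ; identity = ℂ-Laws.+-identityˡ , ℂ-Laws.+-identityʳ
          }
        ; inverse = ℂ-Laws.-‿inverseˡ , ℂ-Laws.-‿inverseʳ
        ; ⁻¹-cong = neg-≐
        }
      ; comm = ℂ-Laws.+-comm
      }
    ; *-cong = *-≐
    ; *-assoc = ℂ-Laws.*-assoc
    ; *-identity = ℂ-Laws.*-identityˡ , ℂ-Laws.*-identityʳ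
    ; distrib = ℂ-Laws.distribˡ , ℂ-Laws.distribʳ
    }
  ; *-comm = ℂ-Laws.*-comm
  }

-- Completeness of the reals

module ℝ-Completeness where

  Close : ℝ → ℝ → ℚ → Set
  Close x y ε = ∃ λ N → ∀ {n} → N ℕ.≤ n → ∣ seq x n ℚ.- seq y n ∣ ℚ.≤ ε

  close-sym : ∀ x y {ε} → Close x y ε → Close y x ε
  close-sym x y (N , close) = N , λ {n} p → ≡.subst (ℚ._≤ _)
    (≡.trans (≡.sym (ℚ.∣-p∣≡∣p∣ (seq x n ℚ.- seq y n))) (≡.cong ∣_∣ (flip-difference (seq x n) (seq y n))))
    (close p)

  close-trans : ∀ x y z {ε δ} → Close x y ε → Close y z δ → Close x z (ε ℚ.+ δ)
  close-trans x y z (M , xy) (N , yz) = M ℕ.⊔ N , λ {n} p → ℚ.≤-trans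
    (ℚ.≤-trans (ℚ.≤-reflexive (≡.cong ∣_∣ (≡.sym (cancel-middle (seq x n) (seq y n) (seq z n)))))
      (ℚ.∣p+q∣≤∣p∣+∣q∣ (seq x n ℚ.- seq y n) (seq y n ℚ.- seq z n)))
    (ℚ.+-mono-≤ (xy (ℕ.m⊔n≤o⇒m≤o M N p)) (yz (ℕ.m⊔n≤o⇒n≤o M N p)))

  close-mono : ∀ x y {ε δ} → ε ℚ.≤ δ → Close x y ε → Close x y δ
  close-mono x y ε≤δ (N , close) = N , λ p → ℚ.≤-trans (close p) ε≤δ

  modulus : ∀ x {ε} → 0ℚ ℚ.< ε → ∃ λ N → ∀ {n} → N ℕ.≤ n → Close x (fromℚ (seq x n)) ε
  modulus x 0<ε = let N , close = cauchy x _ 0<ε in N , λ n≥N → N , λ m≥N → ℚ.<⇒≤ (close m≥N n≥N)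

  module Limit (u : ℕ → ℝ)
    (u-cauchy : ∀ ε → 0ℚ ℚ.< ε → ∃ λ N → ∀ n → Close (u (N ℕ.+ n)) (u N) ε) where

    private
      η : ℕ → ℚ
      η k = ½ ^ℚ k

      0<η : ∀ k → 0ℚ ℚ.< η k
      0<η zero    = 0<1
      0<η (suc k) = *-pos 0<½ (0<η k)

      N : ℕ → ℕ
      N k = proj₁ (u-cauchy (η k) (0<η k))

      x : ℕ → ℝ
      x k = u (N k)

      near-x : ∀ k {m} → N k ℕ.≤ m → Close (u m) (x k) (η k)
      near-x k {m} p = ≡.subst (λ m → Close (u m) (x k) (η k)) (ℕ.m+[n∸m]≡n p)
        (proj₂ (u-cauchy (η k) (0<η k)) (m ℕ.∸ N k))

      x-close : ∀ k l → Close (x k) (x l) (η k ℚ.+ η l)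
      x-close k l = close-trans (x k) (u (N k ℕ.⊔ N l)) (x l)
        (close-sym (u (N k ℕ.⊔ N l)) (x k) (near-x k (ℕ.m≤m⊔n (N k) (N l))))
        (near-x l (ℕ.m≤n⊔m (N k) (N l)))

      -- A diagonal choice: a rational within 2^(-k) of `x k`, which in turn is within 2^(-k) of all
      -- later terms of u.
      s : ℕ → ℚ
      s k = seq (x k) (proj₁ (modulus (x k) (0<η k)))

      s-close : ∀ k → Close (x k) (fromℚ (s k)) (η k)
      s-close k = proj₂ (modulus (x k) (0<η k)) ℕ.≤-refl

      5ℚ : ℚ
      5ℚ = fromℕ 5

      -- The chain in `limit-close`, from a rational approximation of `u n` over `u n`, `x K` and
      -- `x j` to `s j`, costs five δ, two of them between `x K` and `x j`. In `s-cauchy` four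
      -- suffice, and the fifth makes the inequality strict.
      fifth : ∀ {ε} → 0ℚ ℚ.< ε → ∃ λ δ → 0ℚ ℚ.< δ × 5ℚ ℚ.* δ ≡ ε
      fifth 0<ε = divide (ℚ.positive⁻¹ 5ℚ) 0<ε

      small-η : ∀ {δ} → 0ℚ ℚ.< δ → ∃ λ K → ∀ {k} → K ℕ.≤ k → η k ℚ.≤ δ
      small-η 0<δ = pow-small (ℚ.<⇒≤ 0<½) (ℚ.*<* (ℤ.+<+ (s≤s (s≤s z≤n)))) 0<δ

      extract : ∀ p q {δ} → Close (fromℚ p) (fromℚ q) δ → ∣ p ℚ.- q ∣ ℚ.≤ δ
      extract p q (N , close) = close ℕ.≤-refl

      s-cauchy : Cauchy s
      s-cauchy ε 0<ε =
        let δ , 0<δ , eq = fifth 0<ε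
            K , small    = small-η 0<δ
        in K , λ {k} {l} k≥K l≥K → ℚ.≤-<-trans
             (extract (s k) (s l)
               (close-trans (fromℚ (s k)) (x l) (fromℚ (s l))
                 (close-trans (fromℚ (s k)) (x k) (x l)
                   (close-mono (fromℚ (s k)) (x k) (small k≥K) (close-sym (x k) (fromℚ (s k)) (s-close k)))
                   (close-mono (x k) (x l) (ℚ.+-mono-≤ (small k≥K) (small l≥K)) (x-close k l)))
                 (close-mono (x l) (fromℚ (s l)) (small l≥K) (s-close l))))
             (ℚ.<-≤-trans (four<five δ 0<δ) (ℚ.≤-reflexive eq))
        where
        four<five : ∀ δ → 0ℚ ℚ.< δ → δ ℚ.+ (δ ℚ.+ δ) ℚ.+ δ ℚ.< 5ℚ ℚ.* δ
        four<five δ 0<δ = begin-strict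
          δ ℚ.+ (δ ℚ.+ δ) ℚ.+ δ           ≡⟨ ℚ.+-identityʳ (δ ℚ.+ (δ ℚ.+ δ) ℚ.+ δ) ⟨
          δ ℚ.+ (δ ℚ.+ δ) ℚ.+ δ ℚ.+ 0ℚ    <⟨ ℚ.+-monoʳ-< (δ ℚ.+ (δ ℚ.+ δ) ℚ.+ δ) 0<δ ⟩
          δ ℚ.+ (δ ℚ.+ δ) ℚ.+ δ ℚ.+ δ     ≡⟨ five δ ⟩
          5ℚ ℚ.* δ                        ∎
          where open ℚ.≤-Reasoning

    limit : ℝ
    limit = mkℝ s s-cauchy

    limit-close : ∀ ε → 0ℚ ℚ.< ε → ∃ λ M → ∀ {n} → M ℕ.≤ n → Close (u n) limit ε
    limit-close ε 0<ε =
      let δ , 0<δ , eq = fifth 0<ε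
          K , small    = small-η 0<δ
      in N K , λ {n} n≥N →
        let I , u-modulus = modulus (u n) 0<δ
        in I ℕ.⊔ K , λ {j} p →
          let j≥K = ℕ.m⊔n≤o⇒n≤o I K p
              a   = fromℚ (seq (u n) j)
          in ℚ.≤-trans
            (extract (seq (u n) j) (s j)
              (close-trans a (x j) (fromℚ (s j))
                (close-trans a (x K) (x j)
                  (close-trans a (u n) (x K)
                    (close-sym (u n) a (u-modulus (ℕ.m⊔n≤o⇒m≤o I K p)))
                    (close-mono (u n) (x K) (small ℕ.≤-refl) (near-x K n≥N)))
                  (close-mono (x K) (x j) (ℚ.+-mono-≤ (small ℕ.≤-refl) (small j≥K)) (x-close K j)))
                (close-mono (x j) (fromℚ (s j)) (small j≥K) (s-close j))))
            (ℚ.≤-reflexive (≡.trans (five′ δ) eq))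

-- The norm on the complex numbers

infix 4 ∥_∥≤_

-- Comparing squares avoids the square root in |z|; `nonneg` makes the comparison of squares mean
-- |z| ≤ a.
record ∥_∥≤_ (z : ℂ) (a : ℚ) : Set where
  constructor bounded
  field
    nonneg : 0ℚ ℚ.≤ a
    from   : ℕ
    bound  : ∀ {n} → from ℕ.≤ n → seq ∣ z ∣² n ℚ.≤ a ℚ.* a

open ℝ-Completeness using (Close)

∣a∣≤r : ∀ {a r} → 0ℚ ℚ.≤ r → a ℚ.* a ℚ.≤ r ℚ.* r → ∣ a ∣ ℚ.≤ r
∣a∣≤r {a} {r} 0≤r aa≤rr = square-cancel-≤ 0≤r (≡.subst (ℚ._≤ r ℚ.* r) (≡.sym (∣a∣²≡a² a)) aa≤rr)

a²≤r² : ∀ {a r} → ∣ a ∣ ℚ.≤ r → a ℚ.* a ℚ.≤ r ℚ.* r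
a²≤r² {a} {r} a≤r = ≡.subst (ℚ._≤ r ℚ.* r) (∣a∣²≡a² a)
  (*-mono (ℚ.0≤∣p∣ a) (ℚ.≤-trans (ℚ.0≤∣p∣ a) a≤r) a≤r a≤r)

p≤p+q : ∀ {p q} → 0ℚ ℚ.≤ q → p ℚ.≤ p ℚ.+ q
p≤p+q {p} {q} 0≤q = ≤-by q 0≤q ≡.refl

p≤q+p : ∀ {p q} → 0ℚ ℚ.≤ q → p ℚ.≤ q ℚ.+ p
p≤q+p {p} {q} 0≤q = ≤-by q 0≤q (ℚ.+-comm q p)

components : ∀ {z w a b} → 0ℚ ℚ.≤ a → 0ℚ ℚ.≤ b → Close (re z) (re w) a → Close (im z) (im w) b → ∥ z + - w ∥≤ a ℚ.+ b
components {z} {w} {a} {b} 0≤a 0≤b (M , re≤) (N , im≤) = bounded (0≤+ 0≤a 0≤b) (M ℕ.⊔ N) λ {n} p → ℚ.≤-trans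
  (ℚ.+-mono-≤ (a²≤r² {seq (re z) n ℚ.- seq (re w) n} (re≤ (ℕ.m⊔n≤o⇒m≤o M N p)))
              (a²≤r² {seq (im z) n ℚ.- seq (im w) n} (im≤ (ℕ.m⊔n≤o⇒n≤o M N p))))
  (≤-by (a ℚ.* b ℚ.+ a ℚ.* b) (0≤+ (0≤* 0≤a 0≤b) (0≤* 0≤a 0≤b)) (square-+ a b))

re-close : ∀ {z w a} → ∥ z + - w ∥≤ a → Close (re z) (re w) a
re-close {z} {w} {a} (bounded 0≤a N bound) = N , λ {n} p → ∣a∣≤r {seq (re z) n ℚ.- seq (re w) n} 0≤a
  (ℚ.≤-trans (p≤p+q (0≤square (seq (im (z + - w)) n))) (bound p))

im-close : ∀ {z w a} → ∥ z + - w ∥≤ a → Close (im z) (im w) a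
im-close {z} {w} {a} (bounded 0≤a N bound) = N , λ {n} p → ∣a∣≤r {seq (im z) n ℚ.- seq (im w) n} 0≤a
  (ℚ.≤-trans (p≤q+p (0≤square (seq (re (z + - w)) n))) (bound p))

∥∥-resp : ∀ {z w a} → z ≐ w → ∥ z ∥≤ a → ∥ w ∥≤ a
∥∥-resp {z} {w} {a} (eventually M eq) (bounded 0≤a N bound) = bounded 0≤a (M ℕ.⊔ N) λ {n} p →
  let eq₁ , eq₂ = eq (ℕ.m⊔n≤o⇒m≤o M N p)
  in ≡.subst (ℚ._≤ a ℚ.* a) (≡.cong₂ (λ x y → x ℚ.* x ℚ.+ y ℚ.* y) eq₁ eq₂) (bound (ℕ.m⊔n≤o⇒n≤o M N p))

∥∥-mono : ∀ {z a b} → a ℚ.≤ b → ∥ z ∥≤ a → ∥ z ∥≤ b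
∥∥-mono a≤b (bounded 0≤a N bound) = bounded (ℚ.≤-trans 0≤a a≤b) N λ p →
  ℚ.≤-trans (bound p) (*-mono 0≤a (ℚ.≤-trans 0≤a a≤b) a≤b a≤b)

∥∥-+ : ∀ {z w a b} → ∥ z ∥≤ a → ∥ w ∥≤ b → ∥ z + w ∥≤ a ℚ.+ b
∥∥-+ {z} {w} {a} {b} (bounded 0≤a M z≤a) (bounded 0≤b N w≤b) = bounded (0≤+ 0≤a 0≤b) (M ℕ.⊔ N) λ {n} p →
  minkowski-≤ {seq (re z) n} {seq (im z) n} {seq (re w) n} {seq (im w) n} {a} {b} 0≤a 0≤b
    (z≤a (ℕ.m⊔n≤o⇒m≤o M N p)) (w≤b (ℕ.m⊔n≤o⇒n≤o M N p))

∥∥-* : ∀ {z w a b} → ∥ z ∥≤ a → ∥ w ∥≤ b → ∥ z * w ∥≤ a ℚ.* b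
∥∥-* {z} {w} {a} {b} (bounded 0≤a M z≤a) (bounded 0≤b N w≤b) = bounded (0≤* 0≤a 0≤b) (M ℕ.⊔ N) λ {n} p →
  ≡.subst₂ ℚ._≤_ (≡.sym (norm-mult (seq (re z) n) (seq (im z) n) (seq (re w) n) (seq (im w) n))) (square-* a b)
    (*-mono (0≤+ (0≤square (seq (re z) n)) (0≤square (seq (im z) n))) (0≤square b)
      (z≤a (ℕ.m⊔n≤o⇒m≤o M N p)) (w≤b (ℕ.m⊔n≤o⇒n≤o M N p)))

∥∥-neg : ∀ {z a} → ∥ z ∥≤ a → ∥ - z ∥≤ a
∥∥-neg {z} {a} (bounded 0≤a N bound) = bounded 0≤a N λ {n} p →
  ≡.subst (ℚ._≤ a ℚ.* a)
    (≡.sym (≡.cong₂ ℚ._+_ (square-neg (seq (re z) n)) (square-neg (seq (im z) n)))) (bound p)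

∥∥-0 : ∥ 0# ∥≤ 0ℚ
∥∥-0 = bounded ℚ.≤-refl 0 λ _ → ℚ.≤-refl

∥∥-1 : ∥ 1# ∥≤ 1ℚ
∥∥-1 = bounded 0≤1 0 λ _ → ℚ.≤-refl

∥∥-finite : ∀ z → ∃ λ a → ∥ z ∥≤ a
∥∥-finite z =
  let A , 0<A , M , re≤ = cauchy-bound (seq (re z)) (cauchy (re z))
      B , 0<B , N , im≤ = cauchy-bound (seq (im z)) (cauchy (im z))
      0≤A = ℚ.<⇒≤ 0<A
      0≤B = ℚ.<⇒≤ 0<B
  in A ℚ.+ B , bounded (0≤+ 0≤A 0≤B) (M ℕ.⊔ N) λ {n} p → ℚ.≤-trans
       (ℚ.+-mono-≤ (a²≤r² {seq (re z) n} (re≤ (ℕ.m⊔n≤o⇒m≤o M N p)))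
                   (a²≤r² {seq (im z) n} (im≤ (ℕ.m⊔n≤o⇒n≤o M N p))))
       (≤-by (A ℚ.* B ℚ.+ A ℚ.* B) (0≤+ (0≤* 0≤A 0≤B) (0≤* 0≤A 0≤B)) (square-+ A B))

∥∥-complete : ∀ (u : ℕ → ℂ) → (∀ ε → 0ℚ ℚ.< ε → ∃ λ N → ∀ n → ∥ u (N ℕ.+ n) + - u N ∥≤ ε) →
  ∃ λ l → ∀ ε → 0ℚ ℚ.< ε → ∃ λ N → ∀ {n} → N ℕ.≤ n → ∥ u n + - l ∥≤ ε
∥∥-complete u u-cauchy = (X.limit +i Y.limit) , λ ε 0<ε →
  let 0<h         = *-pos 0<ε 0<½
      M , re-lim  = X.limit-close (ε ℚ.* ½) 0<h
      N , im-lim  = Y.limit-close (ε ℚ.* ½) 0<h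
  in M ℕ.⊔ N , λ {n} p → ∥∥-mono {u n + - (X.limit +i Y.limit)} (ℚ.≤-reflexive (half+half ε))
       (components {u n} {X.limit +i Y.limit} (ℚ.<⇒≤ 0<h) (ℚ.<⇒≤ 0<h)
         (re-lim (ℕ.m⊔n≤o⇒m≤o M N p)) (im-lim (ℕ.m⊔n≤o⇒n≤o M N p)))
  where
  re-cauchy : ∀ ε → 0ℚ ℚ.< ε → ∃ λ N → ∀ n → Close (re (u (N ℕ.+ n))) (re (u N)) ε
  re-cauchy ε 0<ε = let N , close = u-cauchy ε 0<ε in N , λ n → re-close {u (N ℕ.+ n)} {u N} (close n)
  im-cauchy : ∀ ε → 0ℚ ℚ.< ε → ∃ λ N → ∀ n → Close (im (u (N ℕ.+ n))) (im (u N)) ε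
  im-cauchy ε 0<ε = let N , close = u-cauchy ε 0<ε in N , λ n → im-close {u (N ℕ.+ n)} {u N} (close n)
  module X = ℝ-Completeness.Limit (λ n → re (u n)) re-cauchy
  module Y = ℝ-Completeness.Limit (λ n → im (u n)) im-cauchy

reciprocal : (w : ℂ) → w #0 → ℂ
reciprocal w d = (re w *ᴿ recipᴿ ∣ w ∣² d) +i (-ᴿ im w *ᴿ recipᴿ ∣ w ∣² d)

-- The totalised `recip` inverts only where |w|² is positive, which d guarantees from the index N
-- on.
reciprocal-inverse : ∀ w d → w * reciprocal w d ≐ 1#
reciprocal-inverse w d@(δ , 0<δ , N , gap) = eventually N λ {n} p →
  let a = seq (re w) n
      b = seq (im w) n
      r = recip (seq ∣ w ∣² n)
      0<∣w∣² = ℚ.<-≤-trans 0<δ (≡.subst (ℚ._≤ seq ∣ w ∣² n) (ℚ.+-identityˡ δ) (gap p))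
  in ≡.trans (inverse-re a b r) (recip-inverseˡ 0<∣w∣²) , inverse-im a b r

-- With h = 1 - ρ and A = |1 - z|² one has h² ≤ A. The reciprocal has squared modulus r = 1/A, and
-- κh = 1 gives r = κ²rh² ≤ κ²rA = κ².
∥∥-unit : ∀ {z ρ κ} → ρ ℚ.< 1ℚ → 0ℚ ℚ.≤ κ → κ ℚ.* (1ℚ ℚ.- ρ) ≡ 1ℚ → ∥ z ∥≤ ρ →
  ∃ λ w → (1# + - z) * w ≐ 1# × ∥ w ∥≤ κ
∥∥-unit {z} {ρ} {κ} ρ<1 0≤κ κ-inverse (bounded 0≤ρ N z≤ρ) =
  reciprocal (1# + - z) d , reciprocal-inverse (1# + - z) d , bounded 0≤κ N λ {n} p → norm-bound n p
  where
  h : ℚ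
  h = 1ℚ ℚ.- ρ
  0<h : 0ℚ ℚ.< h
  0<h = ≡.subst (ℚ._< h) (ℚ.+-inverseʳ ρ) (ℚ.+-monoˡ-< (ℚ.- ρ) ρ<1)
  gap : ∀ {n} → N ℕ.≤ n → 0ℚ ℚ.+ h ℚ.* h ℚ.≤ seq ∣ 1# + - z ∣² n
  gap {n} p =
    let a = seq (re z) n
        b = seq (im z) n
        0≤ρ-a = 0≤-difference (ℚ.≤-trans (p≤∣p∣ a) (∣a∣≤r {a} 0≤ρ (ℚ.≤-trans (p≤p+q (0≤square b)) (z≤ρ p))))
    in ≤-by ((ρ ℚ.- a) ℚ.* (ρ ℚ.- a) ℚ.+ ((ρ ℚ.- a) ℚ.* h ℚ.+ (ρ ℚ.- a) ℚ.* h) ℚ.+ b ℚ.* b)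
         (0≤+ (0≤+ (0≤square (ρ ℚ.- a)) (0≤+ (0≤* 0≤ρ-a (ℚ.<⇒≤ 0<h)) (0≤* 0≤ρ-a (ℚ.<⇒≤ 0<h)))) (0≤square b))
         (square-1- a b ρ)
  d : (1# + - z) #0
  d = h ℚ.* h , *-pos 0<h 0<h , N , gap
  norm-bound : ∀ n → N ℕ.≤ n → seq ∣ reciprocal (1# + - z) d ∣² n ℚ.≤ κ ℚ.* κ
  norm-bound n p = begin
    seq ∣ reciprocal (1# + - z) d ∣² n     ≡⟨ inverse-norm a b r ⟩
    r ℚ.* (r ℚ.* A)                      ≡⟨ ≡.cong (r ℚ.*_) rA≡1 ⟩
    r ℚ.* 1ℚ                             ≡⟨ ≡.cong (r ℚ.*_) (≡.cong₂ ℚ._*_ κ-inverse κ-inverse) ⟨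
    r ℚ.* (κ ℚ.* h ℚ.* (κ ℚ.* h))        ≡⟨ spread κ ρ r ⟩
    κ ℚ.* κ ℚ.* (r ℚ.* (h ℚ.* h))        ≤⟨ *-mono (0≤square κ) (0≤* 0≤r (ℚ.<⇒≤ 0<A)) ℚ.≤-refl (*-mono 0≤r (ℚ.<⇒≤ 0<A) ℚ.≤-refl hh≤A) ⟩
    κ ℚ.* κ ℚ.* (r ℚ.* A)                ≡⟨ ≡.cong (κ ℚ.* κ ℚ.*_) rA≡1 ⟩
    κ ℚ.* κ ℚ.* 1ℚ                       ≡⟨ ℚ.*-identityʳ (κ ℚ.* κ) ⟩
    κ ℚ.* κ                              ∎
    where
    open ℚ.≤-Reasoning
    a = seq (re (1# + - z)) n
    b = seq (im (1# + - z)) n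
    A = seq ∣ 1# + - z ∣² n
    r = recip A
    hh≤A : h ℚ.* h ℚ.≤ A
    hh≤A = ≡.subst (ℚ._≤ A) (ℚ.+-identityˡ (h ℚ.* h)) (gap p)
    0<A : 0ℚ ℚ.< A
    0<A = ℚ.<-≤-trans (*-pos 0<h 0<h) hh≤A
    rA≡1 : r ℚ.* A ≡ 1ℚ
    rA≡1 = recip-inverseˡ 0<A
    0≤r : 0ℚ ℚ.≤ r
    -- The sign of r is read off from r = r²A.
    0≤r = ≡.subst (0ℚ ℚ.≤_) (≡.trans (ℚ.*-assoc r r A) (≡.trans (≡.cong (r ℚ.*_) rA≡1) (ℚ.*-identityʳ r)))
      (0≤* (0≤square r) (ℚ.<⇒≤ 0<A))

ℂ-norm : CompleteNorm (record { isCommutativeRing = ℂ-isCommutativeRing })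
ℂ-norm = record
  { ∥_∥≤_       = ∥_∥≤_
  ; norm-nonneg = ∥_∥≤_.nonneg
  ; norm-resp   = ∥∥-resp
  ; norm-mono   = ∥∥-mono
  ; norm-0      = ∥∥-0
  ; norm-1      = ∥∥-1
  ; norm-+      = ∥∥-+
  ; norm-*      = ∥∥-*
  ; norm-neg    = ∥∥-neg
  ; norm-finite = ∥∥-finite
  ; complete    = ∥∥-complete
  ; unit        = ∥∥-unit
  }

-- Transfer to the notions of the statement

open CompleteNorm ℂ-norm using (_⇢_)

≡⇒≐ : ∀ {z w} → z ≡ w → z ≐ w
≡⇒≐ ≡.refl = ≐-refl

⇢⇒⟶ : ∀ {u l} → u ⇢ l → u ⟶ l
⇢⇒⟶ {u} {l} u⇢l ε 0<ε =
  let N , small = u⇢l (ε ℚ.* ½) (*-pos 0<ε 0<½)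
  in N , λ {n} p → near n (small p)
  where
  h = ε ℚ.* ½
  0<h : 0ℚ ℚ.< h
  0<h = *-pos 0<ε 0<½
  room : ε ℚ.* ε ≡ (h ℚ.* h ℚ.+ h ℚ.* h) ℚ.+ (h ℚ.* h ℚ.+ h ℚ.* h)
  room = ≡.trans (≡.cong₂ ℚ._*_ (≡.sym (half+half ε)) (≡.sym (half+half ε))) (square-+ h h)
  0≤hh+hh = 0≤+ (0≤square h) (0≤square h)
  near : ∀ n → ∥ u n + - l ∥≤ h → ∣ u n - l ∣< fromℚ ε
  -- The bound h² together with a gap of h² fits under ε² = 4h², which provides the strict
  -- inequality.
  near n (bounded _ M bound) = h ℚ.* h , *-pos 0<h 0<h , M , λ {m} p → ℚ.≤-trans
    (ℚ.+-monoˡ-≤ (h ℚ.* h) (bound p)) (≤-by (h ℚ.* h ℚ.+ h ℚ.* h) 0≤hh+hh room)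

-- From |z|²|w|² = 1 and |w| ≤ C follows |z|² ≥ 1/C². Taking C = B + 1 keeps the division safe when
-- B is 0.
unit⇒#0 : ∀ {z w} → z * w ≐ 1# → z #0
unit⇒#0 {z} {w} (eventually M eq) =
  let B , bounded 0≤B N w≤B = ∥∥-finite w
      C                     = B ℚ.+ 1ℚ
      0<C                   = ℚ.+-mono-≤-< 0≤B 0<1
      η , 0<η , CCη≡1       = divide (*-pos 0<C 0<C) 0<1
  in η , 0<η , M ℕ.⊔ N , λ {n} p →
     let a  = seq (re z) n
         b  = seq (im z) n
         c  = seq (re w) n
         d  = seq (im w) n
         e₁ , e₂ = eq (ℕ.m⊔n≤o⇒m≤o M N p)
         0≤∣z∣² = 0≤+ (0≤square a) (0≤square b)
         product : (a ℚ.* a ℚ.+ b ℚ.* b) ℚ.* (c ℚ.* c ℚ.+ d ℚ.* d) ≡ 1ℚ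
         product = ≡.trans (≡.sym (norm-mult a b c d)) (≡.cong₂ (λ x y → x ℚ.* x ℚ.+ y ℚ.* y) e₁ e₂)
         w≤C = ℚ.≤-trans (w≤B (ℕ.m⊔n≤o⇒n≤o M N p))
                 (*-mono 0≤B (ℚ.<⇒≤ 0<C) (p≤p+q 0≤1) (p≤p+q 0≤1))
     in lower 0<C CCη≡1 (a ℚ.* a ℚ.+ b ℚ.* b)
          (ℚ.≤-trans (ℚ.≤-reflexive (≡.sym product)) (*-mono 0≤∣z∣² (0≤square C) ℚ.≤-refl w≤C))
  where
  lower : ∀ {C η} → 0ℚ ℚ.< C → C ℚ.* C ℚ.* η ≡ 1ℚ → ∀ A → 1ℚ ℚ.≤ A ℚ.* (C ℚ.* C) → 0ℚ ℚ.+ η ℚ.≤ A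
  lower {C} {η} 0<C eq A 1≤ACC = ≡.subst (ℚ._≤ A) (≡.sym (ℚ.+-identityˡ η))
    (ℚ.*-cancelˡ-≤-pos (C ℚ.* C) {{ℚ.positive (*-pos 0<C 0<C)}}
      (≡.subst₂ ℚ._≤_ (≡.sym eq) (ℚ.*-comm A (C ℚ.* C)) 1≤ACC))

/-reciprocal : ∀ z w (d : w #0) → z / w ⟨ d ⟩ ≐ z * reciprocal w d
/-reciprocal z w d = pointwise {z / w ⟨ d ⟩} {z * reciprocal w d} (λ _ → ≡.refl) (λ _ → ≡.refl)

-- By uniqueness of inverses, a quotient can be computed with whichever inverse is at hand, whatever
-- the proof d.
/-unit : ∀ z w v (d : w #0) → w * v ≐ 1# → z / w ⟨ d ⟩ ≐ z * v
/-unit z w v d w*v≐1 = ≐-trans {z / w ⟨ d ⟩} {z * reciprocal w d} {z * v} (/-reciprocal z w d)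
  (*-≐ {z} {z} {reciprocal w d} {v} ≐-refl
    (FiniteSums.inverse-unique (record { isCommutativeRing = ℂ-isCommutativeRing })
      w (reciprocal w d) v (reciprocal-inverse w d) w*v≐1))

partialSum-cong : ∀ {f h} → (∀ n → f n ≡ h n) → ∀ n → partialSum f n ≐ partialSum h n
partialSum-cong f≡h zero = ≐-refl
partialSum-cong {f} {h} f≡h (suc n) =
  +-≐ {partialSum f n} {partialSum h n} {f n} {h n} (partialSum-cong f≡h n) (≡⇒≐ (f≡h n))

shiftedFactorial-suc : ∀ a b n →
  ⦅ a ⨾ b ⦆ (suc n) ≐ ⦅ a ⨾ b ⦆ n * (1# - a * RawSemiringDefinitions._^_ (RawRing.rawSemiring ℂ-rawRing) b n)
shiftedFactorial-suc a b n = ≐-refl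

q-number-sum : ∀ n z → [ n ]⟨ z ⟩ ≐ partialSum (RawSemiringDefinitions._^_ (RawRing.rawSemiring ℂ-rawRing) z) n
q-number-sum n z = ≐-refl

minus : ∀ z w → z - w ≐ z + - w
minus z w = ≐-refl

-- Defs re-exports _^_, whereas ⦅_⨾_⦆ and [_]⟨_⟩ unfold to the original; taking
-- the power as a parameter reconciles the two.
module Final (pow : ℂ → ℕ → ℂ) (pow≡ : ∀ z n → RawSemiringDefinitions._^_ (RawRing.rawSemiring ℂ-rawRing) z n ≡ pow z n)
  (q : ℂ) (δ : ℚ) (0<δ : 0ℚ ℚ.< δ) (N : ℕ) (gap : ∀ {n} → N ℕ.≤ n → seq ∣ q ∣² n ℚ.+ δ ℚ.≤ 1ℚ ℚ.* 1ℚ) where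

  -- A rational bound for |q| without a square root: eventually |q|² ≤ 1 - δ = 1 - 2h ≤ (1 - h)².
  h ρ : ℚ
  h = δ ℚ.* ½
  ρ = 1ℚ ℚ.- h
  0<h : 0ℚ ℚ.< h
  0<h = *-pos 0<δ 0<½
  δ≤1 : δ ℚ.≤ 1ℚ
  δ≤1 = ℚ.≤-trans (p≤q+p (0≤+ (0≤square (seq (re q) N)) (0≤square (seq (im q) N)))) (gap ℕ.≤-refl)
  0≤ρ : 0ℚ ℚ.≤ ρ
  0≤ρ = 0≤-difference {h} {1ℚ} (ℚ.≤-trans (p≤p+q {h} {h} (ℚ.<⇒≤ 0<h)) (ℚ.≤-trans (ℚ.≤-reflexive (half+half δ)) δ≤1))
  ρ+h : ρ ℚ.+ h ≡ 1ℚ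
  ρ+h = ≡.sym (a≡a-b+b 1ℚ h)
  ρ<1 : ρ ℚ.< 1ℚ
  ρ<1 = ≡.subst₂ ℚ._<_ (ℚ.+-identityʳ ρ) ρ+h (ℚ.+-monoʳ-< ρ 0<h)
  0<1-ρ : 0ℚ ℚ.< 1ℚ ℚ.- ρ
  0<1-ρ = ≡.subst (ℚ._< 1ℚ ℚ.- ρ) (ℚ.+-inverseʳ ρ) (ℚ.+-monoˡ-< (ℚ.- ρ) ρ<1)
  reciprocal-gap = divide 0<1-ρ 0<1
  κ : ℚ
  κ = proj₁ reciprocal-gap
  0≤κ : 0ℚ ℚ.≤ κ
  0≤κ = ℚ.<⇒≤ (proj₁ (proj₂ reciprocal-gap))
  κ-inverse : κ ℚ.* (1ℚ ℚ.- ρ) ≡ 1ℚ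
  κ-inverse = ≡.trans (ℚ.*-comm κ (1ℚ ℚ.- ρ)) (proj₂ (proj₂ reciprocal-gap))
  q≤ρ : ∥ q ∥≤ ρ
  q≤ρ = bounded 0≤ρ N λ {n} p → ℚ.≤-trans
    (≤-by (1ℚ ℚ.- (seq ∣ q ∣² n ℚ.+ δ)) (0≤-difference (gap p)) (shrink (seq ∣ q ∣² n) δ))
    (≤-by (h ℚ.* h) (0≤square h) (≡.trans (square-complement h) (≡.cong (λ k → (1ℚ ℚ.- k) ℚ.+ h ℚ.* h) (half+half δ))))
  pow≐^ : ∀ z n → pow z n ≐ FiniteSums._^_ (record { isCommutativeRing = ℂ-isCommutativeRing }) z n
  pow≐^ z n = ≡.subst
    (λ p → p ≐ FiniteSums._^_ (record { isCommutativeRing = ℂ-isCommutativeRing }) z n) (pow≡ z n)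
    (FiniteSums.^-independent (record { isCommutativeRing = ℂ-isCommutativeRing }) _≈_ z n)

  factorial-suc : ∀ a b n → ⦅ a ⨾ b ⦆ (suc n) ≐ ⦅ a ⨾ b ⦆ n * (1# - a * pow b n)
  factorial-suc a b n = ≡.subst (λ p → ⦅ a ⨾ b ⦆ (suc n) ≐ ⦅ a ⨾ b ⦆ n * (1# - a * p))
    {RawSemiringDefinitions._^_ (RawRing.rawSemiring ℂ-rawRing) b n} {pow b n} (pow≡ b n) (shiftedFactorial-suc a b n)

  number-sum : ∀ n z → [ n ]⟨ z ⟩ ≐ partialSum (pow z) n
  number-sum n z = ≐-trans
    {[ n ]⟨ z ⟩} {partialSum (RawSemiringDefinitions._^_ (RawRing.rawSemiring ℂ-rawRing) z) n} {partialSum (pow z) n}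
    (q-number-sum n z)
    (partialSum-cong {RawSemiringDefinitions._^_ (RawRing.rawSemiring ℂ-rawRing) z} {pow z} (pow≡ z) n)

  final :
    Σ[ d ∈ (∀ k → pow (⦅ pow q 4 ⨾ pow q 4 ⦆ k) 3 #0) ]
    Σ[ P₂ ∈ ℂ ] Σ[ P₃ ∈ ℂ ] Σ[ P₄ ∈ ℂ ] Σ[ P₅ ∈ ℂ ] Σ[ P₆ ∈ ℂ ]
    Σ[ d∞ ∈ pow P₄ 2 #0 ]
    (⦅ pow q 2 ⨾ pow q 4 ⦆∞≈ P₂) × (⦅ pow q 3 ⨾ pow q 4 ⦆∞≈ P₃) × (⦅ pow q 4 ⨾ pow q 4 ⦆∞≈ P₄) ×
    (⦅ pow q 5 ⨾ pow q 4 ⦆∞≈ P₅) × (⦅ pow q 6 ⨾ pow q 4 ⦆∞≈ P₆) ×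
    (Σ∞ (λ k →
    pow q (k ℕ.^ 2) * [ 6 ℕ.* k ℕ.+ 1 ]⟨ q ⟩
    * (pow (⦅ q ⨾ pow q 2 ⦆ k) 2 * ⦅ pow q 2 ⨾ pow q 4 ⦆ k)
    / pow (⦅ pow q 4 ⨾ pow q 4 ⦆ k) 3 ⟨ d k ⟩)
    ≈ ((1# + q) * P₂ * P₆ / pow P₄ 2 ⟨ d∞ ⟩)) ×
    (Σ∞ (λ k →
    pow (- 1#) k * pow q (3 ℕ.* k ℕ.^ 2) * [ 6 ℕ.* k ℕ.+ 1 ]⟨ q ⟩
    * pow (⦅ q ⨾ pow q 2 ⦆ k) 3
    / pow (⦅ pow q 4 ⨾ pow q 4 ⦆ k) 3 ⟨ d k ⟩)
    ≈ (P₃ * P₅ / pow P₄ 2 ⟨ d∞ ⟩))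
  final = Evaluation.InDisk.Realisation.evaluation (record { isCommutativeRing = ℂ-isCommutativeRing }) ℂ-norm
    0≤ρ ρ<1 0≤κ κ-inverse q q≤ρ
    1# ≐-refl _+_ (λ _ _ → ≐-refl) _*_ (λ _ _ → ≐-refl) (-_) (λ _ → ≐-refl) _-_ minus pow pow≐^
    partialSum (λ _ → ≐-refl) (λ _ _ → ≐-refl)
    ⦅_⨾_⦆ (λ _ _ → ≐-refl) factorial-suc [_]⟨_⟩ number-sum
    _#0 (λ z w → unit⇒#0 {z} {w}) _/_⟨_⟩ /-unit _⟶_ (λ u l → ⇢⇒⟶ {u} {l})

pow-refl : ∀ z n → RawSemiringDefinitions._^_ (RawRing.rawSemiring ℂ-rawRing) z n ≡ z ^ n
pow-refl z n = ≡.refl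

theorem1p1 : (q : ℂ) → ∣ q ∣< 1ᴿ →
    Σ[ d ∈ (∀ k → ⦅ q ^ 4 ⨾ q ^ 4 ⦆ k ^ 3 #0) ]
    Σ[ P₂ ∈ ℂ ] Σ[ P₃ ∈ ℂ ] Σ[ P₄ ∈ ℂ ] Σ[ P₅ ∈ ℂ ] Σ[ P₆ ∈ ℂ ]
    Σ[ d∞ ∈ P₄ ^ 2 #0 ]
    (⦅ q ^ 2 ⨾ q ^ 4 ⦆∞≈ P₂) × (⦅ q ^ 3 ⨾ q ^ 4 ⦆∞≈ P₃) × (⦅ q ^ 4 ⨾ q ^ 4 ⦆∞≈ P₄) ×
    (⦅ q ^ 5 ⨾ q ^ 4 ⦆∞≈ P₅) × (⦅ q ^ 6 ⨾ q ^ 4 ⦆∞≈ P₆) ×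
    (Σ∞ (λ k →
    q ^ (k ℕ.^ 2) * [ 6 ℕ.* k ℕ.+ 1 ]⟨ q ⟩
    * (⦅ q ⨾ q ^ 2 ⦆ k ^ 2 * ⦅ q ^ 2 ⨾ q ^ 4 ⦆ k)
    / ⦅ q ^ 4 ⨾ q ^ 4 ⦆ k ^ 3 ⟨ d k ⟩)
    ≈ ((1# + q) * P₂ * P₆ / P₄ ^ 2 ⟨ d∞ ⟩)) ×
    (Σ∞ (λ k →
    (- 1#) ^ k * q ^ (3 ℕ.* k ℕ.^ 2) * [ 6 ℕ.* k ℕ.+ 1 ]⟨ q ⟩
    * ⦅ q ⨾ q ^ 2 ⦆ k ^ 3
    / ⦅ q ^ 4 ⨾ q ^ 4 ⦆ k ^ 3 ⟨ d k ⟩)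
    ≈ (P₃ * P₅ / P₄ ^ 2 ⟨ d∞ ⟩))
theorem1p1 q (δ , 0<δ , N , gap) = Final.final _ pow-refl q δ 0<δ N gap
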